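{- Let $n\geq 2$ be an integer. Then the discriminant of the homogenized fibotomic polynomial $\Psi_n(x,y)$, regarded as a polynomial in $x$, is $$\begin{cases} \dfrac{(-1)^{\lfloor\varphi(n)/2\rfloor}(2n)^{\varphi(n)}y^{\varphi(n)(\varphi(n)-1)}}{p^{p^{\alpha-1}+1}}&\text{if $n=p^\alpha$ for some prime $p$ and some positive integer $\alpha$};\\[2ex] \dfrac{(-1)^{\varphi(n)/2}(2n)^{\varphi(n)}y^{\varphi(n)(\varphi(n)-1)}}{\prod_{p\mid n}p^{\varphi(n)/(p-1)}}&\text{otherwise}, \end{cases}$$ where the product runs over the primes $p$ dividing $n$.
   Context: The Fibonacci polynomials are defined by $F_1(x)=1$, $F_2(x)=x$, and $F_n(x)=xF_{n-1}(x)+F_{n-2}(x)$ for $n\geq 3$. For $n\geq 2$, the $n$-th fibotomic polynomial $\Psi_n(x)$ is the product of the monic irreducible factors (in $\mathbb{Z}[x]$) of $F_n(x)$ which are not factors of $F_k(x)$ for any $k<n$; also $\Psi_1(x)=1$, so that $F_n(x)=\prod_{d\mid n}\Psi_d(x)$. Equivalently, $\Psi_n(x)=\prod_{1\le s\le n,\ \gcd(s,n)=1}\left(x-2i\cos\frac{\pi s}{n}\right)$ for $n\ge2$, so $\deg\Psi_n=\varphi(n)$, where $\varphi$ is Euler's totient function. The homogenized fibotomic polynomial is $\Psi_1(x,y)=1$ and $\Psi_n(x,y)=y^{\varphi(n)}\Psi_n(x/y)$ for $n\geq 2$. -}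

module Defs where

open import Level using (0ℓ)
open import Data.Nat as ℕ using (ℕ; zero; suc; _∸_; _≤_)
open import Data.Nat.DivMod using (_/_)
open import Data.Nat.Divisibility using (_∣?_)
open import Data.Nat.Coprimality using (coprime?)
open import Data.Nat.Primality using (Prime; prime?)
open import Data.Integer as ℤ using (ℤ)
open import Data.Fin using (Fin; punchIn; toℕ)
import Data.Fin as Fin
open import Data.List using (List; []; _∷_; map; filter; upTo; length; replicate; _++_; foldr)
open import Data.Product using (Σ; _×_; ∃)
open import Relation.Nullary.Decidable using (_×-dec_)
open import Relation.Binary.PropositionalEquality using (_≡_)
open import Relation.Nullary using (yes; no; ¬_)
open import Algebra.Bundles.Raw using (RawRing)

range1 : ℕ → List ℕ
range1 n = map suc (upTo n)

divisors : ℕ → List ℕ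
divisors n = filter (λ d → d ∣? n) (range1 n)

φ : ℕ → ℕ
φ n = length (filter (λ s → coprime? s n) (range1 n))

primeDivisors : ℕ → List ℕ
primeDivisors n = filter (λ p → prime? p ×-dec (p ∣? n)) (range1 n)

-- natural-number division, with the (never used) convention m / 0 = 0
divBy : ℕ → ℕ → ℕ
divBy m zero    = 0
divBy m (suc k) = m / suc k

prodℕ : List ℕ → ℕ
prodℕ = foldr ℕ._*_ 1

IsPrimePower : ℕ → Set
IsPrimePower n = Σ ℕ λ p → Σ ℕ λ α → Prime p × 1 ≤ α × n ≡ p ℕ.^ α

-- Polynomials over a (raw) commutative ring, as coefficient lists
-- (constant coefficient first).  Trailing zeros are allowed; equality
-- is coefficientwise.

module PolyOver (R : RawRing 0ℓ 0ℓ) where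
  open RawRing R

  Poly : Set
  Poly = List Carrier

  coeff : Poly → ℕ → Carrier
  coeff []       _       = 0#
  coeff (a ∷ p)  zero    = a
  coeff (a ∷ p)  (suc k) = coeff p k

  _≈ₚ_ : Poly → Poly → Set
  p ≈ₚ q = ∀ k → coeff p k ≈ coeff q k

  _+ₚ_ : Poly → Poly → Poly
  []      +ₚ q       = q
  (a ∷ p) +ₚ []      = a ∷ p
  (a ∷ p) +ₚ (b ∷ q) = (a + b) ∷ (p +ₚ q)

  scale : Carrier → Poly → Poly
  scale c = map (c *_)

  -ₚ_ : Poly → Poly
  -ₚ_ = map -_

  _*ₚ_ : Poly → Poly → Poly
  []      *ₚ q = []
  (a ∷ p) *ₚ q = scale a q +ₚ (0# ∷ (p *ₚ q))

  oneₚ : Poly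
  oneₚ = 1# ∷ []

  shiftX : Poly → Poly
  shiftX p = 0# ∷ p

  const : Carrier → Poly
  const c = c ∷ []

  monomial : Carrier → ℕ → Poly
  monomial c e = replicate e 0# ++ (c ∷ [])

  prodₚ : List Poly → Poly
  prodₚ = foldr _*ₚ_ oneₚ

  natMul : ℕ → Carrier → Carrier
  natMul zero    a = 0#
  natMul (suc k) a = a + natMul k a

  pow : Carrier → ℕ → Carrier
  pow a zero    = 1#
  pow a (suc k) = a * pow a k

  deriv : Poly → Poly
  deriv []      = []
  deriv (_ ∷ p) = go 1 p
    where
    go : ℕ → Poly → Poly
    go k []      = []
    go k (a ∷ q) = natMul k a ∷ go (suc k) q

  sumFin : ∀ {m} → (Fin m → Carrier) → Carrier
  sumFin {zero}  f = 0#
  sumFin {suc m} f = f Fin.zero + sumFin (λ j → f (Fin.suc j))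

  det : ∀ {m} → (Fin m → Fin m → Carrier) → Carrier
  det {zero}  M = 1#
  det {suc m} M =
    sumFin (λ j → pow (- 1#) (toℕ j) * (M Fin.zero j *
                  det (λ r c → M (Fin.suc r) (punchIn j c))))

  -- Sylvester matrix of f (formal degree m) and g (formal degree k):
  -- k rows of shifted coefficients of f, then m rows of shifted
  -- coefficients of g, leading coefficients first.
  sylvEntry : Poly → ℕ → ℕ → ℕ → Carrier
  sylvEntry f m i j with j ℕ.<? i
  ... | yes _ = 0#
  ... | no  _ with m ℕ.<? (j ∸ i)
  ...   | yes _ = 0#
  ...   | no  _ = coeff f (m ∸ (j ∸ i))

  sylvester : (f : Poly) (m : ℕ) (g : Poly) (k : ℕ) →
              Fin (k ℕ.+ m) → Fin (k ℕ.+ m) → Carrier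
  sylvester f m g k i j with toℕ i ℕ.<? k
  ... | yes _ = sylvEntry f m (toℕ i) (toℕ j)
  ... | no  _ = sylvEntry g k (toℕ i ∸ k) (toℕ j)

  resultant : Poly → ℕ → Poly → ℕ → Carrier
  resultant f m g k = det (sylvester f m g k)

  IsDiscriminant : Poly → ℕ → Carrier → Set
  IsDiscriminant f d Δ =
    coeff f d * Δ ≈ pow (- 1#) ((d ℕ.* (d ∸ 1)) / 2) * resultant f d (deriv f) (d ∸ 1)

  polyRawRing : RawRing 0ℓ 0ℓ
  polyRawRing = record
    { Carrier = Poly ; _≈_ = _≈ₚ_ ; _+_ = _+ₚ_ ; _*_ = _*ₚ_
    ; -_ = -ₚ_ ; 0# = [] ; 1# = oneₚ }

-- ℤ[x] (also used as ℤ[y]) and ℤ[y][x]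

module Zx = PolyOver ℤ.+-*-rawRing
module Zyx = PolyOver (Zx.polyRawRing)

open Zx using () renaming (Poly to ℤ[X]) public

F : ℕ → ℤ[X]
F zero          = []
F (suc zero)    = ℤ.+ 1 ∷ []
F (suc (suc n)) = Zx._+ₚ_ (Zx.shiftX (F (suc n))) (F n)

-- The defining property of the fibotomic polynomials:
-- Ψ_1 = 1 and F_n = ∏_{d ∣ n} Ψ_d for all n ≥ 1
-- (this determines Ψ uniquely, ℤ[x] being an integral domain).
IsFibotomic : (ℕ → ℤ[X]) → Set
IsFibotomic Ψ =
  Zx._≈ₚ_ (Ψ 1) Zx.oneₚ ×
  (∀ n → 1 ≤ n → Zx._≈ₚ_ (F n) (Zx.prodₚ (map Ψ (divisors n))))

-- homogenization  y^{φ(n)} P(x/y)  of a polynomial P of degree φ(n),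
-- as a polynomial in x with coefficients in ℤ[y]:
-- coefficient of x^k is  c_k · y^{φ(n) - k}
homogenize : ℕ → ℤ[X] → Zyx.Poly
homogenize d P = map (λ k → Zx.monomial (Zx.coeff P k) (d ∸ k)) (upTo (suc d))

numerator : ℕ → ℕ → ℤ[X]
numerator s n =
  Zx.monomial ((ℤ.- ℤ.+ 1) ℤ.^ s ℤ.* (ℤ.+ (2 ℕ.* n)) ℤ.^ φ n) (φ n ℕ.* (φ n ∸ 1))

{-# OPTIONS --safe #-}
-- Put ψ = Ψ_n and d = φ(n), and let N be the norm of ℤ[x]/ψ over ℤ.  The Sylvester determinant of ψ and g is
-- N(g), and homogenizing multiplies it by a power of y, so the discriminant is N(ψ′) up to sign.  Write F_n = ψ T,
-- w = x² + 4 and L_n = F_{n+1} + F_{n−1}.  Then w F_n′ = n L_n − x F_n becomes w ψ′ T = n L_n modulo ψ, where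
-- L_n² = w F_n² ± 4 = ±4, whence |N(w) N(T) N(ψ′)| = (2n)^d.
--
-- To find N(w) and N(T), adjoin a root z of z² − xz − 1 and put z̄ = x − z = −1/z, q = z/z̄ = −z².  By Binet's
-- formula F_m (z − z̄) = z̄^m (q^m − 1), and (z − z̄)² = w.  Let p be a prime factor of n, m = n/p, u = q^m − 1.
-- Modulo ψ we have 0 = 1 + q^m + … + q^((p−1)m) = u^(p−1) + p(1 + uh), which forces 1 + uh to be a unit; taking
-- norms, |N(F_m)² N(w)|^(p−1) = p^(2d).  If n is a power of p, then (q − 1)^d is p times a unit as well, because
-- q^m ≡ 1 + (q − 1)^m mod p(q − 1); so |N(w)| = p².  Otherwise |N(w)| divides powers of two primes and is 1, and
-- so is |N(Ψ_e)| whenever two primes divide n/e, so that |N(T)| is the product of the |N(F_{n/p})|.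
--
-- For n ≥ 3, ψ is even with positive constant term.  Then ψ′ = x h with h even, N(x) = ψ(0), and N(h) is a square
-- since multiplication by h preserves the even and the odd polynomials and acts by the same matrix on both.
module Submission where

open import Level using (0ℓ)
open import Defs
open import Algebra.Bundles using (CommutativeRing)
open import Algebra.Bundles.Raw using (RawRing)
import Algebra.Properties.CommutativeSemiring.Exp
import Algebra.Properties.Ring
import Algebra.Properties.Semiring.Exp
import Algebra.Properties.Semiring.Mult.TCOptimised
import Algebra.Solver.Ring
import Algebra.Solver.Ring.AlmostCommutativeRing as ACR
open import Data.Empty using (⊥-elim)
import Data.Fin as Fin
open import Data.Fin.Induction using (<-weakInduction)
import Data.Fin.Properties as Finₚ
open import Data.Integer as ℤ using (ℤ; +_; -[1+_]; _⊖_; 0ℤ; 1ℤ; -1ℤ)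
import Data.Integer.Properties as ℤₚ
open import Data.Integer.Solver using () renaming (module +-*-Solver to ℤ-Solver)
open import Data.List using ([]; _∷_; _++_; map; filter; foldr; length; upTo; applyUpTo)
import Data.List.Properties as Listₚ
open import Data.List.Relation.Unary.All using ([]; _∷_)
open import Data.Maybe using (Maybe; just; nothing)
open import Data.Bool using (true; false; if_then_else_)
open import Data.Nat as ℕ using (ℕ; zero; suc; _∸_; z≤n; s≤s)
open import Data.Nat.Coprimality using (Coprime; coprime?; coprime⇒gcd≡1; gcd≡1⇒coprime; 1-coprimeTo)
open import Data.Nat.Primality using (Prime; prime?; euclidsLemma; prime⇒nonZero; prime⇒nonTrivial)
import Data.Nat.Properties as ℕₚ
open import Data.Nat.Solver using () renaming (module +-*-Solver to ℕ-Solver)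
open import Data.Sum as Sum using (_⊎_; inj₁; inj₂; [_,_]′)
open import Function using (_∘_; id)
open import Relation.Binary.Definitions using (tri<; tri≈; tri>)
import Relation.Binary.PropositionalEquality as ≡
import Relation.Binary.Reasoning.Setoid
open import Relation.Nullary using (Dec; yes; no; ¬_)
open import Relation.Nullary.Decidable using (_×-dec_)
open import Relation.Unary using (Pred; Decidable)
open ≡ using (_≡_)

-- The main obstacle is where to cancel. Binet's formula gives the relation for the geometric sum
-- only after multiplication by F_m (z - z̄), and modulo ψ this factor might be a zero divisor. It
-- is therefore cancelled in ℤ[x][z], where F_m (z - z̄)² = F_m w is a monic polynomial in x, and
-- only the result is reduced modulo ψ. Nothing is used about roots or irreducibility of ψ: it
-- enters as a monic polynomial dividing F_n / F_m for m = n/p, and its norm is an integer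
-- determinant. The congruences hold modulo pu and not merely modulo p, because the cofactor of p
-- must be 1 modulo u for the unit argument to work. Absolute values turn the norm relations into
-- equations between natural numbers, where squaring and (p - 1)-th powers are injective; this takes
-- the place of division. The price is the sign, recovered from parity, and there n = 2 is
-- exceptional because Ψ_2 = x is odd. The value φ(p^(a+1)) = p^a (p - 1) and the divisibility of
-- φ(n) by p - 1 come out of comparing degrees and exponents.

module IntegerSolver (R : CommutativeRing 0ℓ 0ℓ) where
  open CommutativeRing R
  open Algebra.Properties.Ring ring
  open Algebra.Properties.Semiring.Mult.TCOptimised semiring
  open Relation.Binary.Reasoning.Setoid setoid

  -- Integers serve as solver coefficients because their equality is decidable, while equality in R
  -- need not be. Constants such as 4 or -1 then normalize in every ring used below.
  ι : ℤ → Carrier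
  ι (+ n)    = n × 1#
  ι -[1+ n ] = - (suc n × 1#)

  suc-× : ∀ n → suc n × 1# ≈ 1# + n × 1#
  suc-× n = ×-homo-+ 1# 1 n

  ι-⊖ : ∀ m n → ι (m ⊖ n) ≈ m × 1# + - (n × 1#)
  ι-⊖ m zero = sym (trans (+-congˡ -0#≈0#) (+-identityʳ _))
  ι-⊖ zero (suc n) = sym (+-identityˡ _)
  ι-⊖ (suc m) (suc n) = begin
    ι (suc m ⊖ suc n)                       ≡⟨ ≡.cong ι (ℤₚ.[1+m]⊖[1+n]≡m⊖n m n) ⟩
    ι (m ⊖ n)                               ≈⟨ ι-⊖ m n ⟩
    a + - b                                 ≈⟨ +-congʳ (sym (+-identityʳ a)) ⟩
    (a + 0#) + - b                          ≈⟨ +-congʳ (+-congˡ (sym (-‿inverseʳ 1#))) ⟩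
    (a + (1# + - 1#)) + - b                 ≈⟨ +-congʳ (sym (+-assoc _ _ _)) ⟩
    ((a + 1#) + - 1#) + - b                 ≈⟨ +-assoc _ _ _ ⟩
    (a + 1#) + (- 1# + - b)                 ≈⟨ +-cong (+-comm a 1#) (-‿+-comm 1# b) ⟩
    (1# + a) + - (1# + b)                   ≈⟨ +-cong (sym (suc-× m)) (-‿cong (sym (suc-× n))) ⟩
    suc m × 1# + - (suc n × 1#)             ∎
    where
    a = m × 1#
    b = n × 1#

  ι-neg : ∀ i → ι (ℤ.- i) ≈ - ι i
  ι-neg (+ zero)  = sym -0#≈0#
  ι-neg (+ suc n) = refl
  ι-neg -[1+ n ]  = sym (-‿involutive _)

  ι-+ : ∀ i j → ι (i ℤ.+ j) ≈ ι i + ι j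
  ι-+ (+ m) (+ n) = ×-homo-+ 1# m n
  ι-+ (+ m) -[1+ n ] = ι-⊖ m (suc n)
  ι-+ -[1+ m ] (+ n) = trans (ι-⊖ n (suc m)) (+-comm _ _)
  ι-+ -[1+ m ] -[1+ n ] = trans (-‿cong (begin
      suc (suc (m ℕ.+ n)) × 1#   ≡⟨ ≡.cong (_× 1#) (≡.sym (≡.cong suc (ℕₚ.+-suc m n))) ⟩
      (suc m ℕ.+ suc n) × 1#     ≈⟨ ×-homo-+ 1# (suc m) (suc n) ⟩
      suc m × 1# + suc n × 1#    ∎)) (sym (-‿+-comm _ _))
    where import Data.Nat.Properties as ℕₚ

  ι-*⁺ : ∀ m n → ι (+ (m ℕ.* n)) ≈ ι (+ m) * ι (+ n)
  ι-*⁺ m n = ×1-homo-* m n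

  ι-*⁺ˡ : ∀ m j → ι (+ m ℤ.* j) ≈ ι (+ m) * ι j
  ι-*⁺ˡ m (+ n) = trans (reflexive (≡.cong ι (≡.sym (ℤₚ.pos-* m n)))) (ι-*⁺ m n)
  ι-*⁺ˡ m -[1+ n ] = begin
    ι (+ m ℤ.* -[1+ n ])        ≡⟨ ≡.cong ι (≡.sym (ℤₚ.neg-distribʳ-* (+ m) (+ suc n))) ⟩
    ι (ℤ.- (+ m ℤ.* + suc n))   ≈⟨ ι-neg (+ m ℤ.* + suc n) ⟩
    - ι (+ m ℤ.* + suc n)       ≈⟨ -‿cong (ι-*⁺ˡ m (+ suc n)) ⟩
    - (ι (+ m) * ι (+ suc n))   ≈⟨ -‿distribʳ-* _ _ ⟩
    ι (+ m) * - ι (+ suc n)     ∎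

  ι-* : ∀ i j → ι (i ℤ.* j) ≈ ι i * ι j
  ι-* (+ m) j = ι-*⁺ˡ m j
  ι-* -[1+ m ] j = begin
    ι (-[1+ m ] ℤ.* j)          ≡⟨ ≡.cong ι (≡.sym (ℤₚ.neg-distribˡ-* (+ suc m) j)) ⟩
    ι (ℤ.- (+ suc m ℤ.* j))     ≈⟨ ι-neg (+ suc m ℤ.* j) ⟩
    - ι (+ suc m ℤ.* j)         ≈⟨ -‿cong (ι-*⁺ˡ (suc m) j) ⟩
    - (ι (+ suc m) * ι j)       ≈⟨ -‿distribˡ-* _ _ ⟩
    - ι (+ suc m) * ι j         ∎

  morphism : ℤ.+-*-rawRing ACR.-Raw-AlmostCommutative⟶ ACR.fromCommutativeRing R
  morphism = record
    { ⟦_⟧ = ι ; +-homo = ι-+ ; *-homo = ι-* ; -‿homo = ι-neg ; 0-homo = refl ; 1-homo = refl }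

  coeff≟ : ∀ i j → Maybe (ι i ≈ ι j)
  coeff≟ i j with i ℤ.≟ j
  ... | yes i≡j = just (reflexive (≡.cong ι i≡j))
  ... | no  _   = nothing

  open Algebra.Solver.Ring ℤ.+-*-rawRing (ACR.fromCommutativeRing R) morphism coeff≟ public
    using (solve; _:=_; _:+_; _:*_; :-_; _:-_; _:^_; con; Polynomial)

open import Data.Product using (Σ; ∃-syntax; _×_; _,_; proj₁; proj₂)

-- Units in commutative rings

module Binomials where
  open import Data.Nat.Divisibility using (_∣_; ∣⇒≤; m∣m*n)
  open ≡ using (refl; cong; cong₂; sym; trans; subst)

  -- Pascal's rule is the defining equation, which is the form consumed by `horner-pascal`.
  C : ℕ → ℕ → ℕ
  C n       zero    = 1
  C zero    (suc k) = 0
  C (suc n) (suc k) = C n k ℕ.+ C n (suc k)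

  C-zero : ∀ n k → n ℕ.< k → C n k ≡ 0
  C-zero zero    (suc k) _         = refl
  C-zero (suc n) (suc k) (s≤s n<k) = cong₂ ℕ._+_ (C-zero n k n<k) (C-zero n (suc k) (ℕₚ.m<n⇒m<1+n n<k))

  C-diag : ∀ n → C n n ≡ 1
  C-diag zero    = refl
  C-diag (suc n) = trans (cong₂ ℕ._+_ (C-diag n) (C-zero n (suc n) ℕₚ.≤-refl)) refl

  -- The absorption identity stands in for the factorial formula, so that divisibility by a prime
  -- can be argued without fractions.
  C-absorb : ∀ n k → suc k ℕ.* C (suc n) (suc k) ≡ suc n ℕ.* C n k
  C-absorb zero    zero    = refl
  C-absorb zero    (suc k) = ℕₚ.*-zeroʳ k
  C-absorb (suc n) zero    = trans (ℕₚ.*-identityˡ _) (trans (cong suc (C-1 n)) (sym (ℕₚ.*-identityʳ (suc (suc n)))))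
    where
    C-1 : ∀ n → C (suc n) 1 ≡ suc n
    C-1 zero    = refl
    C-1 (suc n) = cong suc (C-1 n)
  C-absorb (suc n) (suc k) = begin
    suc (suc k) ℕ.* (C (suc n) (suc k) ℕ.+ C (suc n) (suc (suc k)))
      ≡⟨ solve 3 (λ k a b → (con 2 :+ k) :* (a :+ b) := a :+ ((con 1 :+ k) :* a :+ (con 2 :+ k) :* b)) refl k (C (suc n) (suc k)) (C (suc n) (suc (suc k))) ⟩
    C (suc n) (suc k) ℕ.+ (suc k ℕ.* C (suc n) (suc k) ℕ.+ suc (suc k) ℕ.* C (suc n) (suc (suc k)))
      ≡⟨ cong (C (suc n) (suc k) ℕ.+_) (cong₂ ℕ._+_ (C-absorb n k) (C-absorb n (suc k))) ⟩
    C (suc n) (suc k) ℕ.+ (suc n ℕ.* C n k ℕ.+ suc n ℕ.* C n (suc k))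
      ≡⟨ cong (C (suc n) (suc k) ℕ.+_) (sym (ℕₚ.*-distribˡ-+ (suc n) (C n k) (C n (suc k)))) ⟩
    suc (suc n) ℕ.* C (suc n) (suc k) ∎
    where
    open ≡.≡-Reasoning
    open ℕ-Solver

  -- By absorption p divides k C(p,k), and it cannot divide k because 0 < k < p.
  prime∣C : ∀ {p} → Prime p → ∀ k → 1 ℕ.≤ k → k ℕ.< p → p ∣ C p k
  prime∣C {suc p} pr (suc k) _ k<p with euclidsLemma (suc k) (C (suc p) (suc k)) pr
    (subst (suc p ∣_) (sym (C-absorb p k)) (m∣m*n (C p k)))
  ... | inj₁ p∣k = ⊥-elim (ℕₚ.<⇒≱ k<p (∣⇒≤ p∣k))
  ... | inj₂ p∣C = p∣C

module GeometricSums (B : CommutativeRing 0ℓ 0ℓ) where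
  open import Data.Nat.Divisibility using (divides)
  open CommutativeRing B
  open IntegerSolver B
  open Algebra.Properties.Semiring.Exp semiring
  open Algebra.Properties.CommutativeSemiring.Exp commutativeSemiring using (^-distrib-*)
  open Relation.Binary.Reasoning.Setoid setoid
  open Binomials

  ν : ℕ → Carrier
  ν n = ι (+ n)

  Unit : Carrier → Set
  Unit a = ∃[ b ] a * b ≈ 1#

  geometric : Carrier → ℕ → Carrier
  geometric q zero    = 0#
  geometric q (suc n) = 1# + q * geometric q n

  geometric-telescope : ∀ q n → q ^ n ≈ 1# + (q - 1#) * geometric q n
  geometric-telescope q zero    = solve 1 (λ q → con (+ 1) := con (+ 1) :+ (q :- con (+ 1)) :* con (+ 0)) refl q
  geometric-telescope q (suc n) = trans (*-congˡ (geometric-telescope q n))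
    (solve 2 (λ q g → q :* (con (+ 1) :+ (q :- con (+ 1)) :* g) := con (+ 1) :+ (q :- con (+ 1)) :* (con (+ 1) :+ q :* g)) refl q (geometric q n))

  geometric-cong : ∀ {q q′} n → q ≈ q′ → geometric q n ≈ geometric q′ n
  geometric-cong zero    e = refl
  geometric-cong (suc n) e = +-congˡ (*-cong e (geometric-cong n e))

  module _ (u : Carrier) where

    -- C(n,k) + C(n,k+1) u + … (N terms), in Horner form.
    horner : ℕ → ℕ → ℕ → Carrier
    horner n k zero    = 0#
    horner n k (suc N) = ν (C n k) + u * horner n (suc k) N

    horner-pascal : ∀ n k N → horner (suc n) (suc k) N ≈ horner n k N + horner n (suc k) N
    horner-pascal n k zero    = sym (+-identityˡ 0#)
    horner-pascal n k (suc N) = trans (+-cong (ι-+ (+ C n k) (+ C n (suc k))) (*-congˡ (horner-pascal n (suc k) N)))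
      (solve 5 (λ u a b x y → (a :+ b) :+ u :* (x :+ y) := (a :+ u :* x) :+ (b :+ u :* y)) refl
        u (ν (C n k)) (ν (C n (suc k))) (horner n (suc k) N) (horner n (suc (suc k)) N))

    horner-last : ∀ n k N → n ℕ.< k ℕ.+ N → horner n k (suc N) ≈ horner n k N
    horner-last n k zero    n< = trans (+-cong (reflexive (≡.cong ν (C-zero n k (≡.subst (n ℕ.<_) (ℕₚ.+-identityʳ k) n<)))) (zeroʳ u)) (+-identityʳ 0#)
    horner-last n k (suc N) n< = +-congˡ (*-congˡ (horner-last n (suc k) N (≡.subst (n ℕ.<_) (ℕₚ.+-suc k N) n<)))

    -- Both sides are ((1 + u)^n - 1) / u; the induction on Pascal's rule avoids dividing by u,
    -- which may be a zero divisor.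
    geometric-horner : ∀ n → geometric (1# + u) n ≈ horner n 1 n
    geometric-horner zero    = refl
    geometric-horner (suc n) = sym (begin
      horner (suc n) 1 (suc n)                                   ≈⟨ horner-pascal n 0 (suc n) ⟩
      (1# + u * horner n 1 n) + horner n 1 (suc n)               ≈⟨ +-congˡ (horner-last n 1 n ℕₚ.≤-refl) ⟩
      (1# + u * horner n 1 n) + horner n 1 n                     ≈⟨ solve 2 (λ u h → (con (+ 1) :+ u :* h) :+ h := con (+ 1) :+ (con (+ 1) :+ u) :* h) refl u (horner n 1 n) ⟩
      1# + (1# + u) * horner n 1 n                               ≈⟨ +-congˡ (*-congˡ (sym (geometric-horner n))) ⟩
      1# + (1# + u) * geometric (1# + u) n                       ∎)

    -- Modulo p every coefficient C(p,i) with 0 < i < p disappears, and C(p,p) = 1 leaves the top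
    -- power alone.
    horner-mod-prime : ∀ {p} → Prime p → ∀ k N → 1 ℕ.≤ k → k ℕ.+ N ≡ p → ∃[ h ] horner p k (suc N) ≈ u ^ N + ν p * h
    horner-mod-prime {p} pr k zero 1≤k e = 0# , (begin
      ν (C p k) + u * 0#    ≡⟨ ≡.cong (λ c → ν c + u * 0#) (≡.trans (≡.cong (C p) (≡.trans (≡.sym (ℕₚ.+-identityʳ k)) e)) (C-diag p)) ⟩
      1# + u * 0#           ≈⟨ solve 2 (λ u c → con (+ 1) :+ u :* con (+ 0) := con (+ 1) :+ c :* con (+ 0)) refl u (ν p) ⟩
      1# + ν p * 0#         ∎)
    horner-mod-prime {p} pr k (suc N) 1≤k e
      with prime∣C pr k 1≤k (ℕₚ.≤-trans (ℕₚ.m<m+n k ℕ.z<s) (ℕₚ.≤-reflexive e))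
         | horner-mod-prime pr (suc k) N (s≤s z≤n) (≡.trans (≡.sym (ℕₚ.+-suc k N)) e)
    ... | divides c C≡ | h , eh = ν c + u * h , (begin
      ν (C p k) + u * horner p (suc k) (suc N)     ≈⟨ +-cong (trans (reflexive (≡.cong ν C≡)) (ι-*⁺ c p)) (*-congˡ eh) ⟩
      ν c * ν p + u * (u ^ N + ν p * h)            ≈⟨ solve 5 (λ c p u x h → c :* p :+ u :* (x :+ p :* h) := u :* x :+ p :* (c :+ u :* h)) refl (ν c) (ν p) u (u ^ N) h ⟩
      u * u ^ N + ν p * (ν c + u * h)              ∎)

    -- The constant term C(p,1) = p is kept exact and only the higher coefficients are taken modulo
    -- p. Hence the multiple of p has cofactor 1 + uh, the shape from which a unit is later
    -- extracted.
    geometric-prime : ∀ {p} → Prime p → ∃[ h ] geometric (1# + u) p ≈ u ^ (p ∸ 1) + ν p * (1# + u * h)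
    geometric-prime {zero}        pr = ⊥-elim (ℕ.≢-nonZero⁻¹ 0 {{prime⇒nonZero pr}} ≡.refl)
    geometric-prime {suc zero}    pr = ⊥-elim (ℕ.nonTrivial⇒≢1 {{prime⇒nonTrivial pr}} ≡.refl)
    geometric-prime {p@(suc (suc p′))} pr with horner-mod-prime pr 2 p′ (s≤s z≤n) ≡.refl
    ... | h , eh = h , (begin
      geometric (1# + u) p                         ≈⟨ geometric-horner p ⟩
      ν (C p 1) + u * horner p 2 (suc p′)          ≈⟨ +-cong (reflexive (≡.cong ν C-p-1)) (*-congˡ eh) ⟩
      ν p + u * (u ^ p′ + ν p * h)                 ≈⟨ solve 4 (λ p u x h → p :+ u :* (x :+ p :* h) := u :* x :+ p :* (con (+ 1) :+ u :* h)) refl (ν p) u (u ^ p′) h ⟩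
      u * u ^ p′ + ν p * (1# + u * h)              ∎)
      where
      C-p-1 : C p 1 ≡ p
      C-p-1 = ≡.trans (≡.sym (ℕₚ.*-identityˡ (C p 1))) (≡.trans (C-absorb (suc p′) 0) (ℕₚ.*-identityʳ p))

  module _ (u : Carrier) {p₁ : ℕ} (pr : Prime (suc p₁)) where

    p : ℕ
    p = suc p₁

    -- Errors are tracked as multiples of pu: the factor u is what later keeps the cofactor of p
    -- congruent to 1 modulo u.
    perturb-^ : ∀ x k n → ∃[ k′ ] (x + ν p * u * k) ^ n ≈ x ^ n + ν p * u * k′
    perturb-^ x k zero    = 0# , solve 2 (λ p u → con (+ 1) := con (+ 1) :+ p :* u :* con (+ 0)) refl (ν p) u
    perturb-^ x k (suc n) with perturb-^ x k n
    ... | k′ , e = x * k′ + k * x ^ n + k * (ν p * u * k′) , trans (*-congˡ e)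
      (solve 6 (λ x p u k k′ y → (x :+ p :* u :* k) :* (y :+ p :* u :* k′) := x :* y :+ p :* u :* (x :* k′ :+ k :* y :+ k :* (p :* u :* k′))) refl
        x (ν p) u k k′ (x ^ n))

    -- U is a multiple of u, so the cofactor 1 + Uh supplied by `geometric-prime` is again of the
    -- form 1 + uh; replacing the powers of U by those of u costs a multiple of pu, absorbed in the
    -- same cofactor.
    geometric-perturbed : ∀ m k → let U = u ^ suc m + ν p * u * k in
      ∃[ h ] geometric (1# + U) p ≈ u ^ (suc m ℕ.* p₁) + ν p * (1# + u * h)
    geometric-perturbed m k with geometric-prime (u ^ suc m + ν p * u * k) pr | perturb-^ (u ^ suc m) k p₁
    ... | h , eh | k′ , ek = k′ + (u ^ m + ν p * k) * h , (begin
      geometric (1# + (u ^ suc m + ν p * u * k)) p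
        ≈⟨ eh ⟩
      (u ^ suc m + ν p * u * k) ^ p₁ + ν p * (1# + (u ^ suc m + ν p * u * k) * h)
        ≈⟨ +-congʳ (trans ek (+-congʳ (^-assocʳ u (suc m) p₁))) ⟩
      u ^ (suc m ℕ.* p₁) + ν p * u * k′ + ν p * (1# + (u * u ^ m + ν p * u * k) * h)
        ≈⟨ solve 7 (λ x p u k k′ y h → x :+ p :* u :* k′ :+ p :* (con (+ 1) :+ (u :* y :+ p :* u :* k) :* h) := x :+ p :* (con (+ 1) :+ u :* (k′ :+ (y :+ p :* k) :* h))) refl
             (u ^ (suc m ℕ.* p₁)) (ν p) u k k′ (u ^ m) h ⟩
      u ^ (suc m ℕ.* p₁) + ν p * (1# + u * (k′ + (u ^ m + ν p * k) * h)) ∎)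

    frobenius-algebra : ∀ k x y h → 1# + (1# + (u * x + ν p * u * k) - 1#) * (y + ν p * (1# + u * h))
      ≈ 1# + (u * x * y + ν p * u * (k * y + (x + ν p * k) * (1# + u * h)))
    frobenius-algebra k x y h = +-congˡ (trans (*-congʳ (solve 1 (λ s → con (+ 1) :+ s :- con (+ 1) := s) refl (u * x + ν p * u * k)))
      (solve 6 (λ p u k x y h → (u :* x :+ p :* u :* k) :* (y :+ p :* (con (+ 1) :+ u :* h))
             := u :* x :* y :+ p :* u :* (k :* y :+ (x :+ p :* k) :* (con (+ 1) :+ u :* h))) refl (ν p) u k x y h))

    -- Telescoping gives (1 + U)^p = 1 + U g with g the geometric sum. As U contains u, the part of
    -- g divisible by p contributes a multiple of pu.
    frobenius-step : ∀ m k → (1# + u) ^ suc m ≈ 1# + (u ^ suc m + ν p * u * k) →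
      ∃[ k′ ] (1# + u) ^ (suc m ℕ.* p) ≈ 1# + (u ^ (suc m ℕ.* p) + ν p * u * k′)
    frobenius-step m k ek = k * Y + (u ^ m + ν p * k) * (1# + u * h) , (begin
      (1# + u) ^ (suc m ℕ.* p)              ≈⟨ sym (^-assocʳ (1# + u) (suc m) p) ⟩
      ((1# + u) ^ suc m) ^ p                ≈⟨ ^-congˡ p ek ⟩
      (1# + U) ^ p                          ≈⟨ geometric-telescope (1# + U) p ⟩
      1# + (1# + U - 1#) * geometric (1# + U) p
                                            ≈⟨ +-congˡ (*-congˡ (proj₂ perturbed)) ⟩
      1# + (1# + U - 1#) * (Y + ν p * (1# + u * h))
        ≈⟨ frobenius-algebra k (u ^ m) Y h ⟩
      1# + (u ^ suc m * Y + ν p * u * (k * Y + (u ^ m + ν p * k) * (1# + u * h)))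
        ≈⟨ +-congˡ (+-congʳ (trans (sym (^-homo-* u (suc m) (suc m ℕ.* p₁))) (reflexive (≡.cong (u ^_) (≡.sym (ℕₚ.*-suc (suc m) p₁)))))) ⟩
      1# + (u ^ (suc m ℕ.* p) + ν p * u * (k * Y + (u ^ m + ν p * k) * (1# + u * h))) ∎)
      where
      U = u ^ suc m + ν p * u * k
      Y = u ^ (suc m ℕ.* p₁)
      perturbed = geometric-perturbed m k
      h = proj₁ perturbed

    -- A Frobenius congruence modulo pu instead of modulo p. The exponent p^j is presented as a
    -- successor so that one factor u can be split off u^(p^j).
    frobenius : ∀ j → ∃[ m ] p ℕ.^ j ≡ suc m × ∃[ k ] (1# + u) ^ suc m ≈ 1# + (u ^ suc m + ν p * u * k)
    frobenius zero = 0 , ≡.refl , 0# ,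
      solve 2 (λ u p → (con (+ 1) :+ u) :^ 1 := con (+ 1) :+ (u :^ 1 :+ p :* u :* con (+ 0))) refl u (ν p)
    frobenius (suc j) with frobenius j
    ... | m , em , k , ek = p₁ ℕ.+ m ℕ.* p , ≡.trans (≡.cong (p ℕ.*_) em) (ℕₚ.*-comm p (suc m)) , frobenius-step m k ek

    geometric-frobenius : ∀ j → ∃[ h ] geometric ((1# + u) ^ (p ℕ.^ j)) p ≈ u ^ (p ℕ.^ j ℕ.* p₁) + ν p * (1# + u * h)
    geometric-frobenius j = proj₁ perturbed , ≡.subst
      (λ M → geometric ((1# + u) ^ M) p ≈ u ^ (M ℕ.* p₁) + ν p * (1# + u * proj₁ perturbed))
      (≡.sym (proj₁ (proj₂ fr))) (trans (geometric-cong p (proj₂ (proj₂ (proj₂ fr)))) (proj₂ perturbed))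
      where
      fr = frobenius j
      perturbed = geometric-perturbed (proj₁ fr) (proj₁ (proj₂ (proj₂ fr)))

    -- With s = 1 + uh, u^M = −p s makes s divide both (uh)^M and 1 − (−uh)^M, so s is a unit.
    unit-of-power : ∀ M h → u ^ M + ν p * (1# + u * h) ≈ 0# → ∃[ v ] Unit v × u ^ M ≈ ν p * v
    unit-of-power M h e = - s , (- (g - ν p * (- h) ^ M) , (begin
        - s * - (g - ν p * (- h) ^ M)         ≈⟨ solve 4 (λ s g p y → :- s :* :- (g :- p :* y) := (s :* g :+ y :* :- (p :* s))) refl s g (ν p) ((- h) ^ M) ⟩
        s * g + (- h) ^ M * - (ν p * s)       ≈⟨ +-congˡ (*-congˡ (sym u^M)) ⟩
        s * g + (- h) ^ M * u ^ M             ≈⟨ +-congˡ (sym (^-distrib-* (- h) u M)) ⟩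
        s * g + (- h * u) ^ M                 ≈⟨ +-congˡ (geometric-telescope (- h * u) M) ⟩
        s * g + (1# + (- h * u - 1#) * g)     ≈⟨ solve 3 (λ u h g → (con (+ 1) :+ u :* h) :* g :+ (con (+ 1) :+ (:- h :* u :- con (+ 1)) :* g) := con (+ 1)) refl u h g ⟩
        1#                                    ∎)) ,
      trans u^M (solve 2 (λ p s → :- (p :* s) := p :* :- s) refl (ν p) s)
      where
      s = 1# + u * h
      g = geometric (- h * u) M
      u^M : u ^ M ≈ - (ν p * s)
      u^M = begin
        u ^ M                               ≈⟨ solve 2 (λ x y → x := (x :+ y) :- y) refl (u ^ M) (ν p * s) ⟩
        (u ^ M + ν p * s) - ν p * s         ≈⟨ +-congʳ e ⟩
        0# - ν p * s                        ≈⟨ +-identityˡ (- (ν p * s)) ⟩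
        - (ν p * s)                         ∎

    -- Applied in two ways: with j = 0 and u = q^m - 1 for every prime p dividing n, and with u = q
    -- - 1 when m = p^j.
    prime-associate : ∀ j → geometric ((1# + u) ^ (p ℕ.^ j)) p ≈ 0# →
      ∃[ v ] Unit v × u ^ (p ℕ.^ j ℕ.* p₁) ≈ ν p * v
    prime-associate j e = unit-of-power (p ℕ.^ j ℕ.* p₁) (proj₁ gf) (trans (sym (proj₂ gf)) e)
      where gf = geometric-frobenius j

-- Quotient rings and the adjunction of a root

module Quotient (R : CommutativeRing 0ℓ 0ℓ) (f : CommutativeRing.Carrier R) where
  open CommutativeRing R
  open IntegerSolver R

  infix 4 _~_
  -- The cofactor is stored as data because `M-cong` has to pass it on to `norm-mod`.
  record _~_ (a b : Carrier) : Set where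
    constructor congruent
    field
      cofactor : Carrier
      equation : a ≈ b + cofactor * f
  open _~_ public

  ≈⇒~ : ∀ {a b} → a ≈ b → a ~ b
  ≈⇒~ {a} {b} e = congruent 0# (trans e (solve 2 (λ b f → b := b :+ con (+ 0) :* f) refl b f))

  ~-sym : ∀ {a b} → a ~ b → b ~ a
  ~-sym {a} {b} (congruent h e) = congruent (- h) (trans
    (solve 3 (λ b h f → b := (b :+ h :* f) :+ :- h :* f) refl b h f) (+-congʳ (sym e)))

  ~-trans : ∀ {a b c} → a ~ b → b ~ c → a ~ c
  ~-trans {a} {b} {c} (congruent h e) (congruent k e′) = congruent (h + k) (trans e (trans (+-congʳ e′)
    (solve 4 (λ c h k f → (c :+ k :* f) :+ h :* f := c :+ (h :+ k) :* f) refl c h k f)))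

  ~-+ : ∀ {a a′ b b′} → a ~ a′ → b ~ b′ → a + b ~ a′ + b′
  ~-+ {a} {a′} {b} {b′} (congruent h e) (congruent k e′) = congruent (h + k) (trans (+-cong e e′)
    (solve 5 (λ a b h k f → (a :+ h :* f) :+ (b :+ k :* f) := (a :+ b) :+ (h :+ k) :* f) refl a′ b′ h k f))

  ~-* : ∀ {a a′ b b′} → a ~ a′ → b ~ b′ → a * b ~ a′ * b′
  ~-* {a} {a′} {b} {b′} (congruent h e) (congruent k e′) = congruent (a′ * k + b′ * h + h * k * f) (trans (*-cong e e′)
    (solve 5 (λ a b h k f → (a :+ h :* f) :* (b :+ k :* f) := a :* b :+ (a :* k :+ b :* h :+ h :* k :* f) :* f) refl a′ b′ h k f))

  ~-neg : ∀ {a b} → a ~ b → - a ~ - b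
  ~-neg {a} {b} (congruent h e) = congruent (- h) (trans (-‿cong e)
    (solve 3 (λ b h f → :- (b :+ h :* f) := :- b :+ :- h :* f) refl b h f))

  -- Only the equality is coarser; carrier and operations are those of R. An identity of R thus
  -- holds in the quotient for literally the same elements.
  quotientRing : CommutativeRing 0ℓ 0ℓ
  quotientRing = record
    { Carrier = Carrier ; _≈_ = _~_ ; _+_ = _+_ ; _*_ = _*_ ; -_ = -_ ; 0# = 0# ; 1# = 1#
    ; isCommutativeRing = record
      { isRing = record
        { +-isAbelianGroup = record
          { isGroup = record
            { isMonoid = record
              { isSemigroup = record
                { isMagma = record
                  { isEquivalence = record { refl = ≈⇒~ refl ; sym = ~-sym ; trans = ~-trans }
                  ; ∙-cong = ~-+ }
                ; assoc = λ a b c → ≈⇒~ (+-assoc a b c) }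
              ; identity = (λ a → ≈⇒~ (+-identityˡ a)) , (λ a → ≈⇒~ (+-identityʳ a)) }
            ; inverse = (λ a → ≈⇒~ (-‿inverseˡ a)) , (λ a → ≈⇒~ (-‿inverseʳ a))
            ; ⁻¹-cong = ~-neg }
          ; comm = λ a b → ≈⇒~ (+-comm a b) }
        ; *-cong = ~-*
        ; *-assoc = λ a b c → ≈⇒~ (*-assoc a b c)
        ; *-identity = (λ a → ≈⇒~ (*-identityˡ a)) , (λ a → ≈⇒~ (*-identityʳ a))
        ; distrib = (λ a b c → ≈⇒~ (distribˡ a b c)) , (λ a b c → ≈⇒~ (distribʳ a b c)) }
      ; *-comm = λ a b → ≈⇒~ (*-comm a b) } }

-- R[z]/(z² − xz − 1), with a + bz written as the pair (a , b).
module QuadraticExtension (R : CommutativeRing 0ℓ 0ℓ) (x : CommutativeRing.Carrier R) where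
  open CommutativeRing R
  open IntegerSolver R

  infix 4 _≈²_
  record _≈²_ (s t : Carrier × Carrier) : Set where
    constructor componentwise
    field
      fst≈ : proj₁ s ≈ proj₁ t
      snd≈ : proj₂ s ≈ proj₂ t
  open _≈²_ public

  infixl 7 _*²_
  _*²_ : Carrier × Carrier → Carrier × Carrier → Carrier × Carrier
  (a , b) *² (c , d) = a * c + b * d , a * d + b * c + x * (b * d)

  extension : CommutativeRing 0ℓ 0ℓ
  extension = record
    { Carrier = Carrier × Carrier ; _≈_ = _≈²_
    ; _+_ = λ { (a , b) (c , d) → a + c , b + d } ; _*_ = _*²_
    ; -_ = λ { (a , b) → - a , - b } ; 0# = 0# , 0# ; 1# = 1# , 0#
    ; isCommutativeRing = record
      { isRing = record
        { +-isAbelianGroup = record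
          { isGroup = record
            { isMonoid = record
              { isSemigroup = record
                { isMagma = record
                  { isEquivalence = record
                    { refl = componentwise refl refl
                    ; sym = λ { (componentwise e e′) → componentwise (sym e) (sym e′) }
                    ; trans = λ { (componentwise e e′) (componentwise g g′) → componentwise (trans e g) (trans e′ g′) } }
                  ; ∙-cong = λ { (componentwise e e′) (componentwise g g′) → componentwise (+-cong e g) (+-cong e′ g′) } }
                ; assoc = λ { (a , a′) (b , b′) (c , c′) → componentwise (+-assoc a b c) (+-assoc a′ b′ c′) } }
              ; identity = (λ { (a , b) → componentwise (+-identityˡ a) (+-identityˡ b) })
                         , (λ { (a , b) → componentwise (+-identityʳ a) (+-identityʳ b) }) }
            ; inverse = (λ { (a , b) → componentwise (-‿inverseˡ a) (-‿inverseˡ b) })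
                      , (λ { (a , b) → componentwise (-‿inverseʳ a) (-‿inverseʳ b) })
            ; ⁻¹-cong = λ { (componentwise e e′) → componentwise (-‿cong e) (-‿cong e′) } }
          ; comm = λ { (a , a′) (b , b′) → componentwise (+-comm a b) (+-comm a′ b′) } }
        ; *-cong = λ { (componentwise e e′) (componentwise g g′) → componentwise
            (+-cong (*-cong e g) (*-cong e′ g′))
            (+-cong (+-cong (*-cong e g′) (*-cong e′ g)) (*-congˡ (*-cong e′ g′))) }
        ; *-assoc = λ { (a , b) (c , d) (g , h) → componentwise
            (solve 7 (λ x a b c d g h → (a :* c :+ b :* d) :* g :+ (a :* d :+ b :* c :+ x :* (b :* d)) :* h
               := a :* (c :* g :+ d :* h) :+ b :* (c :* h :+ d :* g :+ x :* (d :* h))) refl x a b c d g h)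
            (solve 7 (λ x a b c d g h → (a :* c :+ b :* d) :* h :+ (a :* d :+ b :* c :+ x :* (b :* d)) :* g :+ x :* ((a :* d :+ b :* c :+ x :* (b :* d)) :* h)
               := a :* (c :* h :+ d :* g :+ x :* (d :* h)) :+ b :* (c :* g :+ d :* h) :+ x :* (b :* (c :* h :+ d :* g :+ x :* (d :* h)))) refl x a b c d g h) }
        ; *-identity = (λ { (a , b) → componentwise
              (solve 2 (λ a b → con (+ 1) :* a :+ con (+ 0) :* b := a) refl a b)
              (solve 3 (λ x a b → con (+ 1) :* b :+ con (+ 0) :* a :+ x :* (con (+ 0) :* b) := b) refl x a b) })
          , (λ { (a , b) → componentwise
              (solve 2 (λ a b → a :* con (+ 1) :+ b :* con (+ 0) := a) refl a b)
              (solve 3 (λ x a b → a :* con (+ 0) :+ b :* con (+ 1) :+ x :* (b :* con (+ 0)) := b) refl x a b) })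
        ; distrib = (λ { (a , b) (c , d) (g , h) → componentwise
              (solve 6 (λ a b c d g h → a :* (c :+ g) :+ b :* (d :+ h) := (a :* c :+ b :* d) :+ (a :* g :+ b :* h)) refl a b c d g h)
              (solve 7 (λ x a b c d g h → a :* (d :+ h) :+ b :* (c :+ g) :+ x :* (b :* (d :+ h))
                := (a :* d :+ b :* c :+ x :* (b :* d)) :+ (a :* h :+ b :* g :+ x :* (b :* h))) refl x a b c d g h) })
          , (λ { (a , b) (c , d) (g , h) → componentwise
              (solve 6 (λ a b c d g h → (c :+ g) :* a :+ (d :+ h) :* b := (c :* a :+ d :* b) :+ (g :* a :+ h :* b)) refl a b c d g h)
              (solve 7 (λ x a b c d g h → (c :+ g) :* b :+ (d :+ h) :* a :+ x :* ((d :+ h) :* b)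
                := (c :* b :+ d :* a :+ x :* (d :* b)) :+ (g :* b :+ h :* a :+ x :* (h :* b))) refl x a b c d g h) }) }
      ; *-comm = λ { (a , b) (c , d) → componentwise
          (solve 4 (λ a b c d → a :* c :+ b :* d := c :* a :+ d :* b) refl a b c d)
          (solve 5 (λ x a b c d → a :* d :+ b :* c :+ x :* (b :* d) := c :* b :+ d :* a :+ x :* (d :* b)) refl x a b c d) } } }

  -- The norm (a + bz)(a + bz̄) down to R, expanded with z + z̄ = x and z z̄ = -1.
  conjugateProduct : Carrier × Carrier → Carrier
  conjugateProduct (a , b) = a * a + x * (a * b) - b * b

  conjugateProduct-* : ∀ s t → conjugateProduct (s *² t) ≈ conjugateProduct s * conjugateProduct t
  conjugateProduct-* (a , b) (c , d) = solve 5 (λ x a b c d →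
    let g = a :* c :+ b :* d ; h = a :* d :+ b :* c :+ x :* (b :* d) in
    g :* g :+ x :* (g :* h) :- h :* h := (a :* a :+ x :* (a :* b) :- b :* b) :* (c :* c :+ x :* (c :* d) :- d :* d))
    refl x a b c d

  conjugateProduct-cong : ∀ {s t} → s ≈² t → conjugateProduct s ≈ conjugateProduct t
  conjugateProduct-cong (componentwise e g) =
    +-cong (+-cong (*-cong e e) (*-congˡ (*-cong e g))) (-‿cong (*-cong g g))

-- Binet's formula

module Binet (B : CommutativeRing 0ℓ 0ℓ) (z z̄ : CommutativeRing.Carrier B)
  (zz̄ : CommutativeRing._≈_ B (CommutativeRing._*_ B z z̄) (CommutativeRing.-_ B (CommutativeRing.1# B)))
  (fib : ℕ → CommutativeRing.Carrier B)
  (fib-0 : CommutativeRing._≈_ B (fib 0) (CommutativeRing.0# B))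
  (fib-1 : CommutativeRing._≈_ B (fib 1) (CommutativeRing.1# B))
  (fib-suc : ∀ n → CommutativeRing._≈_ B (fib (suc (suc n)))
    (CommutativeRing._+_ B (CommutativeRing._*_ B (CommutativeRing._+_ B z z̄) (fib (suc n))) (fib n))) where
  open CommutativeRing B
  open IntegerSolver B
  open Algebra.Properties.Semiring.Exp semiring
  open Algebra.Properties.CommutativeSemiring.Exp commutativeSemiring using (^-distrib-*)
  open Relation.Binary.Reasoning.Setoid setoid
  open GeometricSums B

  δ q : Carrier
  δ = z - z̄
  q = - (z * z)

  binet : ∀ n → fib n * δ ≈ z ^ n - z̄ ^ n
  binet zero = trans (*-congʳ fib-0) (solve 1 (λ d → con (+ 0) :* d := con (+ 1) :- con (+ 1)) refl δ)
  binet (suc zero) = trans (*-congʳ fib-1) (solve 2 (λ a b → con (+ 1) :* (a :- b) := a :^ 1 :- b :^ 1) refl z z̄)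
  binet (suc (suc n)) = begin
    fib (suc (suc n)) * δ                                ≈⟨ *-congʳ (fib-suc n) ⟩
    ((z + z̄) * fib (suc n) + fib n) * δ                  ≈⟨ solve 4 (λ s f g d → (s :* f :+ g) :* d := s :* (f :* d) :+ g :* d) refl (z + z̄) (fib (suc n)) (fib n) δ ⟩
    (z + z̄) * (fib (suc n) * δ) + fib n * δ              ≈⟨ +-cong (*-congˡ (binet (suc n))) (binet n) ⟩
    -- The whole deviation from the target is gathered in the factor z z̄ + 1, which vanishes.
    (z + z̄) * (z * a - z̄ * b) + (a - b)                  ≈⟨ solve 4 (λ z y a b → (z :+ y) :* (z :* a :- y :* b) :+ (a :- b) := z :* (z :* a) :- y :* (y :* b) :+ (z :* y :+ con (+ 1)) :* (a :- b)) refl z z̄ a b ⟩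
    z * (z * a) - z̄ * (z̄ * b) + (z * z̄ + 1#) * (a - b)   ≈⟨ +-congˡ (*-congʳ (+-congʳ zz̄)) ⟩
    z * (z * a) - z̄ * (z̄ * b) + (- 1# + 1#) * (a - b)    ≈⟨ solve 2 (λ s t → s :+ (:- con (+ 1) :+ con (+ 1)) :* t := s) refl (z * (z * a) - z̄ * (z̄ * b)) (a - b) ⟩
    z * (z * a) - z̄ * (z̄ * b)                            ∎
    where
    a = z ^ n
    b = z̄ ^ n

  z̄q : z̄ * q ≈ z
  z̄q = trans (solve 2 (λ z y → y :* :- (z :* z) := :- ((z :* y) :* z)) refl z z̄)
    (trans (-‿cong (*-congʳ zz̄)) (solve 1 (λ z → :- (:- con (+ 1) :* z) := z) refl z))

  binet-q : ∀ n → fib n * δ ≈ z̄ ^ n * (q ^ n - 1#)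
  binet-q n = trans (binet n) (trans (+-congʳ (trans (^-congˡ n (sym z̄q)) (^-distrib-* z̄ q n)))
    (solve 2 (λ a b → a :* b :- a := a :* (b :- con (+ 1))) refl (z̄ ^ n) (q ^ n)))

  z̄-unit : Unit z̄
  z̄-unit = - z , trans (solve 2 (λ z y → y :* :- z := :- (z :* y)) refl z z̄) (trans (-‿cong zz̄) (solve 0 (:- :- con (+ 1) := con (+ 1)) refl))

  Unit-^ : ∀ {a} n → Unit a → Unit (a ^ n)
  Unit-^ {a} n (b , e) = b ^ n , trans (sym (^-distrib-* a b n)) (trans (^-congˡ n e) (1^ n))
    where
    1^ : ∀ n → 1# ^ n ≈ 1#
    1^ zero    = refl
    1^ (suc n) = trans (*-identityˡ _) (1^ n)

  unit-cancel : ∀ {a c} → Unit a → a * c ≈ 0# → c ≈ 0#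
  unit-cancel {a} {c} (b , e) ac = begin
    c              ≈⟨ sym (*-identityˡ c) ⟩
    1# * c         ≈⟨ *-congʳ (sym e) ⟩
    a * b * c      ≈⟨ solve 3 (λ a b c → a :* b :* c := b :* (a :* c)) refl a b c ⟩
    b * (a * c)    ≈⟨ *-congˡ ac ⟩
    b * 0#         ≈⟨ zeroʳ b ⟩
    0#             ∎

  -- By Binet the quotient of F_(m(k+1)) δ by F_m δ should be z̄^(mk) times a geometric sum in q^m.
  -- Since B may have zero divisors, the factor F_m δ is left standing and the comparison with G is
  -- stated as a vanishing product.
  fib-multiple : ∀ m k G → fib (m ℕ.* suc k) ≈ fib m * G →
    fib m * δ * (z̄ ^ (m ℕ.* k) * geometric (q ^ m) (suc k) - G) ≈ 0#
  fib-multiple m k G e = begin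
    fib m * δ * (y * g - G)                    ≈⟨ solve 5 (λ f d y g G → f :* d :* (y :* g :- G) := f :* d :* (y :* g) :- f :* G :* d) refl (fib m) δ y g G ⟩
    fib m * δ * (y * g) - fib m * G * δ        ≈⟨ +-cong (*-congʳ (binet-q m)) (-‿cong (trans (*-congʳ (sym e)) (binet-q (m ℕ.* suc k)))) ⟩
    z̄ ^ m * (q ^ m - 1#) * (y * g) - z̄ ^ (m ℕ.* suc k) * (q ^ (m ℕ.* suc k) - 1#)
      ≈⟨ +-congˡ (-‿cong (*-cong (trans (reflexive (≡.cong (z̄ ^_) (ℕₚ.*-suc m k))) (^-homo-* z̄ m (m ℕ.* k)))
           (+-congʳ (trans (sym (^-assocʳ q m (suc k))) (geometric-telescope (q ^ m) (suc k)))))) ⟩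
    z̄ ^ m * (q ^ m - 1#) * (y * g) - z̄ ^ m * y * (1# + (q ^ m - 1#) * g - 1#)
      ≈⟨ solve 4 (λ a b y g → a :* b :* (y :* g) :- a :* y :* (con (+ 1) :+ b :* g :- con (+ 1)) := con (+ 0)) refl (z̄ ^ m) (q ^ m - 1#) y g ⟩
    0# ∎
    where
    y = z̄ ^ (m ℕ.* k)
    g = geometric (q ^ m) (suc k)

open ≡ hiding (setoid; [_])

-- Polynomials with integer coefficients

module PolynomialRing where
  open Zx using (coeff; scale; oneₚ; shiftX; const)
    renaming (_+ₚ_ to infixl 6 _+ₚ_; _*ₚ_ to infixl 7 _*ₚ_; -ₚ_ to infix 8 -ₚ_)
  open ℤ-Solver

  +-rightCong : ∀ (a : ℤ) {b c : ℤ} → b ≡ c → a ℤ.+ b ≡ a ℤ.+ c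
  +-rightCong a refl = refl

  +-leftCong : ∀ {a b c : ℤ} → a ≡ b → a ℤ.+ c ≡ b ℤ.+ c
  +-leftCong refl = refl

  *-leftCong : ∀ {a b c : ℤ} → a ≡ b → a ℤ.* c ≡ b ℤ.* c
  *-leftCong refl = refl

  infix 4 _≋_
  -- The pointwise equality `Zx._≈ₚ_` is wrapped in a record so that unification can recover p and q
  -- from the type of an equation.
  record _≋_ (p q : ℤ[X]) : Set where
    constructor coeffwise
    field at : ∀ k → coeff p k ≡ coeff q k
  open _≋_ public

  coeff-+ : ∀ p q k → coeff (p +ₚ q) k ≡ coeff p k ℤ.+ coeff q k
  coeff-+ []      q       k       = sym (ℤₚ.+-identityˡ _)
  coeff-+ (a ∷ p) []      k       = sym (ℤₚ.+-identityʳ _)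
  coeff-+ (a ∷ p) (b ∷ q) zero    = refl
  coeff-+ (a ∷ p) (b ∷ q) (suc k) = coeff-+ p q k

  coeff-scale : ∀ c p k → coeff (scale c p) k ≡ c ℤ.* coeff p k
  coeff-scale c []      k       = sym (ℤₚ.*-zeroʳ c)
  coeff-scale c (a ∷ p) zero    = refl
  coeff-scale c (a ∷ p) (suc k) = coeff-scale c p k

  coeff-neg : ∀ p k → coeff (-ₚ p) k ≡ ℤ.- coeff p k
  coeff-neg []      k       = refl
  coeff-neg (a ∷ p) zero    = refl
  coeff-neg (a ∷ p) (suc k) = coeff-neg p k

  coeff-*-zero : ∀ a p q → coeff ((a ∷ p) *ₚ q) 0 ≡ a ℤ.* coeff q 0
  coeff-*-zero a p q = trans (coeff-+ (scale a q) _ 0)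
    (trans (ℤₚ.+-identityʳ _) (coeff-scale a q 0))

  coeff-*-suc : ∀ a p q k →
    coeff ((a ∷ p) *ₚ q) (suc k) ≡ a ℤ.* coeff q (suc k) ℤ.+ coeff (p *ₚ q) k
  coeff-*-suc a p q k = trans (coeff-+ (scale a q) _ (suc k))
    (+-leftCong (coeff-scale a q (suc k)))

  coeff-*-distribʳ : ∀ p q r k → coeff ((p +ₚ q) *ₚ r) k ≡ coeff (p *ₚ r) k ℤ.+ coeff (q *ₚ r) k
  coeff-*-distribʳ []      q       r k       = sym (ℤₚ.+-identityˡ _)
  coeff-*-distribʳ (a ∷ p) []      r k       = sym (ℤₚ.+-identityʳ _)
  coeff-*-distribʳ (a ∷ p) (b ∷ q) r zero
    rewrite coeff-*-zero (a ℤ.+ b) (p +ₚ q) r | coeff-*-zero a p r | coeff-*-zero b q r =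
    ℤₚ.*-distribʳ-+ (coeff r 0) a b
  coeff-*-distribʳ (a ∷ p) (b ∷ q) r (suc k)
    rewrite coeff-*-suc (a ℤ.+ b) (p +ₚ q) r k | coeff-*-suc a p r k | coeff-*-suc b q r k
          | coeff-*-distribʳ p q r k =
    solve 5 (λ a b r x y → (a :+ b) :* r :+ (x :+ y) := (a :* r :+ x) :+ (b :* r :+ y)) refl
      a b (coeff r (suc k)) (coeff (p *ₚ r) k) (coeff (q *ₚ r) k)

  coeff-*-congʳ : ∀ p {q q′} → q ≋ q′ → ∀ k → coeff (p *ₚ q) k ≡ coeff (p *ₚ q′) k
  coeff-*-congʳ []      e k = refl
  coeff-*-congʳ (a ∷ p) {q} {q′} e zero
    rewrite coeff-*-zero a p q | coeff-*-zero a p q′ = cong (a ℤ.*_) (at e 0)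
  coeff-*-congʳ (a ∷ p) {q} {q′} e (suc k)
    rewrite coeff-*-suc a p q k | coeff-*-suc a p q′ k =
    cong₂ (λ x y → a ℤ.* x ℤ.+ y) (at e (suc k)) (coeff-*-congʳ p e k)

  *-[] : ∀ p k → coeff (p *ₚ []) k ≡ 0ℤ
  *-[] []      k       = refl
  *-[] (a ∷ p) zero    = refl
  *-[] (a ∷ p) (suc k) = *-[] p k

  coeff-*-∷-zero : ∀ p b q → coeff (p *ₚ (b ∷ q)) 0 ≡ b ℤ.* coeff p 0
  coeff-*-∷-zero []      b q = sym (ℤₚ.*-zeroʳ b)
  coeff-*-∷-zero (a ∷ p) b q = trans (coeff-*-zero a p (b ∷ q)) (ℤₚ.*-comm a b)

  -- The product recurses on its left factor. Together with `coeff-*-∷-zero` this supplies the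
  -- mirrored recursion on the right factor, and commutativity follows by comparing the two.
  coeff-*-∷-suc : ∀ p b q k →
    coeff (p *ₚ (b ∷ q)) (suc k) ≡ b ℤ.* coeff p (suc k) ℤ.+ coeff (p *ₚ q) k
  coeff-*-∷-suc []      b q k = sym (trans (ℤₚ.+-identityʳ _) (ℤₚ.*-zeroʳ b))
  coeff-*-∷-suc (a ∷ p) b q zero
    rewrite coeff-*-suc a p (b ∷ q) 0 | coeff-*-∷-zero p b q | coeff-*-zero a p q =
    ℤₚ.+-comm (a ℤ.* coeff q 0) _
  coeff-*-∷-suc (a ∷ p) b q (suc k)
    rewrite coeff-*-suc a p (b ∷ q) (suc k) | coeff-*-∷-suc p b q k | coeff-*-suc a p q k =
    solve 3 (λ x y z → x :+ (y :+ z) := y :+ (x :+ z)) refl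
      (a ℤ.* coeff q (suc k)) (b ℤ.* coeff p (suc k)) (coeff (p *ₚ q) k)

  coeff-*-comm : ∀ p q k → coeff (p *ₚ q) k ≡ coeff (q *ₚ p) k
  coeff-*-comm []      q k = sym (*-[] q k)
  coeff-*-comm (a ∷ p) q zero    = trans (coeff-*-zero a p q) (sym (coeff-*-∷-zero q a p))
  coeff-*-comm (a ∷ p) q (suc k) = trans (coeff-*-suc a p q k)
    (trans (+-rightCong (a ℤ.* coeff q (suc k)) (coeff-*-comm p q k)) (sym (coeff-*-∷-suc q a p k)))

  coeff-*-congˡ : ∀ {p p′} q → p ≋ p′ → ∀ k → coeff (p *ₚ q) k ≡ coeff (p′ *ₚ q) k
  coeff-*-congˡ {p} {p′} q e k = trans (coeff-*-comm p q k) (trans (coeff-*-congʳ q e k) (coeff-*-comm q p′ k))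

  scale-* : ∀ c p q k → coeff (scale c p *ₚ q) k ≡ c ℤ.* coeff (p *ₚ q) k
  scale-* c []      q k = sym (ℤₚ.*-zeroʳ c)
  scale-* c (a ∷ p) q zero
    rewrite coeff-*-zero (c ℤ.* a) (scale c p) q | coeff-*-zero a p q = ℤₚ.*-assoc c a _
  scale-* c (a ∷ p) q (suc k)
    rewrite coeff-*-suc (c ℤ.* a) (scale c p) q k | coeff-*-suc a p q k | scale-* c p q k =
    solve 4 (λ c a x y → (c :* a) :* x :+ c :* y := c :* (a :* x :+ y)) refl
      c a (coeff q (suc k)) (coeff (p *ₚ q) k)

  coeff-*-assoc : ∀ p q r k → coeff ((p *ₚ q) *ₚ r) k ≡ coeff (p *ₚ (q *ₚ r)) k
  coeff-*-assoc []      q r k = refl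
  coeff-*-assoc (a ∷ p) q r k = trans (coeff-*-distribʳ (scale a q) _ r k) (trans (cong₂ ℤ._+_
    (trans (scale-* a q r k) (sym (coeff-scale a (q *ₚ r) k))) (shifted k))
    (sym (coeff-+ (scale a (q *ₚ r)) _ k)))
    where
    shifted : ∀ k → coeff ((0ℤ ∷ (p *ₚ q)) *ₚ r) k ≡ coeff (0ℤ ∷ (p *ₚ (q *ₚ r))) k
    shifted zero = coeff-*-zero 0ℤ (p *ₚ q) r
    shifted (suc k) = trans (coeff-*-suc 0ℤ (p *ₚ q) r k) (trans (ℤₚ.+-identityˡ _) (coeff-*-assoc p q r k))

  coeff-*-identityˡ : ∀ p k → coeff (oneₚ *ₚ p) k ≡ coeff p k
  coeff-*-identityˡ p zero    = trans (coeff-*-zero 1ℤ [] p) (ℤₚ.*-identityˡ _)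
  coeff-*-identityˡ p (suc k) = trans (coeff-*-suc 1ℤ [] p k)
    (trans (ℤₚ.+-identityʳ _) (ℤₚ.*-identityˡ _))

  ℤ[x] : CommutativeRing 0ℓ 0ℓ
  ℤ[x] = record
    { Carrier = ℤ[X] ; _≈_ = _≋_ ; _+_ = _+ₚ_ ; _*_ = _*ₚ_ ; -_ = -ₚ_ ; 0# = [] ; 1# = oneₚ
    ; isCommutativeRing = record
      { isRing = record
        { +-isAbelianGroup = record
          { isGroup = record
            { isMonoid = record
              { isSemigroup = record
                { isMagma = record
                  { isEquivalence = record
                    { refl = coeffwise λ _ → refl
                    ; sym = λ e → coeffwise λ k → sym (at e k)
                    ; trans = λ e f → coeffwise λ k → trans (at e k) (at f k) }
                  ; ∙-cong = λ {p} {p′} {q} {q′} e f → coeffwise λ k →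
                      trans (coeff-+ p q k) (trans (cong₂ ℤ._+_ (at e k) (at f k)) (sym (coeff-+ p′ q′ k))) }
                ; assoc = λ p q r → coeffwise λ k →
                    trans (trans (coeff-+ (p +ₚ q) r k) (+-leftCong (coeff-+ p q k)))
                      (trans (ℤₚ.+-assoc (coeff p k) _ _)
                        (sym (trans (coeff-+ p (q +ₚ r) k) (+-rightCong (coeff p k) (coeff-+ q r k))))) }
              ; identity = (λ p → coeffwise λ k → refl)
                         , (λ p → coeffwise λ k → trans (coeff-+ p [] k) (ℤₚ.+-identityʳ _)) }
            ; inverse = (λ p → coeffwise λ k → trans (coeff-+ (-ₚ p) p k)
                          (trans (+-leftCong (coeff-neg p k)) (ℤₚ.+-inverseˡ (coeff p k))))
                      , (λ p → coeffwise λ k → trans (coeff-+ p (-ₚ p) k)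
                          (trans (+-rightCong (coeff p k) (coeff-neg p k)) (ℤₚ.+-inverseʳ (coeff p k))))
            ; ⁻¹-cong = λ {p} {q} e → coeffwise λ k →
                trans (coeff-neg p k) (trans (cong ℤ.-_ (at e k)) (sym (coeff-neg q k))) }
          ; comm = λ p q → coeffwise λ k →
              trans (coeff-+ p q k) (trans (ℤₚ.+-comm (coeff p k) _) (sym (coeff-+ q p k))) }
        ; *-cong = λ {p} {p′} {q} {q′} e f → coeffwise λ k → trans (coeff-*-congˡ q e k) (coeff-*-congʳ p′ f k)
        ; *-assoc = λ p q r → coeffwise (coeff-*-assoc p q r)
        ; *-identity = (λ p → coeffwise (coeff-*-identityˡ p))
                     , (λ p → coeffwise λ k → trans (coeff-*-comm p oneₚ k) (coeff-*-identityˡ p k))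
        ; distrib = (λ p q r → coeffwise λ k →
                       trans (coeff-*-comm p (q +ₚ r) k) (trans (coeff-*-distribʳ q r p k)
                         (trans (cong₂ ℤ._+_ (coeff-*-comm q p k) (coeff-*-comm r p k)) (sym (coeff-+ (p *ₚ q) _ k)))))
                  , (λ p q r → coeffwise λ k →
                       trans (coeff-*-distribʳ q r p k) (sym (coeff-+ (q *ₚ p) _ k))) }
      ; *-comm = λ p q → coeffwise (coeff-*-comm p q) } }

  X : ℤ[X]
  X = 0ℤ ∷ 1ℤ ∷ []

  const-* : ∀ c p → const c *ₚ p ≋ scale c p
  at (const-* c p) zero    = trans (coeff-*-zero c [] p) (sym (coeff-scale c p 0))
  at (const-* c p) (suc k) = trans (coeff-*-suc c [] p k)
    (trans (ℤₚ.+-identityʳ _) (sym (coeff-scale c p (suc k))))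

  shiftX-* : ∀ p q → shiftX p *ₚ q ≋ shiftX (p *ₚ q)
  at (shiftX-* p q) zero    = coeff-*-zero 0ℤ p q
  at (shiftX-* p q) (suc k) = trans (coeff-*-suc 0ℤ p q k) (ℤₚ.+-identityˡ _)

  shiftX-cong : ∀ {p q} → p ≋ q → shiftX p ≋ shiftX q
  at (shiftX-cong e) zero    = refl
  at (shiftX-cong e) (suc k) = at e k

  shiftX≋X* : ∀ p → shiftX p ≋ X *ₚ p
  at (shiftX≋X* p) zero    = sym (at (shiftX-* oneₚ p) 0)
  at (shiftX≋X* p) (suc k) = sym (trans (at (shiftX-* oneₚ p) (suc k)) (coeff-*-identityˡ p k))

  ∷-split : ∀ a p → (a ∷ p) ≋ const a +ₚ X *ₚ p
  at (∷-split a p) zero    = sym (trans (coeff-+ (const a) (X *ₚ p) 0)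
    (trans (cong (λ t → a ℤ.+ t) (sym (at (shiftX≋X* p) 0))) (ℤₚ.+-identityʳ a)))
  at (∷-split a p) (suc k) = sym (trans (coeff-+ (const a) (X *ₚ p) (suc k))
    (trans (ℤₚ.+-identityˡ _) (sym (at (shiftX≋X* p) (suc k)))))

  tail : ℤ[X] → ℤ[X]
  tail []      = []
  tail (a ∷ p) = p

  coeff-tail : ∀ p k → coeff (tail p) k ≡ coeff p (suc k)
  coeff-tail []      k = refl
  coeff-tail (a ∷ p) k = refl

  1≢0 : 1ℤ ≢ 0ℤ
  1≢0 ()

  -- Degree bounds speak of vanishing coefficients, since trailing zeros make the length of a list
  -- meaningless as a degree. The bound is strict, so that 0 characterizes the zero polynomial.
  Below : ℤ[X] → ℕ → Set
  Below p d = ∀ k → d ℕ.≤ k → coeff p k ≡ 0ℤ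

  Monic : ℤ[X] → ℕ → Set
  Monic p d = coeff p d ≡ 1ℤ × Below p (suc d)

  Below-cong : ∀ {p q d} → p ≋ q → Below p d → Below q d
  Below-cong e b k d≤k = trans (sym (at e k)) (b k d≤k)

  Monic-cong : ∀ {p q d} → p ≋ q → Monic p d → Monic q d
  Monic-cong {d = d} e (t , b) = trans (sym (at e d)) t , Below-cong e b

  Below-tail : ∀ {a p d} → Below (a ∷ p) (suc d) → Below p d
  Below-tail b k d≤k = b (suc k) (s≤s d≤k)

  Below-length : ∀ p → Below p (length p)
  Below-length []      k       _         = refl
  Below-length (a ∷ p) (suc k) (s≤s l≤k) = Below-length p k l≤k

  Below-mono : ∀ {p d e} → d ℕ.≤ e → Below p d → Below p e
  Below-mono d≤e b k e≤k = b k (ℕₚ.≤-trans d≤e e≤k)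

  Below-0 : ∀ {p} → Below p 0 → p ≋ []
  at (Below-0 b) k = b k z≤n

  -- The bounds are asymmetric, degree at most a against degree less than b, so that a + b is again
  -- a strict bound.
  Below-* : ∀ p q a b → Below p (suc a) → Below q b → Below (p *ₚ q) (a ℕ.+ b)
  Below-* []      q a b bp bq k l = refl
  Below-* (c ∷ p) q zero b bp bq zero l
    rewrite coeff-*-zero c p q = trans (cong (c ℤ.*_) (bq 0 l)) (ℤₚ.*-zeroʳ c)
  Below-* (c ∷ p) q zero b bp bq (suc k) l
    rewrite coeff-*-suc c p q k =
    cong₂ ℤ._+_ (trans (cong (c ℤ.*_) (bq (suc k) l)) (ℤₚ.*-zeroʳ c))
      (trans (coeff-*-congˡ {p} {[]} q (Below-0 (Below-tail {c} {p} bp)) k) refl)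
  Below-* (c ∷ p) q (suc a) b bp bq (suc k) (s≤s l)
    rewrite coeff-*-suc c p q k =
    cong₂ ℤ._+_
      (trans (cong (c ℤ.*_) (bq (suc k) (ℕₚ.≤-trans (ℕₚ.m≤n+m b a) (ℕₚ.m≤n⇒m≤1+n l)))) (ℤₚ.*-zeroʳ c))
      (Below-* p q a b (Below-tail {c} {p} bp) bq k l)

  top-* : ∀ p q a b → Below p (suc a) → Below q (suc b) →
    coeff (p *ₚ q) (a ℕ.+ b) ≡ coeff p a ℤ.* coeff q b
  top-* []      q a b bp bq = refl
  top-* (c ∷ p) q zero zero bp bq = coeff-*-zero c p q
  top-* (c ∷ p) q zero (suc b) bp bq =
    trans (coeff-*-suc c p q b) (trans (+-rightCong (c ℤ.* coeff q (suc b))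
      (coeff-*-congˡ {p} {[]} q (Below-0 (Below-tail {c} {p} bp)) b)) (ℤₚ.+-identityʳ _))
  top-* (c ∷ p) q (suc a) b bp bq =
    trans (coeff-*-suc c p q (a ℕ.+ b)) (trans (cong₂ ℤ._+_
      (trans (cong (c ℤ.*_) (bq _ (s≤s (ℕₚ.m≤n+m b a)))) (ℤₚ.*-zeroʳ c))
      (top-* p q a b (Below-tail {c} {p} bp) bq)) (ℤₚ.+-identityˡ _))

  Monic-* : ∀ p q a b → Monic p a → Monic q b → Monic (p *ₚ q) (a ℕ.+ b)
  Monic-* p q a b (t , bp) (u , bq) =
    trans (top-* p q a b bp bq) (cong₂ ℤ._*_ t u) ,
    subst (Below (p *ₚ q)) (ℕₚ.+-suc a b) (Below-* p q a (suc b) bp bq)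

  -- As f is monic, the top coefficient of h reappears as a coefficient of f h. The coefficients of
  -- h are therefore killed one after another from above, starting at the list length, a bound
  -- available for every h.
  Below-quotient : ∀ f h d k → Monic f d → Below (f *ₚ h) (d ℕ.+ k) → Below h k
  Below-quotient f h d k (t , bf) b =
    descend (length h) (Below-mono {h} (ℕₚ.m≤n+m _ k) (Below-length h))
    where
    descend : ∀ j → Below h (k ℕ.+ j) → Below h k
    descend zero    bh = subst (Below h) (ℕₚ.+-identityʳ k) bh
    descend (suc j) bh = descend j lower
      where
      bh′ : Below h (suc (k ℕ.+ j))
      bh′ = subst (Below h) (ℕₚ.+-suc k j) bh
      top : coeff h (k ℕ.+ j) ≡ 0ℤ
      top = trans (sym (ℤₚ.*-identityˡ _)) (trans (*-leftCong (sym t))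
        (trans (sym (top-* f h d (k ℕ.+ j) bf bh′)) (b _ (ℕₚ.+-monoʳ-≤ d (ℕₚ.m≤m+n k j)))))
      lower : Below h (k ℕ.+ j)
      lower i l with ℕₚ.m≤n⇒m<n∨m≡n l
      ... | inj₁ l′   = bh′ i l′
      ... | inj₂ refl = top

  Monic-quotient : ∀ f h a b → Monic f a → Monic (f *ₚ h) (a ℕ.+ b) → Monic h b
  Monic-quotient f h a b (t , bf) (u , bfh) =
    trans (sym (ℤₚ.*-identityˡ _)) (trans (*-leftCong (sym t)) (trans (sym (top-* f h a b bf bh)) u)) , bh
    where
    bh : Below h (suc b)
    bh = Below-quotient f h a (suc b) (t , bf) (subst (Below (f *ₚ h)) (sym (ℕₚ.+-suc a b)) bfh)

  Monic-cancel-0 : ∀ f h d → Monic f d → f *ₚ h ≋ [] → h ≋ []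
  Monic-cancel-0 f h d m e = Below-0 (Below-quotient f h d 0 m (λ k _ → at e k))

  Monic-cancel : ∀ f g h d → Monic f d → f *ₚ g ≋ f *ₚ h → g ≋ h
  Monic-cancel f g h d m e = x∙y⁻¹≈ε⇒x≈y g h (Monic-cancel-0 f (g - h) d m
    (trans′ (distribˡ f g (- h)) (trans′ (+-congˡ (sym′ (-‿distribʳ-* f h))) (x≈y⇒x∙y⁻¹≈ε {f *ₚ g} {f *ₚ h} e))))
    where
    open CommutativeRing ℤ[x] using (_-_; -_; distribˡ; +-congˡ; ring) renaming (trans to trans′; sym to sym′)
    open import Algebra.Properties.Ring ring

-- Determinants

module Determinant where
  open import Data.Fin using (Fin; zero; suc; toℕ; punchIn; inject₁)
  open import Data.Integer using (_+_; _*_)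
  open Zx using (sumFin; det; pow)
  open ℤ-Solver

  Row : ℕ → Set
  Row m = Fin m → ℤ

  Matrix : ℕ → Set
  Matrix m = Fin m → Row m

  sum-cong : ∀ {m} {f g : Fin m → ℤ} → (∀ j → f j ≡ g j) → sumFin f ≡ sumFin g
  sum-cong {zero}  e = refl
  sum-cong {suc m} e = cong₂ _+_ (e zero) (sum-cong (e ∘ suc))

  sum-0 : ∀ m → sumFin {m} (λ _ → 0ℤ) ≡ 0ℤ
  sum-0 zero    = refl
  sum-0 (suc m) = cong (λ t → 0ℤ + t) (sum-0 m)

  sum-linear : ∀ {m} a b (f g : Fin m → ℤ) →
    sumFin (λ j → a * f j + b * g j) ≡ a * sumFin f + b * sumFin g
  sum-linear {zero}  a b f g = solve 2 (λ a b → con 0ℤ := a :* con 0ℤ :+ b :* con 0ℤ) refl a b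
  sum-linear {suc m} a b f g rewrite sum-linear a b (f ∘ suc) (g ∘ suc) =
    solve 6 (λ a b x y s t → (a :* x :+ b :* y) :+ (a :* s :+ b :* t) := a :* (x :+ s) :+ b :* (y :+ t))
      refl a b (f zero) (g zero) (sumFin (f ∘ suc)) (sumFin (g ∘ suc))

  sum-*ˡ : ∀ {m} a (f : Fin m → ℤ) → a * sumFin f ≡ sumFin (λ j → a * f j)
  sum-*ˡ {zero}  a f = ℤₚ.*-zeroʳ a
  sum-*ˡ {suc m} a f rewrite sym (sum-*ˡ a (f ∘ suc)) = ℤₚ.*-distribˡ-+ a _ _

  sum-+ : ∀ {m} (f g : Fin m → ℤ) → sumFin (λ j → f j + g j) ≡ sumFin f + sumFin g
  sum-+ {zero}  f g = refl
  sum-+ {suc m} f g rewrite sum-+ (f ∘ suc) (g ∘ suc) =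
    solve 4 (λ x y s t → (x :+ y) :+ (s :+ t) := (x :+ s) :+ (y :+ t))
      refl (f zero) (g zero) (sumFin (f ∘ suc)) (sumFin (g ∘ suc))

  δ : ∀ {m} → Matrix m
  δ zero    zero    = 1ℤ
  δ zero    (suc j) = 0ℤ
  δ (suc i) zero    = 0ℤ
  δ (suc i) (suc j) = δ i j

  sum-δˡ : ∀ {m} (i : Fin m) (f : Fin m → ℤ) → sumFin (λ j → δ i j * f j) ≡ f i
  sum-δˡ {suc m} zero f = trans (cong₂ _+_ (ℤₚ.*-identityˡ (f zero))
    (trans (sum-cong {g = λ _ → 0ℤ} (λ j → ℤₚ.*-zeroˡ (f (suc j)))) (sum-0 m))) (ℤₚ.+-identityʳ _)
  sum-δˡ (suc i) f = trans (cong₂ _+_ (ℤₚ.*-zeroˡ (f zero)) (sum-δˡ i (f ∘ suc))) (ℤₚ.+-identityˡ _)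

  δ-sym : ∀ {m} (i j : Fin m) → δ i j ≡ δ j i
  δ-sym zero    zero    = refl
  δ-sym zero    (suc j) = refl
  δ-sym (suc i) zero    = refl
  δ-sym (suc i) (suc j) = δ-sym i j

  sum-δʳ : ∀ {m} (i : Fin m) (f : Fin m → ℤ) → sumFin (λ j → f j * δ j i) ≡ f i
  sum-δʳ i f = trans
    (sum-cong (λ j → trans (ℤₚ.*-comm (f j) _) (cong (_* f j) (δ-sym j i)))) (sum-δˡ i f)

  δ-refl : ∀ {m} (i : Fin m) → δ i i ≡ 1ℤ
  δ-refl zero    = refl
  δ-refl (suc i) = δ-refl i

  δ-≢ : ∀ {m} {i j : Fin m} → i ≢ j → δ i j ≡ 0ℤ
  δ-≢ {i = zero}  {zero}  i≢j = ⊥-elim (i≢j refl)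
  δ-≢ {i = zero}  {suc j} i≢j = refl
  δ-≢ {i = suc i} {zero}  i≢j = refl
  δ-≢ {i = suc i} {suc j} i≢j = δ-≢ (i≢j ∘ cong suc)

  sgn : ∀ {m} → Fin m → ℤ
  sgn j = pow -1ℤ (toℕ j)

  minor : ∀ {m} → Matrix (suc m) → Fin (suc m) → Matrix m
  minor M j r c = M (suc r) (punchIn j c)

  laplaceTerm : ∀ {m} → Matrix (suc m) → Row (suc m)
  laplaceTerm M j = sgn j * (M zero j * det (minor M j))

  det-cong : ∀ {m} {M M′ : Matrix m} → (∀ r c → M r c ≡ M′ r c) → det M ≡ det M′
  det-cong {zero}  e = refl
  det-cong {suc m} e = sum-cong (λ j → cong (sgn j *_)
    (cong₂ _*_ (e zero j) (det-cong (λ r c → e (suc r) (punchIn j c)))))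

  -- Hypotheses are relational (rows agreeing pointwise) because functions are not extensional here.
  record Alternating {m} (D : Matrix m → ℤ) : Set where
    field
      respects : ∀ {M M′} → (∀ r c → M r c ≡ M′ r c) → D M ≡ D M′
      linear : ∀ i a b M M₁ M₂ →
        (∀ r → r ≢ i → ∀ c → M r c ≡ M₁ r c) → (∀ r → r ≢ i → ∀ c → M r c ≡ M₂ r c) →
        (∀ c → M i c ≡ a * M₁ i c + b * M₂ i c) → D M ≡ a * D M₁ + b * D M₂
      alternates : ∀ M i j → i ≢ j → (∀ c → M i c ≡ M j c) → D M ≡ 0ℤ

  -- In row zero the minors agree and the entries are linear; in a later row the entries of row zero
  -- agree and the minors are linear by induction.
  det-linear : ∀ {m} i a b (M M₁ M₂ : Matrix m) →
    (∀ r → r ≢ i → ∀ c → M r c ≡ M₁ r c) → (∀ r → r ≢ i → ∀ c → M r c ≡ M₂ r c) →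
    (∀ c → M i c ≡ a * M₁ i c + b * M₂ i c) → det M ≡ a * det M₁ + b * det M₂
  det-linear {suc m} zero a b M M₁ M₂ e₁ e₂ e = trans (sum-cong term) (sum-linear a b (laplaceTerm M₁) (laplaceTerm M₂))
    where
    term : ∀ j → sgn j * (M zero j * det (minor M j)) ≡
      a * (sgn j * (M₁ zero j * det (minor M₁ j))) + b * (sgn j * (M₂ zero j * det (minor M₂ j)))
    term j rewrite e j
                 | det-cong {M = minor M₁ j} {minor M j} (λ r c → sym (e₁ (suc r) (λ ()) (punchIn j c)))
                 | det-cong {M = minor M₂ j} {minor M j} (λ r c → sym (e₂ (suc r) (λ ()) (punchIn j c))) =
      solve 6 (λ s a x b y d → s :* ((a :* x :+ b :* y) :* d) := a :* (s :* (x :* d)) :+ b :* (s :* (y :* d)))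
        refl (sgn j) a (M₁ zero j) b (M₂ zero j) (det (minor M j))
  det-linear {suc m} (suc i) a b M M₁ M₂ e₁ e₂ e = trans (sum-cong term) (sum-linear a b (laplaceTerm M₁) (laplaceTerm M₂))
    where
    term : ∀ j → sgn j * (M zero j * det (minor M j)) ≡
      a * (sgn j * (M₁ zero j * det (minor M₁ j))) + b * (sgn j * (M₂ zero j * det (minor M₂ j)))
    term j rewrite sym (e₁ zero (λ ()) j) | sym (e₂ zero (λ ()) j)
      | det-linear i a b (minor M j) (minor M₁ j) (minor M₂ j)
          (λ r r≢i c → e₁ (suc r) (r≢i ∘ Finₚ.suc-injective) (punchIn j c))
          (λ r r≢i c → e₂ (suc r) (r≢i ∘ Finₚ.suc-injective) (punchIn j c))
          (λ c → e (punchIn j c)) =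
      solve 6 (λ s m a x b y → s :* (m :* (a :* x :+ b :* y)) := a :* (s :* (m :* x)) :+ b :* (s :* (m :* y)))
        refl (sgn j) (M zero j) a (det (minor M₁ j)) b (det (minor M₂ j))

  update : ∀ {m} → Matrix m → Fin m → Row m → Matrix m
  update M i v r with r Fin.≟ i
  ... | yes _ = v
  ... | no  _ = M r

  update-at : ∀ {m} (M : Matrix m) i v c → update M i v i c ≡ v c
  update-at M i v c with i Fin.≟ i
  ... | yes _ = refl
  ... | no  q = ⊥-elim (q refl)

  update-off : ∀ {m} (M : Matrix m) i v r → r ≢ i → ∀ c → update M i v r c ≡ M r c
  update-off M i v r r≢i c with r Fin.≟ i
  ... | yes q = ⊥-elim (r≢i q)
  ... | no  _ = refl

  module Skew {m} (D : Matrix m → ℤ)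
    (respects : ∀ {M M′} → (∀ r c → M r c ≡ M′ r c) → D M ≡ D M′)
    (linear : ∀ i a b M M₁ M₂ →
        (∀ r → r ≢ i → ∀ c → M r c ≡ M₁ r c) → (∀ r → r ≢ i → ∀ c → M r c ≡ M₂ r c) →
        (∀ c → M i c ≡ a * M₁ i c + b * M₂ i c) → D M ≡ a * D M₁ + b * D M₂)
    (i j : Fin m) (i≢j : i ≢ j)
    (alternates : ∀ M → (∀ c → M i c ≡ M j c) → D M ≡ 0ℤ) where

    module _ (M : Matrix m) where
      U : Row m → Row m → Matrix m
      U v w = update (update M i v) j w

      U-i : ∀ v w c → U v w i c ≡ v c
      U-i v w c = trans (update-off (update M i v) j w i i≢j c) (update-at M i v c)

      U-j : ∀ v w c → U v w j c ≡ w c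
      U-j v w c = update-at (update M i v) j w c

      U-off : ∀ v w r → r ≢ i → r ≢ j → ∀ c → U v w r c ≡ M r c
      U-off v w r r≢i r≢j c = trans (update-off (update M i v) j w r r≢j c) (update-off M i v r r≢i c)

      U-same : ∀ v w N → (∀ c → N i c ≡ v c) → (∀ c → N j c ≡ w c) →
        (∀ r → r ≢ i → r ≢ j → ∀ c → N r c ≡ M r c) → D (U v w) ≡ D N
      U-same v w N ei ej eo = respects go
        where
        go : ∀ r c → U v w r c ≡ N r c
        go r c = by-cases (r Fin.≟ i) (r Fin.≟ j)
          where
          by-cases : Dec (r ≡ i) → Dec (r ≡ j) → U v w r c ≡ N r c
          by-cases (yes refl) _          = trans (U-i v w c) (sym (ei c))
          by-cases (no _)     (yes refl) = trans (U-j v w c) (sym (ej c))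
          by-cases (no p)     (no q)     = trans (U-off v w r p q c) (sym (eo r p q c))

      U-linearˡ : ∀ v v′ w → D (U (λ c → v c + v′ c) w) ≡ 1ℤ * D (U v w) + 1ℤ * D (U v′ w)
      U-linearˡ v v′ w = linear i 1ℤ 1ℤ _ _ _ (off v) (off v′)
        (λ c → trans (U-i _ w c) (sym (cong₂ _+_
          (trans (ℤₚ.*-identityˡ _) (U-i v w c)) (trans (ℤₚ.*-identityˡ _) (U-i v′ w c)))))
        where
        off : ∀ u r → r ≢ i → ∀ c → U (λ c → v c + v′ c) w r c ≡ U u w r c
        off u r r≢i c with r Fin.≟ j
        ... | yes _ = refl
        ... | no _ = trans (update-off M i _ r r≢i c) (sym (update-off M i _ r r≢i c))

      U-linearʳ : ∀ v w w′ → D (U v (λ c → w c + w′ c)) ≡ 1ℤ * D (U v w) + 1ℤ * D (U v w′)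
      U-linearʳ v w w′ = linear j 1ℤ 1ℤ _ _ _ (off w) (off w′)
        (λ c → trans (U-j v _ c) (sym (cong₂ _+_
          (trans (ℤₚ.*-identityˡ _) (U-j v w c)) (trans (ℤₚ.*-identityˡ _) (U-j v w′ c)))))
        where
        off : ∀ u r → r ≢ j → ∀ c → U v (λ c → w c + w′ c) r c ≡ U v u r c
        off u r r≢j c = trans (update-off _ j _ r r≢j c) (sym (update-off _ j _ r r≢j c))

      U-equal : ∀ v → D (U v v) ≡ 0ℤ
      U-equal v = alternates _ (λ c → trans (U-i v v c) (sym (U-j v v c)))

    -- Polarization: with v + w in both rows the form vanishes, and expanding leaves exactly the two
    -- mixed terms. Alternation is assumed for the single pair i, j, because `det` is not yet known
    -- to alternate in general when this is applied to it.
    skew : ∀ M M′ → (∀ c → M′ i c ≡ M j c) → (∀ c → M′ j c ≡ M i c) →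
      (∀ r → r ≢ i → r ≢ j → ∀ c → M′ r c ≡ M r c) → D M + D M′ ≡ 0ℤ
    skew M M′ ei ej eo = begin
      D M + D M′                                   ≡⟨ cong₂ _+_ (U-same M v w M (λ _ → refl) (λ _ → refl) (λ _ _ _ _ → refl))
                                                               (U-same M w v M′ ei ej eo) ⟨
      D (U M v w) + D (U M w v)                    ≡⟨ solve 2 (λ x y → x :+ y :=
                                                        con 1ℤ :* (con 1ℤ :* con 0ℤ :+ con 1ℤ :* x) :+ con 1ℤ :* (con 1ℤ :* y :+ con 1ℤ :* con 0ℤ))
                                                        refl (D (U M v w)) (D (U M w v)) ⟩
      1ℤ * (1ℤ * 0ℤ + 1ℤ * D (U M v w)) + 1ℤ * (1ℤ * D (U M w v) + 1ℤ * 0ℤ)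
        ≡⟨ cong₂ (λ x y → 1ℤ * (1ℤ * x + 1ℤ * D (U M v w)) + 1ℤ * (1ℤ * D (U M w v) + 1ℤ * y))
             (U-equal M v) (U-equal M w) ⟨
      1ℤ * (1ℤ * D (U M v v) + 1ℤ * D (U M v w)) + 1ℤ * (1ℤ * D (U M w v) + 1ℤ * D (U M w w))
        ≡⟨ cong₂ (λ x y → 1ℤ * x + 1ℤ * y) (U-linearʳ M v v w) (U-linearʳ M w v w) ⟨
      1ℤ * D (U M v s) + 1ℤ * D (U M w s)          ≡⟨ U-linearˡ M v w s ⟨
      D (U M s s)                                  ≡⟨ U-equal M s ⟩
      0ℤ                                           ∎
      where
      open ≡-Reasoning
      v w s : Row m
      v = M i
      w = M j
      s c = v c + w c

  -- The indices run over ordered pairs of distinct columns, the second one numbered after deletion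
  -- of the first. For a ≤ b, the pairs (a, b) and (b + 1, a) name the same two columns in opposite
  -- order.
  sum-antisymmetric : ∀ m (t : Fin (suc m) → Fin m → ℤ) →
    (∀ a b → a Fin.≤ b → t (inject₁ a) b + t (suc b) a ≡ 0ℤ) →
    sumFin (λ j → sumFin (t j)) ≡ 0ℤ
  sum-antisymmetric zero    t anti = refl
  sum-antisymmetric (suc m) t anti = begin
    sumFin (t zero) + sumFin (λ j → t (suc j) zero + sumFin (t (suc j) ∘ suc))
      ≡⟨ cong (λ s → sumFin (t zero) + s) (sum-+ (λ j → t (suc j) zero) (λ j → sumFin (t (suc j) ∘ suc))) ⟩
    sumFin (t zero) + (sumFin (λ j → t (suc j) zero) + sumFin (λ j → sumFin (t (suc j) ∘ suc)))
      ≡⟨ ℤₚ.+-assoc (sumFin (t zero)) _ _ ⟨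
    (sumFin (t zero) + sumFin (λ j → t (suc j) zero)) + sumFin (λ j → sumFin (t (suc j) ∘ suc))
      ≡⟨ cong₂ _+_ (sym (sum-+ (t zero) (λ j → t (suc j) zero)))
           (sum-antisymmetric m (λ j k → t (suc j) (suc k)) (λ a b a≤b → anti (suc a) (suc b) (s≤s a≤b))) ⟩
    sumFin (λ k → t zero k + t (suc k) zero) + 0ℤ
      ≡⟨ cong (_+ 0ℤ) (trans (sum-cong (λ k → anti zero k z≤n)) (sum-0 (suc m))) ⟩
    0ℤ ∎
    where open ≡-Reasoning

  punchIn-inject₁ : ∀ {m} (a b : Fin m) → a Fin.≤ b → punchIn (inject₁ a) b ≡ suc b
  punchIn-inject₁ zero    b       _         = refl
  punchIn-inject₁ (suc a) (suc b) (s≤s a≤b) = cong suc (punchIn-inject₁ a b a≤b)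

  punchIn-suc : ∀ {m} (a b : Fin m) → a Fin.≤ b → punchIn (suc b) a ≡ inject₁ a
  punchIn-suc zero    b       _         = refl
  punchIn-suc (suc a) (suc b) (s≤s a≤b) = cong suc (punchIn-suc a b a≤b)

  punchIn-punchIn : ∀ {m} (a b : Fin (suc m)) (c : Fin m) → a Fin.≤ b →
    punchIn (inject₁ a) (punchIn b c) ≡ punchIn (suc b) (punchIn a c)
  punchIn-punchIn zero    b       c       _         = refl
  punchIn-punchIn (suc a) (suc b) zero    _         = refl
  punchIn-punchIn (suc a) (suc b) (suc c) (s≤s a≤b) = cong suc (punchIn-punchIn a b c a≤b)

  -- Expanding along both equal rows, the two orders of a pair of columns share the same minor and
  -- the same entries but differ in sign.
  det-alternates-01 : ∀ {m} (M : Matrix (suc (suc m))) → (∀ c → M zero c ≡ M (suc zero) c) → det M ≡ 0ℤ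
  det-alternates-01 {m} M e = trans (sum-cong expand) (sum-antisymmetric (suc m) t anti)
    where
    open ≡-Reasoning
    minor₂ : Fin (suc (suc m)) → Fin (suc m) → Matrix m
    minor₂ j k r c = M (suc (suc r)) (punchIn j (punchIn k c))
    t : Fin (suc (suc m)) → Fin (suc m) → ℤ
    t j k = sgn j * (M zero j * (sgn k * (M (suc zero) (punchIn j k) * det (minor₂ j k))))
    expand : ∀ j → sgn j * (M zero j * det (minor M j)) ≡ sumFin (t j)
    expand j = trans (cong (sgn j *_) (sum-*ˡ (M zero j) (laplaceTerm (minor M j))))
      (sum-*ˡ (sgn j) (λ k → M zero j * laplaceTerm (minor M j) k))
    anti : ∀ a b → a Fin.≤ b → t (inject₁ a) b + t (suc b) a ≡ 0ℤ
    anti a b a≤b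
      rewrite punchIn-inject₁ a b a≤b | punchIn-suc a b a≤b | Finₚ.toℕ-inject₁ a
            | det-cong {M = minor₂ (inject₁ a) b} {minor₂ (suc b) a}
                (λ r c → cong (M (suc (suc r))) (punchIn-punchIn a b c a≤b))
            | e (inject₁ a) | e (suc b) =
      solve 5 (λ s x t y d → s :* (x :* (t :* (y :* d))) :+ (con -1ℤ :* t) :* (y :* (s :* (x :* d))) := con 0ℤ)
        refl (sgn a) (M (suc zero) (inject₁ a)) (sgn b) (M (suc zero) (suc b)) (det (minor₂ (suc b) a))

  module AlternatesStep {m}
    (IH : ∀ (M : Matrix m) i j → i ≢ j → (∀ c → M i c ≡ M j c) → det M ≡ 0ℤ) where

    det-alternates-suc : ∀ (M : Matrix (suc m)) i j → i ≢ j →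
      (∀ c → M (suc i) c ≡ M (suc j) c) → det M ≡ 0ℤ
    det-alternates-suc M i j i≢j e = trans (sum-cong {f = laplaceTerm M} (λ k → trans
      (cong (λ d → sgn k * (M zero k * d)) (IH (minor M k) i j i≢j (λ c → e (punchIn k c))))
      (trans (cong (sgn k *_) (ℤₚ.*-zeroʳ (M zero k))) (ℤₚ.*-zeroʳ (sgn k))))) (sum-0 (suc m))

  module AlternatesStep₀ {m}
    (IH : ∀ (M : Matrix (suc m)) i j → i ≢ j → (∀ c → M i c ≡ M j c) → det M ≡ 0ℤ)
    (M : Matrix (suc (suc m))) (j : Fin m) (e : ∀ c → M zero c ≡ M (suc (suc j)) c) where
    open ≡-Reasoning
    open AlternatesStep IH
    open Skew {suc (suc m)} det det-cong det-linear (suc zero) (suc (suc j)) (λ ())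
      (λ N eN → det-alternates-suc N zero (suc j) (λ ()) eN)

    v w : Row (suc (suc m))
    v = M (suc (suc j))
    w = M (suc zero)

    rows-equal : ∀ c → U M v w zero c ≡ U M v w (suc zero) c
    rows-equal c = trans (U-off M v w zero (λ ()) (λ ()) c) (trans (e c) (sym (U-i M v w c)))

    -- Exchanging rows 1 and j + 2 brings the equal rows to the top. The exchange flips the sign
    -- because both rows lie in the minors, where alternation holds by induction.
    result : det M ≡ 0ℤ
    result = begin
      det M                    ≡⟨ ℤₚ.+-identityʳ (det M) ⟨
      det M + 0ℤ               ≡⟨ cong (λ t → det M + t) (det-alternates-01 (U M v w) rows-equal) ⟨
      det M + det (U M v w)    ≡⟨ skew M (U M v w) (U-i M v w) (U-j M v w) (U-off M v w) ⟩
      0ℤ                       ∎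

  det-alternates : ∀ {m} (M : Matrix m) i j → i ≢ j → (∀ c → M i c ≡ M j c) → det M ≡ 0ℤ
  det-alternates {suc m} M zero zero i≢j e = ⊥-elim (i≢j refl)
  det-alternates {suc (suc m)} M zero (suc zero) i≢j e = det-alternates-01 M e
  det-alternates {suc (suc m)} M zero (suc (suc j)) i≢j e =
    AlternatesStep₀.result (det-alternates {suc m}) M j e
  det-alternates {suc (suc m)} M (suc zero) zero i≢j e = det-alternates-01 M (λ c → sym (e c))
  det-alternates {suc (suc m)} M (suc (suc i)) zero i≢j e =
    AlternatesStep₀.result (det-alternates {suc m}) M i (λ c → sym (e c))
  det-alternates {suc m} M (suc i) (suc j) i≢j e =
    AlternatesStep.det-alternates-suc (det-alternates {m}) M i j (i≢j ∘ cong suc) e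

  det-alternating : ∀ {m} → Alternating (det {m})
  det-alternating = record { respects = det-cong ; linear = det-linear ; alternates = det-alternates }

module DeterminantUniqueness where
  open import Data.Fin using (Fin; zero; suc; toℕ; punchIn; inject₁; _↑ʳ_)
  open import Data.Integer using (_+_; _*_)
  open Zx using (sumFin; det)
  open ℤ-Solver
  open Determinant
  open ≡-Reasoning

  infixr 5 _◂_
  _◂_ : ∀ {m} → Row (suc m) → (Fin m → Row (suc m)) → Matrix (suc m)
  (v ◂ R) zero    = v
  (v ◂ R) (suc r) = R r

  insert0 : ∀ {m} → Fin (suc m) → Row m → Row (suc m)
  insert0 zero            w zero    = 0ℤ
  insert0 zero            w (suc c) = w c
  insert0 {suc m} (suc j) w zero    = w zero
  insert0 {suc m} (suc j) w (suc c) = insert0 j (w ∘ suc) c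

  insert0-linear : ∀ {m} (j : Fin (suc m)) a b {w w₁ w₂ : Row m} →
    (∀ c → w c ≡ a * w₁ c + b * w₂ c) → ∀ c → insert0 j w c ≡ a * insert0 j w₁ c + b * insert0 j w₂ c
  insert0-linear zero            a b e zero    = solve 2 (λ a b → con 0ℤ := a :* con 0ℤ :+ b :* con 0ℤ) refl a b
  insert0-linear zero            a b e (suc c) = e c
  insert0-linear {suc m} (suc j) a b e zero    = e zero
  insert0-linear {suc m} (suc j) a b e (suc c) = insert0-linear j a b (e ∘ suc) c

  insert0-cong : ∀ {m} (j : Fin (suc m)) {w w′ : Row m} →
    (∀ c → w c ≡ w′ c) → ∀ c → insert0 j w c ≡ insert0 j w′ c
  insert0-cong zero            e zero    = refl
  insert0-cong zero            e (suc c) = e c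
  insert0-cong {suc m} (suc j) e zero    = e zero
  insert0-cong {suc m} (suc j) e (suc c) = insert0-cong j (e ∘ suc) c

  insert0-δ : ∀ {m} (j : Fin (suc m)) r c → insert0 j (δ r) c ≡ δ (punchIn j r) c
  insert0-δ zero            r       zero    = refl
  insert0-δ zero            r       (suc c) = refl
  insert0-δ {suc m} (suc j) zero    zero    = refl
  insert0-δ {suc m} (suc j) (suc r) zero    = refl
  insert0-δ {suc m} (suc j) zero    (suc c) = insert0-0 j c
    where
    insert0-0 : ∀ {m} (j : Fin (suc m)) c → insert0 {m} j (λ _ → 0ℤ) c ≡ 0ℤ
    insert0-0 zero            zero    = refl
    insert0-0 zero            (suc c) = refl
    insert0-0 {suc m} (suc j) zero    = refl
    insert0-0 {suc m} (suc j) (suc c) = insert0-0 j c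
  insert0-δ {suc m} (suc j) (suc r) (suc c) = insert0-δ j r c

  -- Identifies a row stripped of its entry in column j with the row obtained by subtracting a
  -- multiple of the unit row, the operation under which an alternating form is invariant.
  insert0-clear : ∀ {m} (j : Fin (suc m)) (v : Row (suc m)) c →
    insert0 j (v ∘ punchIn j) c ≡ v c + ℤ.- v j * δ j c
  insert0-clear zero            v zero    = solve 1 (λ x → con 0ℤ := x :+ :- x :* con 1ℤ) refl (v zero)
  insert0-clear zero            v (suc c) = solve 2 (λ x y → y := y :+ :- x :* con 0ℤ) refl (v zero) (v (suc c))
  insert0-clear {suc m} (suc j) v zero    = solve 2 (λ x y → y := y :+ :- x :* con 0ℤ) refl (v (suc j)) (v zero)
  insert0-clear {suc m} (suc j) v (suc c) = insert0-clear j (v ∘ suc) c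

  module FormProperties {m} (D : Matrix (suc m) → ℤ) (alt : Alternating D) where
    open Alternating alt

    expand-row : ∀ k (a : Fin k → ℤ) (E : Fin k → Row (suc m)) (R : Fin m → Row (suc m)) →
      D ((λ c → sumFin (λ j → a j * E j c)) ◂ R) ≡ sumFin (λ j → a j * D (E j ◂ R))
    expand-row zero a E R = linear zero 0ℤ 0ℤ zero-row zero-row zero-row
      (λ _ _ _ → refl) (λ _ _ _ → refl) (λ _ → refl)
      where
      zero-row : Matrix (suc m)
      zero-row = (λ _ → 0ℤ) ◂ R
    expand-row (suc k) a E R = begin
      D ((λ c → sumFin (λ j → a j * E j c)) ◂ R)
        ≡⟨ linear zero (a zero) 1ℤ _ (E zero ◂ R) (rest ◂ R)
             (λ { zero p _ → ⊥-elim (p refl) ; (suc r) _ _ → refl })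
             (λ { zero p _ → ⊥-elim (p refl) ; (suc r) _ _ → refl })
             (λ c → cong (λ t → a zero * E zero c + t) (sym (ℤₚ.*-identityˡ (rest c)))) ⟩
      a zero * D (E zero ◂ R) + 1ℤ * D (rest ◂ R)
        ≡⟨ cong (λ t → a zero * D (E zero ◂ R) + t) (trans (ℤₚ.*-identityˡ _) (expand-row k (a ∘ suc) (E ∘ suc) R)) ⟩
      a zero * D (E zero ◂ R) + sumFin (λ j → a (suc j) * D (E (suc j) ◂ R)) ∎
      where
      rest : Row (suc m)
      rest c = sumFin (λ j → a (suc j) * E (suc j) c)

    add-to-row : ∀ (i : Fin m) x (v : Row (suc m)) (R R′ : Fin m → Row (suc m)) →
      (∀ r → r ≢ i → ∀ c → R′ r c ≡ R r c) → (∀ c → R′ i c ≡ R i c + x * v c) → D (v ◂ R′) ≡ D (v ◂ R)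
    add-to-row i x v R R′ off at-i = begin
      D (v ◂ R′)                         ≡⟨ linear (suc i) 1ℤ x (v ◂ R′) (v ◂ R) (v ◂ update-i)
                                              (λ { zero _ _ → refl ; (suc r) p c → off r (p ∘ cong suc) c })
                                              (λ { zero _ _ → refl ; (suc r) p c → trans (off r (p ∘ cong suc) c) (sym (update-i-off r (p ∘ cong suc) c)) })
                                              (λ c → trans (at-i c) (sym (cong₂ _+_ (ℤₚ.*-identityˡ (R i c)) (cong (x *_) (update-i-at c))))) ⟩
      1ℤ * D (v ◂ R) + x * D (v ◂ update-i) ≡⟨ cong₂ _+_ (ℤₚ.*-identityˡ (D (v ◂ R))) (trans (cong (x *_)
                                              (alternates (v ◂ update-i) zero (suc i) (λ ()) (λ c → sym (update-i-at c)))) (ℤₚ.*-zeroʳ x)) ⟩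
      D (v ◂ R) + 0ℤ                     ≡⟨ ℤₚ.+-identityʳ (D (v ◂ R)) ⟩
      D (v ◂ R)                          ∎
      where
      update-i : Fin m → Row (suc m)
      update-i r with r Fin.≟ i
      ... | yes _ = v
      ... | no  _ = R r
      update-i-at : ∀ c → update-i i c ≡ v c
      update-i-at c with i Fin.≟ i
      ... | yes _ = refl
      ... | no  p = ⊥-elim (p refl)
      update-i-off : ∀ r → r ≢ i → ∀ c → update-i r c ≡ R r c
      update-i-off r p c with r Fin.≟ i
      ... | yes q = ⊥-elim (p q)
      ... | no  _ = refl

    -- Row r receives its multiple of v as soon as toℕ r < k; the rows are treated one k at a time.
    clear-prefix : ∀ k → k ℕ.≤ m → (x : Fin m → ℤ) (v : Row (suc m)) (R : Fin m → Row (suc m)) →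
      D (v ◂ λ r c → R r c + (if toℕ r ℕ.<ᵇ k then x r else 0ℤ) * v c) ≡ D (v ◂ R)
    clear-prefix zero    _   x v R = respects (λ { zero c → refl
      ; (suc r) c → solve 2 (λ a b → a :+ con 0ℤ :* b := a) refl (R r c) (v c) })
    clear-prefix (suc k) k<m x v R = trans
      (add-to-row i (x i) v (stage k) (stage (suc k)) off at-i) (clear-prefix k (ℕₚ.<⇒≤ k<m) x v R)
      where
      i : Fin m
      i = Fin.fromℕ< k<m
      stage : ℕ → Fin m → Row (suc m)
      stage k r c = R r c + (if toℕ r ℕ.<ᵇ k then x r else 0ℤ) * v c
      <ᵇ-suc : ∀ a b → a ≢ b → (a ℕ.<ᵇ suc b) ≡ (a ℕ.<ᵇ b)
      <ᵇ-suc zero    zero    p = ⊥-elim (p refl)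
      <ᵇ-suc zero    (suc b) p = refl
      <ᵇ-suc (suc a) zero    p = refl
      <ᵇ-suc (suc a) (suc b) p = <ᵇ-suc a b (p ∘ cong suc)
      <ᵇ-refl : ∀ a → (a ℕ.<ᵇ a) ≡ false
      <ᵇ-refl zero    = refl
      <ᵇ-refl (suc a) = <ᵇ-refl a
      <ᵇ-self : ∀ a → (a ℕ.<ᵇ suc a) ≡ true
      <ᵇ-self zero    = refl
      <ᵇ-self (suc a) = <ᵇ-self a
      off : ∀ r → r ≢ i → ∀ c → stage (suc k) r c ≡ stage k r c
      off r r≢i c rewrite <ᵇ-suc (toℕ r) k
        (λ e → r≢i (Finₚ.toℕ-injective (trans e (sym (Finₚ.toℕ-fromℕ< k<m))))) = refl
      at-i : ∀ c → stage (suc k) i c ≡ stage k i c + x i * v c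
      at-i c rewrite Finₚ.toℕ-fromℕ< k<m | <ᵇ-refl k | <ᵇ-self k =
        solve 3 (λ a b d → a :+ b :* d := (a :+ con 0ℤ :* d) :+ b :* d) refl (R i c) (x i) (v c)

    clear : ∀ (x : Fin m → ℤ) (v : Row (suc m)) (R : Fin m → Row (suc m)) →
      D (v ◂ λ r c → R r c + x r * v c) ≡ D (v ◂ R)
    clear x v R = trans (respects (λ { zero c → refl
      ; (suc r) c → cong (λ b → R r c + (if b then x r else 0ℤ) * v c) (sym (full r)) }))
      (clear-prefix m ℕₚ.≤-refl x v R)
      where
      full : ∀ {m} (r : Fin m) → (toℕ r ℕ.<ᵇ m) ≡ true
      full zero    = refl
      full (suc r) = full r

    -- With the unit row on top and column j cleared below, D becomes an alternating form in one
    -- dimension less, to which induction applies.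
    cofactor : Fin (suc m) → Matrix m → ℤ
    cofactor j B = D (δ j ◂ λ r → insert0 j (B r))

    cofactor-alternating : ∀ j → Alternating (cofactor j)
    cofactor-alternating j = record
      { respects = λ e → respects (λ { zero c → refl ; (suc r) c → insert0-cong j (e r) c })
      ; linear = λ i a b M M₁ M₂ e₁ e₂ e → linear (suc i) a b _ _ _
          (λ { zero _ c → refl ; (suc r) p c → insert0-cong j (e₁ r (p ∘ cong suc)) c })
          (λ { zero _ c → refl ; (suc r) p c → insert0-cong j (e₂ r (p ∘ cong suc)) c })
          (λ c → insert0-linear j a b e c)
      ; alternates = λ M i k i≢k e → alternates _ (suc i) (suc k) (i≢k ∘ Finₚ.suc-injective)
          (λ c → insert0-cong j e c) }

    rotated : Fin (suc m) → Matrix (suc m)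
    rotated j = δ j ◂ λ r → δ (punchIn j r)

    -- Moving row j of the identity to the top is a cycle; passing from i to i + 1 exchanges the top
    -- row with row i + 1 and so flips the sign.
    rotated-sgn : ∀ j → D (rotated j) ≡ sgn j * D δ
    rotated-sgn = <-weakInduction (λ j → D (rotated j) ≡ sgn j * D δ)
      (trans (respects (λ { zero c → refl ; (suc r) c → refl })) (sym (ℤₚ.*-identityˡ (D δ)))) step
      where
      punchIn-diag₁ : ∀ {m} (i : Fin m) → punchIn (inject₁ i) i ≡ suc i
      punchIn-diag₁ i = punchIn-inject₁ i i ℕₚ.≤-refl
      punchIn-diag : ∀ {m} (i : Fin m) → punchIn (suc i) i ≡ inject₁ i
      punchIn-diag i = punchIn-suc i i ℕₚ.≤-refl
      punchIn-off : ∀ {m} (i r : Fin m) → r ≢ i → punchIn (suc i) r ≡ punchIn (inject₁ i) r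
      punchIn-off zero    zero    p = ⊥-elim (p refl)
      punchIn-off zero    (suc r) p = refl
      punchIn-off (suc i) zero    p = refl
      punchIn-off (suc i) (suc r) p = cong suc (punchIn-off i r (p ∘ cong suc))
      step : ∀ (i : Fin m) → D (rotated (inject₁ i)) ≡ sgn (inject₁ i) * D δ → D (rotated (suc i)) ≡ sgn (suc i) * D δ
      step i IH rewrite Finₚ.toℕ-inject₁ i = begin
        D (rotated (suc i))                           ≡⟨ solve 2 (λ x y → y := (x :+ y) :+ :- x) refl
                                                           (D (rotated (inject₁ i))) (D (rotated (suc i))) ⟩
        (D (rotated (inject₁ i)) + D (rotated (suc i))) + ℤ.- D (rotated (inject₁ i))
          ≡⟨ cong₂ (λ x y → x + ℤ.- y) swapped IH ⟩
        0ℤ + ℤ.- (sgn i * D δ)                        ≡⟨ solve 2 (λ s d → con 0ℤ :+ :- (s :* d) := (con -1ℤ :* s) :* d) refl (sgn i) (D δ) ⟩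
        (-1ℤ * sgn i) * D δ                           ∎
        where
        open Skew D respects linear zero (suc i) (λ ()) (λ M e → alternates M zero (suc i) (λ ()) e)
        swapped : D (rotated (inject₁ i)) + D (rotated (suc i)) ≡ 0ℤ
        swapped = skew _ _ (λ c → cong (λ k → δ k c) (sym (punchIn-diag₁ i)))
          (λ c → cong (λ k → δ k c) (punchIn-diag i))
          (λ { zero p _ _ → ⊥-elim (p refl)
             ; (suc r) _ q c → cong (λ k → δ k c) (punchIn-off i r (q ∘ cong suc)) })

  -- Expand the first row into unit rows, clear column j from the other rows, and apply induction to
  -- the cofactor form; what remains is the Laplace expansion of `det`.
  alternating-unique : ∀ {m} (D : Matrix m → ℤ) → Alternating D → ∀ M → D M ≡ det M * D δ
  alternating-unique {zero} D alt M = trans (Alternating.respects alt (λ ())) (sym (ℤₚ.*-identityˡ (D δ)))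
  alternating-unique {suc m} D alt M = begin
    D M                                                     ≡⟨ respects (λ { zero c → sym (sum-δʳ c (M zero)) ; (suc r) c → refl }) ⟩
    D ((λ c → sumFin (λ j → M zero j * δ j c)) ◂ (M ∘ suc)) ≡⟨ expand-row (suc m) (M zero) δ (M ∘ suc) ⟩
    sumFin (λ j → M zero j * D (δ j ◂ (M ∘ suc)))           ≡⟨ sum-cong term ⟩
    sumFin (λ j → D δ * laplaceTerm M j)                    ≡⟨ sum-*ˡ (D δ) (laplaceTerm M) ⟨
    D δ * det M                                             ≡⟨ ℤₚ.*-comm (D δ) (det M) ⟩
    det M * D δ                                             ∎
    where
    open Alternating alt
    open FormProperties D alt
    term : ∀ j → M zero j * D (δ j ◂ (M ∘ suc)) ≡ D δ * laplaceTerm M j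
    term j = begin
      M zero j * D (δ j ◂ (M ∘ suc))                   ≡⟨ cong (M zero j *_) (clear (λ r → ℤ.- M (suc r) j) (δ j) (M ∘ suc)) ⟨
      M zero j * D (δ j ◂ λ r c → M (suc r) c + ℤ.- M (suc r) j * δ j c)
        ≡⟨ cong (M zero j *_) (respects (λ { zero c → refl ; (suc r) c → sym (insert0-clear j (M (suc r)) c) })) ⟩
      M zero j * cofactor j (minor M j)                ≡⟨ cong (M zero j *_) (alternating-unique (cofactor j) (cofactor-alternating j) (minor M j)) ⟩
      M zero j * (det (minor M j) * cofactor j δ)      ≡⟨ cong (λ t → M zero j * (det (minor M j) * t))
                                                            (trans (respects (λ { zero c → refl ; (suc r) c → insert0-δ j r c })) (rotated-sgn j)) ⟩
      M zero j * (det (minor M j) * (sgn j * D δ))     ≡⟨ solve 4 (λ a b s d → a :* (b :* (s :* d)) := d :* (s :* (a :* b))) refl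
                                                            (M zero j) (det (minor M j)) (sgn j) (D δ) ⟩
      D δ * laplaceTerm M j                            ∎

  infixl 7 _⊡_
  _⊡_ : ∀ {m} → Matrix m → Matrix m → Matrix m
  (A ⊡ B) r c = sumFin (λ k → A r k * B k c)

  -- As a function of the rows of A, det (A B) is alternating, hence det A times its value at the
  -- identity matrix, which is det B.
  det-* : ∀ {m} (A B : Matrix m) → det (A ⊡ B) ≡ det A * det B
  det-* {m} A B = trans (alternating-unique (λ A → det (A ⊡ B)) right-multiplication A)
    (cong (det A *_) (det-cong (λ r c → sum-δˡ r (λ k → B k c))))
    where
    row-cong : ∀ {u v : Row m} → (∀ k → u k ≡ v k) → ∀ c → sumFin (λ k → u k * B k c) ≡ sumFin (λ k → v k * B k c)
    row-cong e c = sum-cong (λ k → cong (_* B k c) (e k))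
    right-multiplication : Alternating (λ A → det (A ⊡ B))
    right-multiplication = record
      { respects = λ e → det-cong (λ r → row-cong (e r))
      ; linear = λ i a b M M₁ M₂ e₁ e₂ e → det-linear i a b (M ⊡ B) (M₁ ⊡ B) (M₂ ⊡ B)
          (λ r p → row-cong (e₁ r p)) (λ r p → row-cong (e₂ r p))
          (λ c → trans (sum-cong (λ k → trans (cong (_* B k c) (e k))
                   (solve 5 (λ a x b y z → (a :* x :+ b :* y) :* z := a :* (x :* z) :+ b :* (y :* z)) refl
                     a (M₁ i k) b (M₂ i k) (B k c))))
                 (sum-linear a b (λ k → M₁ i k * B k c) (λ k → M₂ i k * B k c)))
      ; alternates = λ M i j i≢j e → det-alternates (M ⊡ B) i j i≢j (row-cong e) }

  det-row₀ : ∀ {m} (M : Matrix (suc m)) → (∀ c → M zero (suc c) ≡ 0ℤ) → det M ≡ M zero zero * det (minor M zero)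
  det-row₀ {m} M e = begin
    laplaceTerm M zero + sumFin (λ j → laplaceTerm M (suc j))
      ≡⟨ cong₂ _+_ (ℤₚ.*-identityˡ (M zero zero * det (minor M zero))) (trans (sum-cong {f = λ j → laplaceTerm M (suc j)} {λ _ → 0ℤ}
           (λ j → trans (cong (λ t → sgn (suc j) * (t * det (minor M (suc j)))) (e j))
             (trans (cong (sgn (suc j) *_) (ℤₚ.*-zeroˡ (det (minor M (suc j))))) (ℤₚ.*-zeroʳ (sgn (suc j)))))) (sum-0 m)) ⟩
    M zero zero * det (minor M zero) + 0ℤ     ≡⟨ ℤₚ.+-identityʳ (M zero zero * det (minor M zero)) ⟩
    M zero zero * det (minor M zero)          ∎

  det-zero-column₀ : ∀ {m} (M : Matrix (suc m)) → (∀ r → M r zero ≡ 0ℤ) → det M ≡ 0ℤ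
  det-zero-column₀ {m} M e = trans (sum-cong {f = laplaceTerm M} {λ _ → 0ℤ} (vanish M e)) (sum-0 (suc m))
    where
    vanish : ∀ {m} (M : Matrix (suc m)) → (∀ r → M r zero ≡ 0ℤ) → ∀ j → laplaceTerm M j ≡ 0ℤ
    vanish M e zero = trans (cong (λ t → 1ℤ * (t * det (minor M zero))) (e zero))
      (trans (ℤₚ.*-identityˡ _) (ℤₚ.*-zeroˡ (det (minor M zero))))
    vanish {suc m} M e (suc j) = trans (cong (λ t → sgn (suc j) * (M zero (suc j) * t))
      (det-zero-column₀ (minor M (suc j)) (λ r → e (suc r))))
      (trans (cong (sgn (suc j) *_) (ℤₚ.*-zeroʳ (M zero (suc j)))) (ℤₚ.*-zeroʳ (sgn (suc j))))

  -- `det` expands along row zero; deleting any column but the first leaves a minor whose first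
  -- column is zero.
  det-column₀ : ∀ {m} (M : Matrix (suc m)) → (∀ r → M (suc r) zero ≡ 0ℤ) → det M ≡ M zero zero * det (minor M zero)
  det-column₀ {zero} M e = det-row₀ M (λ ())
  det-column₀ {suc m} M e = begin
    laplaceTerm M zero + sumFin (λ j → laplaceTerm M (suc j))
      ≡⟨ cong₂ _+_ (ℤₚ.*-identityˡ (M zero zero * det (minor M zero))) (trans (sum-cong {f = λ j → laplaceTerm M (suc j)} {λ _ → 0ℤ}
           (λ j → trans (cong (λ t → sgn (suc j) * (M zero (suc j) * t)) (det-zero-column₀ (minor M (suc j)) e))
             (trans (cong (sgn (suc j) *_) (ℤₚ.*-zeroʳ (M zero (suc j)))) (ℤₚ.*-zeroʳ (sgn (suc j)))))) (sum-0 (suc m))) ⟩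
    M zero zero * det (minor M zero) + 0ℤ     ≡⟨ ℤₚ.+-identityʳ (M zero zero * det (minor M zero)) ⟩
    M zero zero * det (minor M zero)          ∎

  det-unitriangular : ∀ {m} (M : Matrix m) → (∀ r → M r r ≡ 1ℤ) → (∀ r c → c Fin.< r → M r c ≡ 0ℤ) → det M ≡ 1ℤ
  det-unitriangular {zero} M diag low = refl
  det-unitriangular {suc m} M diag low = trans (det-column₀ M (λ r → low (suc r) zero (s≤s z≤n)))
    (cong₂ _*_ (diag zero) (det-unitriangular (minor M zero) (diag ∘ suc) (λ r c c<r → low (suc r) (suc c) (s≤s c<r))))

  det-block : ∀ k {m} (M : Matrix (k ℕ.+ m)) → (∀ r c → toℕ r ℕ.< k → M r c ≡ δ r c) →
    det M ≡ det (λ i j → M (k ↑ʳ i) (k ↑ʳ j))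
  det-block zero    M e = refl
  det-block (suc k) M e = trans (det-row₀ M (λ c → e zero (suc c) (s≤s z≤n)))
    (trans (cong₂ _*_ (e zero zero (s≤s z≤n)) (det-block k (minor M zero) (λ r c r<k → e (suc r) (suc c) (s≤s r<k))))
      (ℤₚ.*-identityˡ _))

  det-scalar : ∀ {m} x (M : Matrix m) → (∀ r c → M r c ≡ x * δ r c) → det M ≡ x ℤ.^ m
  det-scalar {zero}  x M e = refl
  det-scalar {suc m} x M e = trans (det-row₀ M (λ c → trans (e zero (suc c)) (ℤₚ.*-zeroʳ x)))
    (cong₂ _*_ (trans (e zero zero) (ℤₚ.*-identityʳ x)) (det-scalar x (minor M zero) (λ r c → e (suc r) (suc c))))

-- Norms and resultants

module Monomials where
  open import Data.Fin using (Fin; zero; suc; toℕ)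
  open Zx using (coeff; monomial; shiftX; scale; sumFin)
  open PolynomialRing
  open Determinant using (sum-cong)
  open CommutativeRing ℤ[x] using (_+_; _*_; _-_; -_)
    renaming (refl to ≋-refl; sym to ≋-sym)

  xpow : ℕ → ℤ[X]
  xpow = monomial 1ℤ

  coeff-monomial : ∀ c n → coeff (monomial c n) n ≡ c
  coeff-monomial c zero    = refl
  coeff-monomial c (suc n) = coeff-monomial c n

  coeff-monomial-≢ : ∀ c n k → n ≢ k → coeff (monomial c n) k ≡ 0ℤ
  coeff-monomial-≢ c zero    zero    p = ⊥-elim (p refl)
  coeff-monomial-≢ c zero    (suc k) p = refl
  coeff-monomial-≢ c (suc n) zero    p = refl
  coeff-monomial-≢ c (suc n) (suc k) p = coeff-monomial-≢ c n k (p ∘ cong suc)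

  xpow-suc-* : ∀ n p → xpow (suc n) * p ≋ shiftX (xpow n * p)
  xpow-suc-* n p = shiftX-* (xpow n) p

  coeff-xpow-* : ∀ s p u → coeff (xpow s * p) (s ℕ.+ u) ≡ coeff p u
  coeff-xpow-* zero    p u = coeff-*-identityˡ p u
  coeff-xpow-* (suc s) p u = trans (at (xpow-suc-* s p) (suc (s ℕ.+ u))) (coeff-xpow-* s p u)

  coeff-xpow-*-< : ∀ s p t → t ℕ.< s → coeff (xpow s * p) t ≡ 0ℤ
  coeff-xpow-*-< (suc s) p zero    _         = at (xpow-suc-* s p) 0
  coeff-xpow-*-< (suc s) p (suc t) (s≤s t<s) = trans (at (xpow-suc-* s p) (suc t)) (coeff-xpow-*-< s p t t<s)

  Monic-xpow : ∀ n → Monic (xpow n) n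
  Monic-xpow n = coeff-monomial 1ℤ n , λ k n<k → coeff-monomial-≢ 1ℤ n k (ℕₚ.<⇒≢ n<k)

  -- Rows and columns of the matrices below run through the powers of x in descending order.
  exponent : ∀ {d} → Fin d → ℕ
  exponent {d} k = d ∸ suc (toℕ k)

  exponent-< : ∀ {d} (k : Fin d) → exponent k ℕ.< d
  exponent-< {suc d} k = s≤s (ℕₚ.m∸n≤m d (toℕ k))

  record Linear (T : ℤ[X] → ℤ) : Set where
    field
      T-cong  : ∀ {p q} → p ≋ q → T p ≡ T q
      T-+     : ∀ p q → T (p + q) ≡ T p ℤ.+ T q
      T-scale : ∀ c p → T (scale c p) ≡ c ℤ.* T p

  -- Evaluates a linear functional in the power basis. Taking remainders, multiplying by f and
  -- reading a coefficient are all instances, so that matrix products appear without separate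
  -- computations. The leading term is split off because `exponent` descends.
  linear-expansion : ∀ {T} → Linear T → ∀ d p → Below p d →
    T p ≡ sumFin {d} (λ k → coeff p (exponent k) ℤ.* T (xpow (exponent k)))
  linear-expansion {T} lin zero p b = trans (T-cong (Below-0 b)) (T-scale 0ℤ [])
    where open Linear lin
  linear-expansion {T} lin (suc d) p b = begin
    T p                                     ≡⟨ T-cong split ⟩
    T (scale c (xpow d) + p′)               ≡⟨ T-+ (scale c (xpow d)) p′ ⟩
    T (scale c (xpow d)) ℤ.+ T p′           ≡⟨ cong₂ ℤ._+_ (T-scale c (xpow d)) (linear-expansion lin d p′ p′-below) ⟩
    c ℤ.* T (xpow d) ℤ.+ sumFin {d} (λ k → coeff p′ (exponent k) ℤ.* T (xpow (exponent k)))
      ≡⟨ cong (λ t → c ℤ.* T (xpow d) ℤ.+ t) (sum-cong (λ k → cong (ℤ._* T (xpow (exponent k)))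
           (p′-coeff (exponent k) (λ e → ℕₚ.<⇒≢ (exponent-< k) (sym e))))) ⟩
    c ℤ.* T (xpow d) ℤ.+ sumFin {d} (λ k → coeff p (exponent k) ℤ.* T (xpow (exponent k))) ∎
    where
    open Linear lin
    open ≡-Reasoning
    c = coeff p d
    p′ = p - scale c (xpow d)
    coeff-p′ : ∀ k → coeff p′ k ≡ coeff p k ℤ.+ ℤ.- (c ℤ.* coeff (xpow d) k)
    coeff-p′ k = trans (coeff-+ p (- scale c (xpow d)) k) (cong (λ t → coeff p k ℤ.+ t)
      (trans (coeff-neg (scale c (xpow d)) k) (cong ℤ.-_ (coeff-scale c (xpow d) k))))
    p′-coeff : ∀ k → d ≢ k → coeff p′ k ≡ coeff p k
    p′-coeff k d≢k = trans (coeff-p′ k) (trans (cong (λ t → coeff p k ℤ.+ ℤ.- (c ℤ.* t)) (coeff-monomial-≢ 1ℤ d k d≢k))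
      (trans (cong (λ t → coeff p k ℤ.+ ℤ.- t) (ℤₚ.*-zeroʳ c)) (ℤₚ.+-identityʳ _)))
    p′-below : Below p′ d
    p′-below k d≤k with ℕₚ.m≤n⇒m<n∨m≡n d≤k
    ... | inj₁ d<k  = trans (p′-coeff k (ℕₚ.<⇒≢ d<k)) (b k d<k)
    ... | inj₂ refl = trans (coeff-p′ d) (trans (cong (λ t → c ℤ.+ ℤ.- (c ℤ.* t)) (coeff-monomial 1ℤ d))
                        (trans (cong (λ t → c ℤ.+ ℤ.- t) (ℤₚ.*-identityʳ c)) (ℤₚ.+-inverseʳ c)))
    split : p ≋ scale c (xpow d) + p′
    split = ≋-sym (IntegerSolver.solve ℤ[x] 2 (λ p s → s :+ (p :- s) := p) ≋-refl p (scale c (xpow d)))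
      where open IntegerSolver ℤ[x] using (_:+_; _:-_; _:=_)

module Division (f : ℤ[X]) (d : ℕ) (monic : Zx.coeff f d ≡ 1ℤ × PolynomialRing.Below f (suc d)) where
  open Zx using (coeff; scale; const)
  open PolynomialRing
  open CommutativeRing ℤ[x] using (_+_; _*_; _-_; -_; setoid; +-cong; +-congˡ; +-congʳ; *-congˡ; +-identityʳ)
    renaming (refl to ≋-refl; sym to ≋-sym; trans to ≋-trans)
  open IntegerSolver ℤ[x] using (solve; _:+_; _:-_; _:*_; :-_; _:=_)

  -- Division by Horner's scheme: if p has remainder r, then a + x p is congruent to a + x r, whose
  -- coefficient at d is the next digit of the quotient and is removed by subtracting that multiple
  -- of f.
  remainder : ℤ[X] → ℤ[X]
  remainder []      = []
  remainder (a ∷ p) = (a ∷ remainder p) - const (coeff (a ∷ remainder p) d) * f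

  quotient : ℤ[X] → ℤ[X]
  quotient []      = []
  quotient (a ∷ p) = coeff (a ∷ remainder p) d ∷ quotient p

  remainder-below : ∀ p → Below (remainder p) d
  remainder-below [] k d≤k = refl
  remainder-below (a ∷ p) k d≤k = begin
    coeff (remainder (a ∷ p)) k                      ≡⟨ coeff-+ r (- (const c * f)) k ⟩
    coeff r k ℤ.+ coeff (- (const c * f)) k          ≡⟨ cong (λ t → coeff r k ℤ.+ t) (trans (coeff-neg (const c * f) k)
                                                          (cong ℤ.-_ (trans (at (const-* c f) k) (coeff-scale c f k)))) ⟩
    coeff r k ℤ.+ ℤ.- (c ℤ.* coeff f k)              ≡⟨ by-degree (ℕₚ.m≤n⇒m<n∨m≡n d≤k) ⟩
    0ℤ                                               ∎
    where
    open ≡-Reasoning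
    open import Data.Sum using (_⊎_)
    r = a ∷ remainder p
    c = coeff r d
    r-below : ∀ j → d ℕ.< j → coeff r j ≡ 0ℤ
    r-below (suc j) (s≤s d≤j) = remainder-below p j d≤j
    by-degree : d ℕ.< k ⊎ d ≡ k → coeff r k ℤ.+ ℤ.- (c ℤ.* coeff f k) ≡ 0ℤ
    by-degree (inj₁ d<k)  = trans (cong₂ (λ s t → s ℤ.+ ℤ.- (c ℤ.* t)) (r-below k d<k) (proj₂ monic k d<k))
                              (trans (ℤₚ.+-identityˡ _) (cong ℤ.-_ (ℤₚ.*-zeroʳ c)))
    by-degree (inj₂ refl) = trans (cong (λ t → c ℤ.+ ℤ.- (c ℤ.* t)) (proj₁ monic))
                              (trans (cong (λ t → c ℤ.+ ℤ.- t) (ℤₚ.*-identityʳ c)) (ℤₚ.+-inverseʳ c))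

  division : ∀ p → p ≋ quotient p * f + remainder p
  division [] = ≋-refl
  division (a ∷ p) = begin
    a ∷ p                                       ≈⟨ ∷-split a p ⟩
    const a + X * p                             ≈⟨ +-congˡ {const a} (*-congˡ {X} (division p)) ⟩
    const a + X * (quotient p * f + remainder p)
      ≈⟨ solve 6 (λ a x q f r c → a :+ x :* (q :* f :+ r) := (c :+ x :* q) :* f :+ ((a :+ x :* r) :- c :* f)) ≋-refl
           (const a) X (quotient p) f (remainder p) (const c) ⟩
    (const c + X * quotient p) * f + ((const a + X * remainder p) - const c * f)
      ≈⟨ +-cong (CommutativeRing.*-congʳ ℤ[x] {f} (≋-sym (∷-split c (quotient p))))
                (+-congʳ { - (const c * f)} (≋-sym (∷-split a (remainder p)))) ⟩
    (c ∷ quotient p) * f + ((a ∷ remainder p) - const c * f) ∎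
    where
    open Relation.Binary.Reasoning.Setoid setoid
    c = coeff (a ∷ remainder p) d

  coeff-minus : ∀ p q k → coeff (p - q) k ≡ coeff p k ℤ.- coeff q k
  coeff-minus p q k = trans (coeff-+ p (- q) k) (cong (λ t → coeff p k ℤ.+ t) (coeff-neg q k))

  -- Two representations differ by a multiple of the monic f of degree below d, which forces the
  -- cofactor to vanish.
  remainder-unique : ∀ p q r → Below r d → p ≋ q * f + r → remainder p ≋ r
  remainder-unique p q r r-below e = ≋-sym (x∙y⁻¹≈ε⇒x≈y r (remainder p)
    (≋-trans (≋-sym fh≋) (≋-trans (*-congˡ {f} h≋0) (zeroʳ f))))
    where
    open Relation.Binary.Reasoning.Setoid setoid
    open import Algebra.Properties.Ring (CommutativeRing.ring ℤ[x]) using (x∙y⁻¹≈ε⇒x≈y)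
    open CommutativeRing ℤ[x] using (zeroʳ)
    h = quotient p - q
    fh≋ : f * h ≋ r - remainder p
    fh≋ = begin
      f * h                                  ≈⟨ solve 4 (λ f q q′ r → f :* (q′ :- q) := (q′ :* f :+ r) :- (q :* f :+ r)) ≋-refl
                                                  f q (quotient p) (remainder p) ⟩
      (quotient p * f + remainder p) - (q * f + remainder p)
                                             ≈⟨ +-congʳ { - (q * f + remainder p)} (≋-trans (≋-sym (division p)) e) ⟩
      (q * f + r) - (q * f + remainder p)    ≈⟨ solve 4 (λ f q r r′ → (q :* f :+ r) :- (q :* f :+ r′) := r :- r′) ≋-refl f q r (remainder p) ⟩
      r - remainder p                        ∎
    h≋0 : h ≋ []
    h≋0 = Below-0 (Below-quotient f h d 0 monic (subst (Below (f * h)) (sym (ℕₚ.+-identityʳ d))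
      (Below-cong {r - remainder p} (≋-sym fh≋) (λ k d≤k → trans (coeff-minus r (remainder p) k)
        (cong₂ ℤ._-_ (r-below k d≤k) (remainder-below p k d≤k))))))

  remainder-cong : ∀ {p q} → p ≋ q → remainder p ≋ remainder q
  remainder-cong {p} {q} e = remainder-unique p (quotient q) (remainder q) (remainder-below q) (≋-trans e (division q))

  remainder-id : ∀ p → Below p d → remainder p ≋ p
  remainder-id p b = remainder-unique p [] p b ≋-refl

  remainder-mod : ∀ p q h → p ≋ q + h * f → remainder p ≋ remainder q
  remainder-mod p q h e = remainder-unique p (quotient q + h) (remainder q) (remainder-below q)
    (≋-trans e (≋-trans (+-congʳ {h * f} (division q))
      (solve 4 (λ q r h f → (q :* f :+ r) :+ h :* f := (q :+ h) :* f :+ r) ≋-refl (quotient q) (remainder q) h f)))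

  remainder-+ : ∀ p q → remainder (p + q) ≋ remainder p + remainder q
  remainder-+ p q = remainder-unique (p + q) (quotient p + quotient q) (remainder p + remainder q)
    (λ k d≤k → trans (coeff-+ (remainder p) (remainder q) k) (cong₂ ℤ._+_ (remainder-below p k d≤k) (remainder-below q k d≤k)))
    (≋-trans (+-cong (division p) (division q))
      (solve 5 (λ a r b s f → (a :* f :+ r) :+ (b :* f :+ s) := (a :+ b) :* f :+ (r :+ s)) ≋-refl
        (quotient p) (remainder p) (quotient q) (remainder q) f))

  remainder-scale : ∀ c p → remainder (scale c p) ≋ scale c (remainder p)
  remainder-scale c p = remainder-unique (scale c p) (const c * quotient p) (scale c (remainder p))
    (λ k d≤k → trans (coeff-scale c (remainder p) k) (trans (cong (c ℤ.*_) (remainder-below p k d≤k)) (ℤₚ.*-zeroʳ c)))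
    (≋-trans (≋-sym (const-* c p)) (≋-trans (*-congˡ {const c} (division p))
      (≋-trans (solve 4 (λ c q f r → c :* (q :* f :+ r) := c :* q :* f :+ c :* r) ≋-refl (const c) (quotient p) f (remainder p))
        (+-congˡ {const c * quotient p * f} (const-* c (remainder p))))))

  quotient-below : ∀ p k → Below p (d ℕ.+ k) → Below (quotient p) k
  quotient-below p k b = Below-quotient f (quotient p) d k monic (Below-cong {p - remainder p}
    (≋-trans (+-congʳ { - remainder p} (division p))
      (solve 3 (λ q f r → (q :* f :+ r) :- r := f :* q) ≋-refl (quotient p) f (remainder p)))
    (λ i l → trans (coeff-minus p (remainder p) i)
      (cong₂ ℤ._-_ (b i l) (remainder-below p i (ℕₚ.≤-trans (ℕₚ.m≤m+n d k) l)))))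

module Norm (f : ℤ[X]) (d : ℕ) (monic : PolynomialRing.Monic f d) where
  open import Data.Fin using (Fin; zero; suc; toℕ; splitAt; _↑ˡ_; _↑ʳ_)
  open Zx using (coeff; scale; const; sumFin; det)
  open PolynomialRing
  open Monomials
  open Division f d monic
  open Determinant
  open DeterminantUniqueness
  open CommutativeRing ℤ[x] using (_+_; _*_; *-congˡ; *-congʳ; *-comm; *-assoc; distribʳ)
    renaming (refl to ≋-refl; sym to ≋-sym; trans to ≋-trans)
  open IntegerSolver ℤ[x] using (solve; _:+_; _:*_; _:=_)

  -- Multiplication by g on ℤ[x]/f in the basis x^(d-1), ..., x, 1, with the images of the basis as
  -- rows.
  normMatrix : ℤ[X] → Matrix d
  normMatrix g i j = coeff (remainder (xpow (exponent i) * g)) (exponent j)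

  norm : ℤ[X] → ℤ
  norm g = det (normMatrix g)

  norm-mod : ∀ g g′ h → g ≋ g′ + h * f → norm g ≡ norm g′
  norm-mod g g′ h e = det-cong {M = normMatrix g} {normMatrix g′} (λ i j → at (remainder-mod (xpow (exponent i) * g) (xpow (exponent i) * g′) (xpow (exponent i) * h)
    (≋-trans (*-congˡ {xpow (exponent i)} e)
      (solve 4 (λ x g h f → x :* (g :+ h :* f) := x :* g :+ x :* h :* f) ≋-refl (xpow (exponent i)) g′ h f))) (exponent j))

  norm-cong : ∀ {g g′} → g ≋ g′ → norm g ≡ norm g′
  norm-cong {g} {g′} e = norm-mod g g′ [] (≋-trans e (≋-sym (CommutativeRing.+-identityʳ ℤ[x] g′)))

  coeff-remainder-linear : ∀ h k → Linear (λ p → coeff (remainder (p * h)) k)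
  coeff-remainder-linear h k = record
    { T-cong  = λ {p} {q} e → at (remainder-cong (*-congʳ {h} e)) k
    ; T-+     = λ p q → trans (at (remainder-cong (distribʳ h p q)) k)
        (trans (at (remainder-+ (p * h) (q * h)) k) (coeff-+ (remainder (p * h)) (remainder (q * h)) k))
    ; T-scale = λ c p → trans (at (remainder-cong (≋-trans (*-congʳ {h} (≋-sym (const-* c p)))
        (≋-trans (*-assoc (const c) p h) (const-* c (p * h))))) k)
        (trans (at (remainder-scale c (p * h)) k) (coeff-scale c (remainder (p * h)) k)) }

  -- Reducing x^i g modulo f before multiplying by h does not affect the final remainder, and
  -- expanding the reduced row in powers of x is the matrix product.
  norm-* : ∀ g h → norm (g * h) ≡ norm g ℤ.* norm h
  norm-* g h = trans (det-cong entries) (det-* (normMatrix g) (normMatrix h))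
    where
    entries : ∀ i j → normMatrix (g * h) i j ≡ (normMatrix g ⊡ normMatrix h) i j
    entries i j = trans
      (at (remainder-mod (x * (g * h)) (r * h) (q * h) (≋-trans (≋-sym (*-assoc x g h))
        (≋-trans (*-congʳ {h} (division (x * g))) (solve 4 (λ q f r h → (q :* f :+ r) :* h := r :* h :+ q :* h :* f) ≋-refl q f r h)))) (exponent j))
      (linear-expansion (coeff-remainder-linear h (exponent j)) d r (remainder-below (x * g)))
      where
      x = xpow (exponent i)
      q = quotient (x * g)
      r = remainder (x * g)

  exponent-injective : ∀ {d} {i j : Fin d} → exponent i ≡ exponent j → i ≡ j
  exponent-injective {d} {i} {j} e = Finₚ.toℕ-injective (ℕₚ.suc-injective (ℕₚ.∸-cancelˡ-≡ (Finₚ.toℕ<n i) (Finₚ.toℕ<n j) e))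

  coeff-xpow-δ : ∀ (i j : Fin d) → coeff (xpow (exponent i)) (exponent j) ≡ δ i j
  coeff-xpow-δ i j with i Fin.≟ j
  ... | yes refl = trans (coeff-monomial 1ℤ (exponent i)) (sym (δ-refl i))
  ... | no  i≢j  = trans (coeff-monomial-≢ 1ℤ (exponent i) (exponent j) (i≢j ∘ exponent-injective)) (sym (δ-≢ i≢j))

  xpow-below : ∀ (i : Fin d) → Below (xpow (exponent i)) d
  xpow-below i k d≤k = coeff-monomial-≢ 1ℤ (exponent i) k (λ e → ℕₚ.<⇒≢ (ℕₚ.<-≤-trans (exponent-< i) d≤k) e)

  norm-const : ∀ c → norm (const c) ≡ c ℤ.^ d
  norm-const c = det-scalar c (normMatrix (const c)) (λ i j → begin
    coeff (remainder (xpow (exponent i) * const c)) (exponent j)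
      ≡⟨ at (remainder-cong (≋-trans (*-comm (xpow (exponent i)) (const c)) (const-* c (xpow (exponent i))))) (exponent j) ⟩
    coeff (remainder (scale c (xpow (exponent i)))) (exponent j)
      ≡⟨ at (remainder-scale c (xpow (exponent i))) (exponent j) ⟩
    coeff (scale c (remainder (xpow (exponent i)))) (exponent j)
      ≡⟨ coeff-scale c (remainder (xpow (exponent i))) (exponent j) ⟩
    c ℤ.* coeff (remainder (xpow (exponent i))) (exponent j)
      ≡⟨ cong (c ℤ.*_) (trans (at (remainder-id (xpow (exponent i)) (xpow-below i)) (exponent j)) (coeff-xpow-δ i j)) ⟩
    c ℤ.* δ i j ∎)
    where open ≡-Reasoning

  -- The row stands for x^s g. The two cases where `sylvEntry` returns 0 correspond to exponents
  -- above the degree of x^s g and to exponents below s.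
  sylvEntry-coeff : ∀ g m s i j → Below g (suc m) → j ℕ.≤ i ℕ.+ s ℕ.+ m →
    Zx.sylvEntry g m i j ≡ coeff (xpow s * g) (i ℕ.+ s ℕ.+ m ∸ j)
  sylvEntry-coeff g m s i j b j≤ with j ℕ.<? i
  ... | yes j<i = sym (trans (cong (coeff (xpow s * g)) index) (trans (coeff-xpow-* s g (i ∸ j ℕ.+ m))
        (b (i ∸ j ℕ.+ m) (ℕₚ.+-monoˡ-≤ m (ℕₚ.m<n⇒0<n∸m j<i)))))
    where
    open ≡-Reasoning
    index : i ℕ.+ s ℕ.+ m ∸ j ≡ s ℕ.+ (i ∸ j ℕ.+ m)
    index = begin
      i ℕ.+ s ℕ.+ m ∸ j       ≡⟨ cong (_∸ j) (ℕₚ.+-assoc i s m) ⟩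
      i ℕ.+ (s ℕ.+ m) ∸ j     ≡⟨ ℕₚ.+-∸-comm (s ℕ.+ m) (ℕₚ.<⇒≤ j<i) ⟩
      i ∸ j ℕ.+ (s ℕ.+ m)     ≡⟨ ℕ-Solver.solve 3 (λ a s m → a ℕ-Solver.:+ (s ℕ-Solver.:+ m) ℕ-Solver.:= s ℕ-Solver.:+ (a ℕ-Solver.:+ m)) refl (i ∸ j) s m ⟩
      s ℕ.+ (i ∸ j ℕ.+ m)     ∎
  ... | no j≮i with m ℕ.<? (j ∸ i)
  ...   | yes m<e = sym (coeff-xpow-*-< s g (i ℕ.+ s ℕ.+ m ∸ j) (subst (ℕ._< s) (sym index) below-s))
    where
    i≤j : i ℕ.≤ j
    i≤j = ℕₚ.≮⇒≥ j≮i
    index : i ℕ.+ s ℕ.+ m ∸ j ≡ s ℕ.+ m ∸ (j ∸ i)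
    index = trans (cong₂ _∸_ (ℕₚ.+-assoc i s m) (sym (ℕₚ.m+[n∸m]≡n i≤j))) (ℕₚ.[m+n]∸[m+o]≡n∸o i (s ℕ.+ m) (j ∸ i))
    e≤ : j ∸ i ℕ.≤ s ℕ.+ m
    e≤ = ℕₚ.m≤n+o⇒m∸n≤o j i (subst (j ℕ.≤_) (ℕₚ.+-assoc i s m) j≤)
    below-s : s ℕ.+ m ∸ (j ∸ i) ℕ.< s
    below-s = ℕₚ.<-≤-trans (ℕₚ.∸-monoʳ-< m<e e≤) (ℕₚ.≤-reflexive (ℕₚ.m+n∸n≡m s m))
  ...   | no m≮e = sym (trans (cong (coeff (xpow s * g)) index) (coeff-xpow-* s g (m ∸ (j ∸ i))))
    where
    i≤j : i ℕ.≤ j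
    i≤j = ℕₚ.≮⇒≥ j≮i
    index : i ℕ.+ s ℕ.+ m ∸ j ≡ s ℕ.+ (m ∸ (j ∸ i))
    index = trans (cong₂ _∸_ (ℕₚ.+-assoc i s m) (sym (ℕₚ.m+[n∸m]≡n i≤j)))
      (trans (ℕₚ.[m+n]∸[m+o]≡n∸o i (s ℕ.+ m) (j ∸ i)) (ℕₚ.+-∸-assoc s (ℕₚ.≮⇒≥ m≮e)))

  sylvEntry-row : ∀ g m k i j → Below g (suc m) → i ℕ.< k → j ℕ.< k ℕ.+ m →
    Zx.sylvEntry g m i j ≡ coeff (xpow (k ∸ suc i) * g) (k ℕ.+ m ∸ suc j)
  sylvEntry-row g m k i j b i<k j<k+m = trans
    (sylvEntry-coeff g m (k ∸ suc i) i j b (ℕ.s≤s⁻¹ (subst (j ℕ.<_) (sym total) j<k+m)))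
    (cong (λ t → coeff (xpow (k ∸ suc i) * g) (t ∸ suc j)) total)
    where
    total : suc (i ℕ.+ (k ∸ suc i) ℕ.+ m) ≡ k ℕ.+ m
    total = cong (ℕ._+ m) (ℕₚ.m+[n∸m]≡n i<k)

  sum-split : ∀ k {m} (T : Fin (k ℕ.+ m) → ℤ) →
    sumFin T ≡ sumFin (λ l → T (l ↑ˡ m)) ℤ.+ sumFin (λ l → T (k ↑ʳ l))
  sum-split zero    T = sym (ℤₚ.+-identityˡ (sumFin T))
  sum-split (suc k) {m} T = trans (cong (λ t → T zero ℤ.+ t) (sum-split k (T ∘ suc)))
    (sym (ℤₚ.+-assoc (T zero) (sumFin (λ l → T (suc l ↑ˡ m))) _))

  -- Dividing the rows x^i g by f factors the Sylvester matrix as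
  --   ⎛ I  0 ⎞ ⎛ rows of f ⎞
  --   ⎝ Q  R ⎠ ⎝  0     I  ⎠
  -- with Q the quotients and R the remainders, i.e. the norm matrix.
  module Sylvester (g : ℤ[X]) (k : ℕ) (g-below : Below g (suc k)) where

    gRow : Fin d → ℤ[X]
    gRow i = xpow (exponent i) * g

    lowerMatrix : Matrix (k ℕ.+ d)
    lowerMatrix r c = [ (λ _ → δ r c)
                      , (λ i → [ (λ l → coeff (quotient (gRow i)) (exponent l))
                               , (λ j → coeff (remainder (gRow i)) (exponent j)) ]′ (splitAt k c)) ]′ (splitAt k r)

    upperRow : Fin k ⊎ Fin d → ℤ[X]
    upperRow (inj₁ l) = xpow (exponent l) * f
    upperRow (inj₂ j) = xpow (exponent j)

    upperMatrix : Matrix (k ℕ.+ d)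
    upperMatrix r c = coeff (upperRow (splitAt k r)) (exponent c)

    exponent-↑ˡ : ∀ (l : Fin k) → exponent (l ↑ˡ d) ≡ exponent l ℕ.+ d
    exponent-↑ˡ l rewrite Finₚ.toℕ-↑ˡ l d = ℕₚ.+-∸-comm d (Finₚ.toℕ<n l)

    exponent-↑ʳ : ∀ (j : Fin d) → exponent (k ↑ʳ j) ≡ exponent j
    exponent-↑ʳ j rewrite Finₚ.toℕ-↑ʳ k j | sym (ℕₚ.+-suc k (toℕ j)) = ℕₚ.[m+n]∸[m+o]≡n∸o k d (suc (toℕ j))

    sylvester-top : ∀ (l : Fin k) c → Zx.sylvester f d g k (l ↑ˡ d) c ≡ coeff (xpow (exponent l) * f) (exponent c)
    sylvester-top l c with toℕ (l ↑ˡ d) ℕ.<? k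
    ... | yes _ rewrite Finₚ.toℕ-↑ˡ l d = sylvEntry-row f d k (toℕ l) (toℕ c) (proj₂ monic) (Finₚ.toℕ<n l) (Finₚ.toℕ<n c)
    ... | no p = ⊥-elim (p (subst (ℕ._< k) (sym (Finₚ.toℕ-↑ˡ l d)) (Finₚ.toℕ<n l)))

    sylvester-bottom : ∀ (i : Fin d) c → Zx.sylvester f d g k (k ↑ʳ i) c ≡ coeff (gRow i) (exponent c)
    sylvester-bottom i c with toℕ (k ↑ʳ i) ℕ.<? k
    ... | yes p = ⊥-elim (ℕₚ.<⇒≱ p (subst (k ℕ.≤_) (sym (Finₚ.toℕ-↑ʳ k i)) (ℕₚ.m≤m+n k (toℕ i))))
    ... | no _ rewrite Finₚ.toℕ-↑ʳ k i | ℕₚ.m+n∸m≡n k (toℕ i) =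
      trans (sylvEntry-row g k d (toℕ i) (toℕ c) g-below (Finₚ.toℕ<n i) (subst (toℕ c ℕ.<_) (ℕₚ.+-comm k d) (Finₚ.toℕ<n c)))
        (cong (λ t → coeff (gRow i) (t ∸ suc (toℕ c))) (ℕₚ.+-comm d k))

    gRow-below : ∀ i → Below (gRow i) (d ℕ.+ k)
    gRow-below i = Below-mono {gRow i} bound (Below-* (xpow (exponent i)) g (exponent i) (suc k) (proj₂ (Monic-xpow (exponent i))) g-below)
      where
      bound : exponent i ℕ.+ suc k ℕ.≤ d ℕ.+ k
      bound = ℕₚ.≤-trans (ℕₚ.≤-reflexive (ℕₚ.+-suc (exponent i) k)) (ℕₚ.+-monoˡ-≤ k (exponent-< i))

    multiple-linear : ∀ t → Linear (λ q → coeff (q * f) t)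
    multiple-linear t = record
      { T-cong = λ e → at (*-congʳ {f} e) t
      ; T-+ = λ p q → trans (at (distribʳ f p q) t) (coeff-+ (p * f) (q * f) t)
      ; T-scale = λ c p → trans (at (≋-trans (*-congʳ {f} (≋-sym (const-* c p)))
          (≋-trans (*-assoc (const c) p f) (const-* c (p * f)))) t) (coeff-scale c (p * f) t) }

    coeff-linear : ∀ t → Linear (λ p → coeff p t)
    coeff-linear t = record { T-cong = λ e → at e t ; T-+ = λ p q → coeff-+ p q t ; T-scale = λ c p → coeff-scale c p t }

    factorization-bottom : ∀ i c → Zx.sylvester f d g k (k ↑ʳ i) c ≡ (lowerMatrix ⊡ upperMatrix) (k ↑ʳ i) c
    factorization-bottom i c = begin
      Zx.sylvester f d g k (k ↑ʳ i) c                   ≡⟨ sylvester-bottom i c ⟩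
      coeff (gRow i) t                                  ≡⟨ at (division (gRow i)) t ⟩
      coeff (q * f + r) t                               ≡⟨ coeff-+ (q * f) r t ⟩
      coeff (q * f) t ℤ.+ coeff r t                     ≡⟨ cong₂ ℤ._+_
        (linear-expansion (multiple-linear t) k q (quotient-below (gRow i) k (gRow-below i)))
        (linear-expansion (coeff-linear t) d r (remainder-below (gRow i))) ⟩
      sumFin {k} (λ l → coeff q (exponent l) ℤ.* coeff (xpow (exponent l) * f) t) ℤ.+
      sumFin {d} (λ j → coeff r (exponent j) ℤ.* coeff (xpow (exponent j)) t)
        ≡⟨ cong₂ ℤ._+_ (sum-cong top) (sum-cong bottom) ⟨
      sumFin {k} (λ l → T (l ↑ˡ d)) ℤ.+ sumFin {d} (λ j → T (k ↑ʳ j))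
        ≡⟨ sum-split k T ⟨
      sumFin T ∎
      where
      open ≡-Reasoning
      t = exponent c
      q = quotient (gRow i)
      r = remainder (gRow i)
      T : Fin (k ℕ.+ d) → ℤ
      T m = lowerMatrix (k ↑ʳ i) m ℤ.* upperMatrix m c
      top : ∀ l → T (l ↑ˡ d) ≡ coeff q (exponent l) ℤ.* coeff (xpow (exponent l) * f) t
      top l rewrite Finₚ.splitAt-↑ʳ k d i | Finₚ.splitAt-↑ˡ k l d = refl
      bottom : ∀ j → T (k ↑ʳ j) ≡ coeff r (exponent j) ℤ.* coeff (xpow (exponent j)) t
      bottom j rewrite Finₚ.splitAt-↑ʳ k d i | Finₚ.splitAt-↑ʳ k d j = refl

    factorization-top : ∀ l c → Zx.sylvester f d g k (l ↑ˡ d) c ≡ (lowerMatrix ⊡ upperMatrix) (l ↑ˡ d) c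
    factorization-top l c = begin
      Zx.sylvester f d g k (l ↑ˡ d) c                    ≡⟨ sylvester-top l c ⟩
      coeff (xpow (exponent l) * f) (exponent c)         ≡⟨ cong (λ s → coeff (upperRow s) (exponent c)) (Finₚ.splitAt-↑ˡ k l d) ⟨
      upperMatrix (l ↑ˡ d) c                             ≡⟨ sum-δˡ (l ↑ˡ d) (λ m → upperMatrix m c) ⟨
      sumFin (λ m → δ (l ↑ˡ d) m ℤ.* upperMatrix m c)    ≡⟨ sum-cong (λ m → cong (ℤ._* upperMatrix m c) (identity-row m)) ⟨
      (lowerMatrix ⊡ upperMatrix) (l ↑ˡ d) c             ∎
      where
      open ≡-Reasoning
      identity-row : ∀ m → lowerMatrix (l ↑ˡ d) m ≡ δ (l ↑ˡ d) m
      identity-row m rewrite Finₚ.splitAt-↑ˡ k l d = refl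

    factorization : ∀ r c → Zx.sylvester f d g k r c ≡ (lowerMatrix ⊡ upperMatrix) r c
    factorization r c = subst (λ r → Zx.sylvester f d g k r c ≡ (lowerMatrix ⊡ upperMatrix) r c)
      (Finₚ.join-splitAt k d r) (by-block (splitAt k r))
      where
      by-block : ∀ s → Zx.sylvester f d g k (Fin.join k d s) c ≡ (lowerMatrix ⊡ upperMatrix) (Fin.join k d s) c
      by-block (inj₁ l) = factorization-top l c
      by-block (inj₂ i) = factorization-bottom i c

    det-lower : det lowerMatrix ≡ norm g
    det-lower = trans (det-block k lowerMatrix identity-rows) (det-cong entries)
      where
      identity-rows : ∀ r c → toℕ r ℕ.< k → lowerMatrix r c ≡ δ r c
      identity-rows r c r<k rewrite Finₚ.splitAt-< k r r<k = refl
      entries : ∀ i j → lowerMatrix (k ↑ʳ i) (k ↑ʳ j) ≡ normMatrix g i j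
      entries i j rewrite Finₚ.splitAt-↑ʳ k d i | Finₚ.splitAt-↑ʳ k d j = refl

    upperRow-monic : ∀ r → Monic (upperRow (splitAt k r)) (exponent r)
    upperRow-monic r = subst (λ r → Monic (upperRow (splitAt k r)) (exponent r)) (Finₚ.join-splitAt k d r) (by-block (splitAt k r))
      where
      by-block : ∀ s → Monic (upperRow (splitAt k (Fin.join k d s))) (exponent (Fin.join k d s))
      by-block (inj₁ l) rewrite Finₚ.splitAt-↑ˡ k l d | exponent-↑ˡ l =
        Monic-* (xpow (exponent l)) f (exponent l) d (Monic-xpow (exponent l)) monic
      by-block (inj₂ j) rewrite Finₚ.splitAt-↑ʳ k d j | exponent-↑ʳ j = Monic-xpow (exponent j)

    -- Row r is monic of degree `exponent r`, so listing powers in descending order makes the matrix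
    -- unitriangular.
    det-upper : det upperMatrix ≡ 1ℤ
    det-upper = det-unitriangular upperMatrix (λ r → proj₁ (upperRow-monic r))
      (λ r c c<r → proj₂ (upperRow-monic r) (exponent c) (ℕₚ.∸-monoʳ-< (s≤s c<r) (Finₚ.toℕ<n r)))

    resultant-norm : Zx.resultant f d g k ≡ norm g
    resultant-norm = begin
      det (Zx.sylvester f d g k)          ≡⟨ det-cong factorization ⟩
      det (lowerMatrix ⊡ upperMatrix)     ≡⟨ det-* lowerMatrix upperMatrix ⟩
      det lowerMatrix ℤ.* det upperMatrix ≡⟨ cong₂ ℤ._*_ det-lower det-upper ⟩
      norm g ℤ.* 1ℤ                       ≡⟨ ℤₚ.*-identityʳ (norm g) ⟩
      norm g                              ∎
      where open ≡-Reasoning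

module Derivative (R : RawRing 0ℓ 0ℓ) where
  open PolyOver R

  derivFrom : ℕ → Poly → Poly
  derivFrom n []      = []
  derivFrom n (c ∷ q) = natMul n c ∷ derivFrom (suc n) q

  mutual
    deriv-∷∷ : ∀ a b q → deriv (a ∷ b ∷ q) ≡ natMul 1 b ∷ derivFrom 2 q
    -- Generalizing 2 and `b ∷ q` makes all arguments of the local function distinct variables, so
    -- that the underscore below can be solved by unification.
    deriv-∷∷ a b q with 2 | b ∷ q
    ... | n | r = cong (natMul 1 b ∷_) (go≡derivFrom a r n q)

    -- The underscore stands for the local function of deriv, which has no name outside its clause.
    go≡derivFrom : ∀ (a : RawRing.Carrier R) (p : Poly) n q → _ ≡ derivFrom n q
    go≡derivFrom a p n []      = refl
    go≡derivFrom a p n (c ∷ q) = cong (natMul n c ∷_) (go≡derivFrom a p (suc n) q)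

  deriv-∷ : ∀ a p → deriv (a ∷ p) ≡ derivFrom 1 p
  deriv-∷ a []      = refl
  deriv-∷ a (b ∷ q) = deriv-∷∷ a b q

-- Homogenization

module Homogenization where
  open import Data.Fin using (Fin; zero; suc; toℕ; punchIn; _↑ˡ_; _↑ʳ_)
  open import Data.Nat.DivMod using (_/_)
  open Zx using (coeff; const; oneₚ; monomial; natMul)
  open PolynomialRing
  open Monomials
  open CommutativeRing ℤ[x] using (_+_; _*_; _-_; -_; setoid; +-cong; +-congˡ; *-congˡ; *-congʳ; *-cong; *-assoc; distribʳ; distribˡ; zeroʳ; zeroˡ)
    renaming (refl to ≋-refl; sym to ≋-sym; trans to ≋-trans; reflexive to ≋-reflexive; *-identityˡ to ·-identityˡ)
  open IntegerSolver ℤ[x] using (solve; con; _:+_; _:*_; _:=_)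

  natMul-* : ∀ n a → natMul n a ≡ + n ℤ.* a
  natMul-* zero    a = sym (ℤₚ.*-zeroˡ a)
  natMul-* (suc n) a = trans (cong (λ t → a ℤ.+ t) (natMul-* n a)) (sym (ℤₚ.suc-* (+ n) a))

  coeff-deriv : ∀ p k → coeff (Zx.deriv p) k ≡ + suc k ℤ.* coeff p (suc k)
  coeff-deriv []      k = sym (ℤₚ.*-zeroʳ (+ suc k))
  coeff-deriv (a ∷ p) k = trans (cong (λ q → coeff q k) (deriv-∷ a p)) (from 1 p k)
    where
    open Derivative ℤ.+-*-rawRing
    from : ∀ n q k → coeff (derivFrom n q) k ≡ + (n ℕ.+ k) ℤ.* coeff q k
    from n []      k       = sym (ℤₚ.*-zeroʳ (+ (n ℕ.+ k)))
    from n (c ∷ q) zero    = trans (natMul-* n c) (cong (λ t → + t ℤ.* c) (sym (ℕₚ.+-identityʳ n)))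
    from n (c ∷ q) (suc k) = trans (from (suc n) q k) (cong (λ t → + t ℤ.* coeff q k) (sym (ℕₚ.+-suc n k)))

  monomial-const : ∀ c n → monomial c n ≋ const c * xpow n
  at (monomial-const c n) k = sym (trans (at (const-* c (xpow n)) k) (trans (coeff-scale c (xpow n) k) (coefficients n k)))
    where
    coefficients : ∀ n k → c ℤ.* coeff (xpow n) k ≡ coeff (monomial c n) k
    coefficients zero    zero    = ℤₚ.*-identityʳ c
    coefficients zero    (suc k) = ℤₚ.*-zeroʳ c
    coefficients (suc n) zero    = ℤₚ.*-zeroʳ c
    coefficients (suc n) (suc k) = coefficients n k

  const-·-* : ∀ a b → const a * const b ≋ const (a ℤ.* b)
  const-·-* a b = const-* a (const b)

  const-0 : const 0ℤ ≋ []
  at const-0 zero    = refl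
  at const-0 (suc k) = refl

  xpow-+ : ∀ m n → xpow (m ℕ.+ n) ≋ xpow m * xpow n
  xpow-+ zero    n = ≋-sym (·-identityˡ (xpow n))
  xpow-+ (suc m) n = ≋-trans (shiftX-cong (xpow-+ m n)) (≋-sym (xpow-suc-* m (xpow n)))

  Zyx-natMul : ∀ n p → Zyx.natMul n p ≋ const (+ n) * p
  Zyx-natMul zero    p = ≋-sym (≋-trans (*-congʳ {p} const-0) (zeroˡ p))
  Zyx-natMul (suc n) p = ≋-trans (+-congˡ {p} (Zyx-natMul n p))
    (solve 2 (λ p c → p :+ c :* p := (con (+ 1) :+ c) :* p) ≋-refl p (const (+ n)))

  Homogenizes : Zyx.Poly → ℤ[X] → ℕ → Set
  Homogenizes G p m = ∀ k → Zyx.coeff G k ≋ monomial (coeff p k) (m ∸ k)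

  homogenize-spec : ∀ d p → Below p (suc d) → Homogenizes (homogenize d p) p d
  homogenize-spec d p b k = go (suc d) id k (λ m l → ≋-trans (≋-reflexive (cong (λ c → monomial c (d ∸ m)) (b m l))) (monomial-0 (d ∸ m)))
    where
    monomial-0 : ∀ n → monomial 0ℤ n ≋ []
    monomial-0 n = ≋-trans (monomial-const 0ℤ n) (≋-trans (*-congʳ {xpow n} const-0) (zeroˡ (xpow n)))
    h : ℕ → ℤ[X]
    h m = monomial (coeff p m) (d ∸ m)
    go : ∀ n (g : ℕ → ℕ) k → (∀ m → n ℕ.≤ m → h (g m) ≋ []) → Zyx.coeff (map h (applyUpTo g n)) k ≋ h (g k)
    go zero    g k       z = ≋-sym (z k z≤n)
    go (suc n) g zero    z = ≋-refl
    go (suc n) g (suc k) z = go n (g ∘ suc) k (λ m l → z (suc m) (s≤s l))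

  deriv-homogenizes : ∀ G p d → Homogenizes G p d → Homogenizes (Zyx.deriv G) (Zx.deriv p) (d ∸ 1)
  deriv-homogenizes G p d H k = ≋-trans (coeff-Zyx-deriv G k) (≋-trans (*-congˡ {const (+ suc k)} (H (suc k)))
    (≋-trans (*-congˡ {const (+ suc k)} (monomial-const (coeff p (suc k)) (d ∸ suc k)))
      (≋-trans (≋-sym (*-assoc (const (+ suc k)) (const (coeff p (suc k))) (xpow (d ∸ suc k))))
        (≋-trans (*-congʳ {xpow (d ∸ suc k)} (const-·-* (+ suc k) (coeff p (suc k))))
          (≋-trans (≋-sym (monomial-const (+ suc k ℤ.* coeff p (suc k)) (d ∸ suc k)))
            (≋-reflexive (cong₂ monomial (sym (coeff-deriv p k)) (sym (ℕₚ.∸-+-assoc d 1 k)))))))))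
    where
    open Derivative Zx.polyRawRing
    coeff-Zyx-deriv : ∀ G k → Zyx.coeff (Zyx.deriv G) k ≋ const (+ suc k) * Zyx.coeff G (suc k)
    coeff-Zyx-deriv []      k = ≋-sym (zeroʳ (const (+ suc k)))
    coeff-Zyx-deriv (a ∷ p) k = ≋-trans (≋-reflexive (cong (λ q → Zyx.coeff q k) (deriv-∷ a p))) (from 1 p k)
      where
      from : ∀ n q k → Zyx.coeff (derivFrom n q) k ≋ const (+ (n ℕ.+ k)) * Zyx.coeff q k
      from n []      k       = ≋-sym (zeroʳ (const (+ (n ℕ.+ k))))
      from n (c ∷ q) zero    = ≋-trans (Zyx-natMul n c) (≋-reflexive (cong (λ t → const (+ t) * c) (sym (ℕₚ.+-identityʳ n))))
      from n (c ∷ q) (suc k) = ≋-trans (from (suc n) q k) (≋-reflexive (cong (λ t → const (+ t) * Zyx.coeff q k) (sym (ℕₚ.+-suc n k))))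

  -- In a row shifted by i the entry in column j has degree j - i in y. Multiplying the row by y^i
  -- leaves y^j, which depends on the column only.
  homogeneous-entry : ∀ G p m → Homogenizes G p m → ∀ i j →
    xpow i * Zyx.sylvEntry G m i j ≋ const (Zx.sylvEntry p m i j) * xpow j
  homogeneous-entry G p m H i j with j ℕ.<? i
  ... | yes _ = ≋-trans (zeroʳ (xpow i)) (≋-sym (≋-trans (*-congʳ {xpow j} const-0) (zeroˡ (xpow j))))
  ... | no j≮i with m ℕ.<? (j ∸ i)
  ...   | yes _ = ≋-trans (zeroʳ (xpow i)) (≋-sym (≋-trans (*-congʳ {xpow j} const-0) (zeroˡ (xpow j))))
  ...   | no m≮e = begin
    xpow i * Zyx.coeff G (m ∸ (j ∸ i))         ≈⟨ *-congˡ {xpow i} (H (m ∸ (j ∸ i))) ⟩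
    xpow i * monomial c (m ∸ (m ∸ (j ∸ i)))    ≡⟨ cong (λ t → xpow i * monomial c t) (ℕₚ.m∸[m∸n]≡n (ℕₚ.≮⇒≥ m≮e)) ⟩
    xpow i * monomial c (j ∸ i)                ≈⟨ *-congˡ {xpow i} (monomial-const c (j ∸ i)) ⟩
    xpow i * (const c * xpow (j ∸ i))          ≈⟨ solve 3 (λ x c y → x :* (c :* y) := c :* (x :* y)) ≋-refl (xpow i) (const c) (xpow (j ∸ i)) ⟩
    const c * (xpow i * xpow (j ∸ i))          ≈⟨ *-congˡ {const c} (≋-sym (xpow-+ i (j ∸ i))) ⟩
    const c * xpow (i ℕ.+ (j ∸ i))             ≡⟨ cong (λ t → const c * xpow t) (ℕₚ.m+[n∸m]≡n (ℕₚ.≮⇒≥ j≮i)) ⟩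
    const c * xpow j                           ∎
    where
    open Relation.Binary.Reasoning.Setoid setoid
    c = coeff p (m ∸ (j ∸ i))

  sumℕ : ∀ {m} → (Fin m → ℕ) → ℕ
  sumℕ {zero}  f = 0
  sumℕ {suc m} f = f zero ℕ.+ sumℕ (f ∘ suc)

  sumℕ-punchIn : ∀ {m} (f : Fin (suc m) → ℕ) j → sumℕ f ≡ f j ℕ.+ sumℕ (f ∘ punchIn j)
  sumℕ-punchIn f zero = refl
  sumℕ-punchIn {suc m} f (suc j) = trans (cong (f zero ℕ.+_) (sumℕ-punchIn (f ∘ suc) j))
    (ℕ-Solver.solve 3 (λ a b c → a ℕ-Solver.:+ (b ℕ-Solver.:+ c) ℕ-Solver.:= b ℕ-Solver.:+ (a ℕ-Solver.:+ c)) refl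
      (f zero) (f (suc j)) (sumℕ (f ∘ suc ∘ punchIn j)))

  sumℕ-split : ∀ k {m} (f : Fin (k ℕ.+ m) → ℕ) → sumℕ f ≡ sumℕ (λ l → f (l ↑ˡ m)) ℕ.+ sumℕ (λ j → f (k ↑ʳ j))
  sumℕ-split zero    f = refl
  sumℕ-split (suc k) {m} f = trans (cong (f zero ℕ.+_) (sumℕ-split k (f ∘ suc)))
    (sym (ℕₚ.+-assoc (f zero) (sumℕ (λ l → f (suc l ↑ˡ m))) _))

  sumℕ-cong : ∀ {m} {f g : Fin m → ℕ} → (∀ j → f j ≡ g j) → sumℕ f ≡ sumℕ g
  sumℕ-cong {zero}  e = refl
  sumℕ-cong {suc m} e = cong₂ ℕ._+_ (e zero) (sumℕ-cong (e ∘ suc))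

  sumℕ-const+ : ∀ {m} k (f : Fin m → ℕ) → sumℕ (λ j → k ℕ.+ f j) ≡ m ℕ.* k ℕ.+ sumℕ f
  sumℕ-const+ {zero}  k f = refl
  sumℕ-const+ {suc m} k f = trans (cong ((k ℕ.+ f zero) ℕ.+_) (sumℕ-const+ k (f ∘ suc)))
    (ℕ-Solver.solve 4 (λ k a b c → (k ℕ-Solver.:+ a) ℕ-Solver.:+ (b ℕ-Solver.:+ c) ℕ-Solver.:= (k ℕ-Solver.:+ b) ℕ-Solver.:+ (a ℕ-Solver.:+ c)) refl
      k (f zero) (m ℕ.* k) (sumℕ (f ∘ suc)))

  Zyx-sum : ∀ {m} K L (f : Fin m → ℤ[X]) (g : Fin m → ℤ) → (∀ j → K * f j ≋ const (g j) * L) →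
    K * Zyx.sumFin f ≋ const (Zx.sumFin g) * L
  Zyx-sum {zero}  K L f g e = ≋-trans (zeroʳ K) (≋-sym (≋-trans (*-congʳ {L} const-0) (zeroˡ L)))
  Zyx-sum {suc m} K L f g e = ≋-trans (distribˡ K (f zero) (Zyx.sumFin (f ∘ suc)))
    (≋-trans (+-cong (e zero) (Zyx-sum K L (f ∘ suc) (g ∘ suc) (e ∘ suc)))
      (≋-sym (distribʳ L (const (g zero)) (const (Zx.sumFin (g ∘ suc))))))

  Zyx-pow-neg1 : ∀ n → Zyx.pow (- oneₚ) n ≋ const (Zx.pow -1ℤ n)
  Zyx-pow-neg1 zero    = ≋-refl
  Zyx-pow-neg1 (suc n) = ≋-trans (*-congˡ { - oneₚ} (Zyx-pow-neg1 n)) (const-·-* -1ℤ (Zx.pow -1ℤ n))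

  -- Every Laplace term picks up the same row and column weights. The relation is cross-multiplied,
  -- as powers of y have no inverses in ℤ[y].
  homogeneous-det : ∀ {m} (M : Fin m → Fin m → ℤ[X]) (a : Fin m → Fin m → ℤ) (u v : Fin m → ℕ) →
    (∀ r c → xpow (u r) * M r c ≋ const (a r c) * xpow (v c)) →
    xpow (sumℕ u) * Zyx.det M ≋ const (Zx.det a) * xpow (sumℕ v)
  homogeneous-det {zero}  M a u v e = ≋-refl
  homogeneous-det {suc m} M a u v e = Zyx-sum (xpow (sumℕ u)) (xpow (sumℕ v))
    (λ j → Zyx.pow (- oneₚ) (toℕ j) * (M zero j * Zyx.det (λ r c → M (suc r) (punchIn j c))))
    (λ j → Zx.pow -1ℤ (toℕ j) ℤ.* (a zero j ℤ.* Zx.det (λ r c → a (suc r) (punchIn j c)))) term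
    where
    open Relation.Binary.Reasoning.Setoid setoid
    term : ∀ j → xpow (sumℕ u) * (Zyx.pow (- oneₚ) (toℕ j) * (M zero j * Zyx.det (λ r c → M (suc r) (punchIn j c))))
      ≋ const (Zx.pow -1ℤ (toℕ j) ℤ.* (a zero j ℤ.* Zx.det (λ r c → a (suc r) (punchIn j c)))) * xpow (sumℕ v)
    term j = begin
      xpow (sumℕ u) * (s * (M zero j * D))
        ≈⟨ *-congʳ {s * (M zero j * D)} (xpow-+ (u zero) (sumℕ (u ∘ suc))) ⟩
      (x₀ * x) * (s * (M zero j * D))
        ≈⟨ solve 5 (λ x₀ x s m d → (x₀ :* x) :* (s :* (m :* d)) := s :* ((x₀ :* m) :* (x :* d))) ≋-refl x₀ x s (M zero j) D ⟩
      s * ((x₀ * M zero j) * (x * D))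
        ≈⟨ *-cong (Zyx-pow-neg1 (toℕ j)) (*-cong (e zero j)
             (homogeneous-det (λ r c → M (suc r) (punchIn j c)) (λ r c → a (suc r) (punchIn j c)) (u ∘ suc) (v ∘ punchIn j) (λ r c → e (suc r) (punchIn j c)))) ⟩
      const σ * ((const α * y₀) * (const δ * y))
        ≈⟨ solve 5 (λ s a y₀ d y → s :* ((a :* y₀) :* (d :* y)) := (s :* (a :* d)) :* (y₀ :* y)) ≋-refl (const σ) (const α) y₀ (const δ) y ⟩
      (const σ * (const α * const δ)) * (y₀ * y)
        ≈⟨ *-cong (≋-trans (*-congˡ {const σ} (const-·-* α δ)) (const-·-* σ (α ℤ.* δ)))
             (≋-sym (≋-trans (≋-reflexive (cong xpow (sumℕ-punchIn v j))) (xpow-+ (v j) (sumℕ (v ∘ punchIn j))))) ⟩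
      const (σ ℤ.* (α ℤ.* δ)) * xpow (sumℕ v) ∎
      where
      s = Zyx.pow (- oneₚ) (toℕ j)
      D = Zyx.det (λ r c → M (suc r) (punchIn j c))
      x₀ = xpow (u zero)
      x = xpow (sumℕ (u ∘ suc))
      y₀ = xpow (v j)
      y = xpow (sumℕ (v ∘ punchIn j))
      σ = Zx.pow -1ℤ (toℕ j)
      α = a zero j
      δ = Zx.det (λ r c → a (suc r) (punchIn j c))

  module _ (k m : ℕ) where
    -- The shift restarts at 0 in the second block of the Sylvester matrix.
    rowShift : Fin (k ℕ.+ m) → ℕ
    rowShift r with toℕ r ℕ.<? k
    ... | yes _ = toℕ r
    ... | no  _ = toℕ r ∸ k

    -- Each of the m rows of the second block sits k places lower than its shift; the excess m k is
    -- the degree of the resultant in y.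
    columns-rows : sumℕ {k ℕ.+ m} toℕ ≡ sumℕ rowShift ℕ.+ m ℕ.* k
    columns-rows = begin
      sumℕ {k ℕ.+ m} toℕ                        ≡⟨ sumℕ-split k {m} toℕ ⟩
      sumℕ {k} (λ l → toℕ (l ↑ˡ m)) ℕ.+ sumℕ {m} (λ j → toℕ (k ↑ʳ j))
        ≡⟨ cong₂ ℕ._+_ (sumℕ-cong {f = λ l → toℕ (l ↑ˡ m)} (λ l → sym (shift-↑ˡ l))) (trans (sumℕ-cong {f = λ j → toℕ (k ↑ʳ j)} (λ j → trans (Finₚ.toℕ-↑ʳ k j) (cong (k ℕ.+_) (sym (shift-↑ʳ j)))))
             (sumℕ-const+ k (λ j → rowShift (k ↑ʳ j)))) ⟩
      sumℕ {k} (λ l → rowShift (l ↑ˡ m)) ℕ.+ (m ℕ.* k ℕ.+ sumℕ {m} (λ j → rowShift (k ↑ʳ j)))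
        ≡⟨ ℕ-Solver.solve 3 (λ a b c → a ℕ-Solver.:+ (b ℕ-Solver.:+ c) ℕ-Solver.:= (a ℕ-Solver.:+ c) ℕ-Solver.:+ b) refl
             (sumℕ (λ l → rowShift (l ↑ˡ m))) (m ℕ.* k) (sumℕ (λ j → rowShift (k ↑ʳ j))) ⟩
      (sumℕ (λ l → rowShift (l ↑ˡ m)) ℕ.+ sumℕ (λ j → rowShift (k ↑ʳ j))) ℕ.+ m ℕ.* k
        ≡⟨ cong (ℕ._+ m ℕ.* k) (sumℕ-split k rowShift) ⟨
      sumℕ rowShift ℕ.+ m ℕ.* k ∎
      where
      open ≡-Reasoning
      shift-↑ˡ : ∀ l → rowShift (l ↑ˡ m) ≡ toℕ (l ↑ˡ m)
      shift-↑ˡ l with toℕ (l ↑ˡ m) ℕ.<? k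
      ... | yes _ = refl
      ... | no p = ⊥-elim (p (subst (ℕ._< k) (sym (Finₚ.toℕ-↑ˡ l m)) (Finₚ.toℕ<n l)))
      shift-↑ʳ : ∀ j → rowShift (k ↑ʳ j) ≡ toℕ j
      shift-↑ʳ j with toℕ (k ↑ʳ j) ℕ.<? k
      ... | yes p = ⊥-elim (ℕₚ.<⇒≱ p (subst (k ℕ.≤_) (sym (Finₚ.toℕ-↑ʳ k j)) (ℕₚ.m≤m+n k (toℕ j))))
      ... | no _ = trans (cong (_∸ k) (Finₚ.toℕ-↑ʳ k j)) (ℕₚ.m+n∸m≡n k (toℕ j))

    -- The common factor y^S, with S the sum of the row shifts, is monic and can be cancelled.
    homogeneous-resultant : ∀ G p H q → Homogenizes G p m → Homogenizes H q k →
      Zyx.resultant G m H k ≋ monomial (Zx.resultant p m q k) (m ℕ.* k)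
    homogeneous-resultant G p H q hG hH = ≋-trans
      (Monic-cancel (xpow S) (Zyx.resultant G m H k) (const ρ * xpow (m ℕ.* k)) S (Monic-xpow S) (begin
        xpow S * Zyx.resultant G m H k                 ≈⟨ homogeneous-det (Zyx.sylvester G m H k) (Zx.sylvester p m q k) rowShift toℕ entry ⟩
        const ρ * xpow (sumℕ {k ℕ.+ m} toℕ)            ≡⟨ cong (λ t → const ρ * xpow t) columns-rows ⟩
        const ρ * xpow (S ℕ.+ m ℕ.* k)                 ≈⟨ *-congˡ {const ρ} (xpow-+ S (m ℕ.* k)) ⟩
        const ρ * (xpow S * xpow (m ℕ.* k))            ≈⟨ solve 3 (λ c x y → c :* (x :* y) := x :* (c :* y)) ≋-refl (const ρ) (xpow S) (xpow (m ℕ.* k)) ⟩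
        xpow S * (const ρ * xpow (m ℕ.* k))            ∎))
      (≋-sym (monomial-const ρ (m ℕ.* k)))
      where
      open Relation.Binary.Reasoning.Setoid setoid
      S = sumℕ rowShift
      ρ = Zx.resultant p m q k
      entry : ∀ r c → xpow (rowShift r) * Zyx.sylvester G m H k r c ≋ const (Zx.sylvester p m q k r c) * xpow (toℕ c)
      entry r c with toℕ r ℕ.<? k
      ... | yes _ = homogeneous-entry G p m hG (toℕ r) (toℕ c)
      ... | no  _ = homogeneous-entry H q k hH (toℕ r ∸ k) (toℕ c)

  deriv-below : ∀ p d → Below p (suc d) → Below (Zx.deriv p) d
  deriv-below p d b k d≤k = trans (coeff-deriv p k) (trans (cong (+ suc k ℤ.*_) (b (suc k) (s≤s d≤k))) (ℤₚ.*-zeroʳ (+ suc k)))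

  homogenized-discriminant : ∀ p d → 1 ℕ.≤ d → (monic : Monic p d) →
    Zyx.IsDiscriminant (homogenize d p) d
      (monomial (Zx.pow -1ℤ ((d ℕ.* (d ∸ 1)) / 2) ℤ.* Norm.norm p d monic (Zx.deriv p)) (d ℕ.* (d ∸ 1)))
  homogenized-discriminant p d@(suc e) _ monic = at (begin
    Zyx.coeff G d * monomial (s ℤ.* ν) (d ℕ.* e)     ≈⟨ *-congʳ {monomial (s ℤ.* ν) (d ℕ.* e)} leading ⟩
    oneₚ * monomial (s ℤ.* ν) (d ℕ.* e)              ≈⟨ ·-identityˡ (monomial (s ℤ.* ν) (d ℕ.* e)) ⟩
    monomial (s ℤ.* ν) (d ℕ.* e)                     ≈⟨ monomial-const (s ℤ.* ν) (d ℕ.* e) ⟩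
    const (s ℤ.* ν) * xpow (d ℕ.* e)                 ≈⟨ *-congʳ {xpow (d ℕ.* e)} (≋-sym (const-·-* s ν)) ⟩
    const s * const ν * xpow (d ℕ.* e)               ≈⟨ *-assoc (const s) (const ν) (xpow (d ℕ.* e)) ⟩
    const s * (const ν * xpow (d ℕ.* e))             ≈⟨ *-cong (≋-sym (Zyx-pow-neg1 ((d ℕ.* e) / 2))) (≋-sym (monomial-const ν (d ℕ.* e))) ⟩
    Zyx.pow (- oneₚ) ((d ℕ.* e) / 2) * monomial ν (d ℕ.* e)
      ≡⟨ cong (λ t → Zyx.pow (- oneₚ) ((d ℕ.* e) / 2) * monomial t (d ℕ.* e)) (sym (Norm.Sylvester.resultant-norm p d monic (Zx.deriv p) e (deriv-below p d (proj₂ monic)))) ⟩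
    Zyx.pow (- oneₚ) ((d ℕ.* e) / 2) * monomial (Zx.resultant p d (Zx.deriv p) e) (d ℕ.* e)
      ≈⟨ *-congˡ {Zyx.pow (- oneₚ) ((d ℕ.* e) / 2)} (≋-sym (homogeneous-resultant e d G p (Zyx.deriv G) (Zx.deriv p) spec (deriv-homogenizes G p d spec))) ⟩
    Zyx.pow (- oneₚ) ((d ℕ.* e) / 2) * Zyx.resultant G d (Zyx.deriv G) e ∎)
    where
    open Relation.Binary.Reasoning.Setoid setoid
    G = homogenize d p
    s = Zx.pow -1ℤ ((d ℕ.* e) / 2)
    ν = Norm.norm p d monic (Zx.deriv p)
    spec : Homogenizes G p d
    spec = homogenize-spec d p (proj₂ monic)
    leading : Zyx.coeff G d ≋ oneₚ
    leading = ≋-trans (spec d) (≋-reflexive (cong₂ monomial (proj₁ monic) (ℕₚ.n∸n≡0 d)))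

-- Fibonacci polynomials

module FibonacciPolynomials where
  open Zx using (const; shiftX)
  open PolynomialRing
  open CommutativeRing ℤ[x] using (_+_; _*_)
    renaming (+-congʳ to ≋-+-congʳ)

  F-suc : ∀ n → F (suc (suc n)) ≋ X * F (suc n) + F n
  F-suc n = ≋-+-congʳ {F n} (shiftX≋X* (F (suc n)))

  Below-+ : ∀ {p q d} → Below p d → Below q d → Below (p + q) d
  Below-+ {p} {q} bp bq k l = trans (coeff-+ p q k) (cong₂ ℤ._+_ (bp k l) (bq k l))

  F-monic : ∀ n → Monic (F (suc n)) n
  F-monic zero = refl , λ { (suc k) _ → refl }
  F-monic (suc n) = trans (coeff-+ (shiftX (F (suc n))) (F n) (suc n))
      (cong₂ ℤ._+_ (proj₁ (F-monic n)) (F-below n (suc n) (ℕₚ.n≤1+n n))) ,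
    Below-+ {shiftX (F (suc n))} {F n} shifted (Below-mono {F n} (ℕₚ.m≤n+m n 2) (F-below n))
    where
    F-below : ∀ n → Below (F n) n
    F-below zero    k l = refl
    F-below (suc n) = proj₂ (F-monic n)
    shifted : Below (shiftX (F (suc n))) (suc (suc n))
    shifted (suc k) (s≤s l) = proj₂ (F-monic n) k l

  w : ℤ[X]
  w = X * X + const (+ 4)

  w-monic : Monic w 2
  w-monic = refl , λ { zero () ; (suc zero) (s≤s ()) ; (suc (suc zero)) (s≤s (s≤s ())) ; (suc (suc (suc k))) _ → refl }

-- Norms of F_m and x² + 4 modulo ψ

module NormOfFibonacci (ψ : ℤ[X]) (d : ℕ) (monic : PolynomialRing.Monic ψ d) where
  open import Data.Integer using (∣_∣)
  open Zx using (const; oneₚ)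
  open PolynomialRing
  open FibonacciPolynomials
  open Norm ψ d monic
  open Quotient ℤ[x] ψ using (quotientRing; congruent; ≈⇒~; cofactor; equation)
  -- P and E belong to ℤ[x][z], B and Q to (ℤ[x]/ψ)[z]. Both consist of the same pairs with the same
  -- operations, and B has the coarser equality.
  private
    module ℤx = CommutativeRing ℤ[x]
    module ℤxS = IntegerSolver ℤ[x]
    module P = CommutativeRing (QuadraticExtension.extension ℤ[x] X)
    module Q = QuadraticExtension quotientRing X
    module E = QuadraticExtension ℤ[x] X
    module B = CommutativeRing Q.extension
  open Algebra.Properties.Semiring.Exp P.semiring using () renaming (_^_ to _^P_)
  open Algebra.Properties.Semiring.Exp B.semiring using () renaming (_^_ to _^B_; ^-congˡ to ^B-congˡ)
  open ℤxS using (solve; con; _:+_; _:*_; _:-_; :-_; _:=_)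

  embed : ℤ[X] → ℤ[X] × ℤ[X]
  embed a = a , []

  z z̄ : ℤ[X] × ℤ[X]
  z = [] , oneₚ
  z̄ = X , ℤx.- oneₚ

  fib-sucP : ∀ n → embed (F (suc (suc n))) E.≈² (z P.+ z̄) P.* embed (F (suc n)) P.+ embed (F n)
  fib-sucP n = E.componentwise
    (ℤx.trans (F-suc n) (solve 3 (λ x f g → x :* f :+ g := (con (+ 0) :+ x) :* f :+ (con (+ 1) :+ :- con (+ 1)) :* con (+ 0) :+ g) ℤx.refl X (F (suc n)) (F n)))
    (solve 2 (λ x f → con (+ 0) := ((con (+ 0) :+ x) :* con (+ 0) :+ (con (+ 1) :+ :- con (+ 1)) :* f :+ x :* ((con (+ 1) :+ :- con (+ 1)) :* con (+ 0))) :+ con (+ 0)) ℤx.refl X (F (suc n)))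

  zz̄P : z P.* z̄ E.≈² P.- P.1#
  zz̄P = E.componentwise
    (solve 1 (λ x → con (+ 0) :* x :+ con (+ 1) :* :- con (+ 1) := :- con (+ 1)) ℤx.refl X)
    (solve 1 (λ x → con (+ 0) :* :- con (+ 1) :+ con (+ 1) :* x :+ x :* (con (+ 1) :* :- con (+ 1)) := :- con (+ 0)) ℤx.refl X)

  toB : ∀ {s t} → s E.≈² t → s Q.≈² t
  toB (E.componentwise e g) = Q.componentwise (≈⇒~ e) (≈⇒~ g)

  module BinetP = Binet (QuadraticExtension.extension ℤ[x] X) z z̄ zz̄P (λ n → embed (F n)) P.refl P.refl fib-sucP
  module BinetB = Binet Q.extension z z̄ (toB zz̄P) (λ n → embed (F n)) B.refl B.refl (λ n → toB (fib-sucP n))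
  open BinetB using (δ; q)
  open GeometricSums Q.extension using (geometric; geometric-cong; ν; Unit; prime-associate)
  open GeometricSums (QuadraticExtension.extension ℤ[x] X) using () renaming (geometric to geometricP)

  -- The rings share their multiplication, yet each defines its powers from its own structure, so
  -- agreement takes an induction.
  ^P≡^B : ∀ a n → a ^P n ≡ a ^B n
  ^P≡^B a zero    = refl
  ^P≡^B a (suc n) = cong (a P.*_) (^P≡^B a n)

  geometricP≡geometric : ∀ a n → geometricP a n ≡ geometric a n
  geometricP≡geometric a zero    = refl
  geometricP≡geometric a (suc n) = cong (λ t → P.1# P.+ a P.* t) (geometricP≡geometric a n)

  -- One further factor δ turns F_(m+1) δ into F_(m+1) w, a monic polynomial in x, which acts on
  -- both coordinates separately and is not a zero divisor there.
  P-cancel-fib-δ : ∀ m s → embed (F (suc m)) P.* δ P.* s E.≈² P.0# → s E.≈² P.0#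
  P-cancel-fib-δ m s@(a , b) e = E.componentwise (vanish a (E.fst≈ scaled)) (vanish b (E.snd≈ scaled))
    where
    f = F (suc m)
    vanish : ∀ c → f ℤx.* w ℤx.* c ≋ [] → c ≋ []
    vanish c = Monic-cancel-0 (f ℤx.* w) c (m ℕ.+ 2) (Monic-* f w m 2 (F-monic m) w-monic)
    -- The terms d₁ and d₂ are the coordinates of δ = -x + 2z, and δ² = w.
    square : embed (f ℤx.* w) E.≈² embed f P.* δ P.* δ
    square = E.componentwise
      (solve 2 (λ x f → let d₁ = con (+ 0) :+ :- x ; d₂ = con (+ 1) :+ :- :- con (+ 1)
                            a₁ = f :* d₁ :+ con (+ 0) :* d₂ ; a₂ = f :* d₂ :+ con (+ 0) :* d₁ :+ x :* (con (+ 0) :* d₂) in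
        f :* (x :* x :+ con (+ 4)) := a₁ :* d₁ :+ a₂ :* d₂) ℤx.refl X f)
      (solve 2 (λ x f → let d₁ = con (+ 0) :+ :- x ; d₂ = con (+ 1) :+ :- :- con (+ 1)
                            a₁ = f :* d₁ :+ con (+ 0) :* d₂ ; a₂ = f :* d₂ :+ con (+ 0) :* d₁ :+ x :* (con (+ 0) :* d₂) in
        con (+ 0) := a₁ :* d₂ :+ a₂ :* d₁ :+ x :* (a₂ :* d₂)) ℤx.refl X f)
    product : embed (f ℤx.* w) P.* s E.≈² P.0#
    product = P.trans (P.*-congʳ square) (P.trans
      (solveP 3 (λ f d s → f ⊗ d ⊗ d ⊗ s ⊜ d ⊗ (f ⊗ d ⊗ s)) P.refl (embed f) δ s) (P.trans (P.*-congˡ {δ} {embed f P.* δ P.* s} {P.0#} e) (P.zeroʳ δ)))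
      where open IntegerSolver (QuadraticExtension.extension ℤ[x] X) using () renaming (solve to solveP; _:*_ to _⊗_; _:=_ to _⊜_)
    scaled : (f ℤx.* w ℤx.* a , f ℤx.* w ℤx.* b) E.≈² P.0#
    scaled = P.trans (E.componentwise
      (solve 3 (λ g a b → g :* a := g :* a :+ con (+ 0) :* b) ℤx.refl (f ℤx.* w) a b)
      (solve 4 (λ x g a b → g :* b := g :* b :+ con (+ 0) :* a :+ x :* (con (+ 0) :* b)) ℤx.refl X (f ℤx.* w) a b)) product

  -- The relation from `fib-multiple` is cancelled in ℤ[x][z] and then read modulo ψ, where G
  -- becomes 0; the power of z̄ in front is a unit.
  geometric-vanishes : ∀ m k G h → F (suc m ℕ.* suc k) ≋ F (suc m) ℤx.* G → G ≋ h ℤx.* ψ →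
    geometric (q ^B suc m) (suc k) B.≈ B.0#
  geometric-vanishes m k G h eF eG = BinetB.unit-cancel {z̄ ^B (suc m ℕ.* k)} {geometric (q ^B suc m) (suc k)} (BinetB.Unit-^ {z̄} (suc m ℕ.* k) BinetB.z̄-unit) (begin
    y B.* g                              ≈⟨ solveB 2 (λ s t → s :=ᵇ (s :-ᵇ t) :+ᵇ t) B.refl (y B.* g) (embed G) ⟩
    (y B.* g B.- embed G) B.+ embed G    ≈⟨ B.+-cong difference (Q.componentwise (congruent h eG) (≈⇒~ ℤx.refl)) ⟩
    B.0# B.+ B.0#                        ≈⟨ B.+-identityˡ B.0# ⟩
    B.0#                                 ∎)
    where
    open Relation.Binary.Reasoning.Setoid B.setoid
    open IntegerSolver Q.extension using () renaming (solve to solveB; _:-_ to _:-ᵇ_; _:+_ to _:+ᵇ_; _:=_ to _:=ᵇ_)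
    y = z̄ ^B (suc m ℕ.* k)
    g = geometric (q ^B suc m) (suc k)
    multiple : embed (F (suc m ℕ.* suc k)) E.≈² embed (F (suc m)) P.* embed G
    multiple = E.componentwise
      (ℤx.trans eF (solve 2 (λ f g → f :* g := f :* g :+ con (+ 0) :* con (+ 0)) ℤx.refl (F (suc m)) G))
      (solve 3 (λ x f g → con (+ 0) := f :* con (+ 0) :+ con (+ 0) :* g :+ x :* (con (+ 0) :* con (+ 0))) ℤx.refl X (F (suc m)) G)
    same : z̄ ^P (suc m ℕ.* k) P.* geometricP (BinetP.q ^P suc m) (suc k) P.- embed G ≡ y B.* g B.- embed G
    same = cong₂ (λ s t → s P.* t P.- embed G) (^P≡^B z̄ (suc m ℕ.* k))
      (trans (cong (λ t → geometricP t (suc k)) (^P≡^B BinetP.q (suc m))) (geometricP≡geometric (q ^B suc m) (suc k)))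
    difference : y B.* g B.- embed G B.≈ B.0#
    difference = toB (subst (E._≈² P.0#) same (P-cancel-fib-δ m _ (BinetP.fib-multiple (suc m) k (embed G) multiple)))

  -- The absolute norm from (ℤ[x]/ψ)[z] to ℤ, taken in two stages. Elements of ℤ[x] therefore
  -- contribute squares, and p contributes p^(2d).
  M : ℤ[X] × ℤ[X] → ℕ
  M s = ∣ norm (E.conjugateProduct s) ∣

  M-cong : ∀ {s t} → s B.≈ t → M s ≡ M t
  M-cong {s} {t} e = cong ∣_∣ (norm-mod (E.conjugateProduct s) (E.conjugateProduct t) (cofactor same) (equation same))
    where same = Q.conjugateProduct-cong {s} {t} e

  M-* : ∀ s t → M (s B.* t) ≡ M s ℕ.* M t
  M-* s t = trans (cong ∣_∣ (trans (norm-cong (E.conjugateProduct-* s t)) (norm-* (E.conjugateProduct s) (E.conjugateProduct t))))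
    (ℤₚ.abs-* (norm (E.conjugateProduct s)) (norm (E.conjugateProduct t)))

  ^-abs : ∀ c n → ∣ c ℤ.^ n ∣ ≡ ∣ c ∣ ℕ.^ n
  ^-abs c zero    = refl
  ^-abs c (suc n) = trans (ℤₚ.abs-* c (c ℤ.^ n)) (cong (∣ c ∣ ℕ.*_) (^-abs c n))

  M-embed : ∀ a → M (embed a) ≡ ∣ norm a ∣ ℕ.* ∣ norm a ∣
  M-embed a = trans (cong ∣_∣ (trans (norm-cong {g′ = a ℤx.* a}
      (solve 2 (λ x a → a :* a :+ x :* (a :* con (+ 0)) :- con (+ 0) :* con (+ 0) := a :* a) ℤx.refl X a)) (norm-* a a)))
    (ℤₚ.abs-* (norm a) (norm a))

  norm-1 : norm oneₚ ≡ 1ℤ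
  norm-1 = trans (norm-const 1ℤ) (ℤₚ.^-zeroˡ d)

  M-1 : M B.1# ≡ 1
  M-1 = trans (M-embed oneₚ) (cong (λ t → ∣ t ∣ ℕ.* ∣ t ∣) norm-1)

  M-^ : ∀ s n → M (s ^B n) ≡ M s ℕ.^ n
  M-^ s zero    = M-1
  M-^ s (suc n) = trans (M-* s (s ^B n)) (cong (M s ℕ.*_) (M-^ s n))

  M-unit : ∀ {s} → Unit s → M s ≡ 1
  M-unit {s} (t , e) = ℕₚ.m*n≡1⇒m≡1 (M s) (M t) (trans (sym (M-* s t)) (trans (M-cong e) M-1))

  ν-const : ∀ n → ν n B.≈ embed (const (+ n))
  ν-const zero    = toB (E.componentwise (coeffwise λ { zero → refl ; (suc k) → refl }) ℤx.refl)
  ν-const (suc n) = B.trans (IntegerSolver.suc-× Q.extension n) (B.+-congˡ (ν-const n))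

  M-ν : ∀ n → M (ν n) ≡ n ℕ.^ d ℕ.* n ℕ.^ d
  M-ν n = trans (M-cong (ν-const n)) (trans (M-embed (const (+ n)))
    (cong (λ t → t ℕ.* t) (trans (cong ∣_∣ (norm-const (+ n))) (^-abs (+ n) d))))

  W : ℕ
  W = ∣ norm w ∣

  -- The conjugate of δ is -δ, so the inner norm is -w, and the sign is lost in the absolute value.
  M-δ : M δ ≡ W
  M-δ = begin
    M δ                                    ≡⟨ cong ∣_∣ (norm-cong {g′ = const -1ℤ ℤx.* w}
                                                (solve 1 (λ x → let d₁ = con (+ 0) :+ :- x ; d₂ = con (+ 1) :+ :- :- con (+ 1) in
                                                  d₁ :* d₁ :+ x :* (d₁ :* d₂) :- d₂ :* d₂ := con -1ℤ :* (x :* x :+ con (+ 4))) ℤx.refl X)) ⟩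
    ∣ norm (const -1ℤ ℤx.* w) ∣            ≡⟨ cong ∣_∣ (norm-* (const -1ℤ) w) ⟩
    ∣ norm (const -1ℤ) ℤ.* norm w ∣        ≡⟨ ℤₚ.abs-* (norm (const -1ℤ)) (norm w) ⟩
    ∣ norm (const -1ℤ) ∣ ℕ.* W             ≡⟨ cong (ℕ._* W) (trans (cong ∣_∣ (norm-const -1ℤ)) (trans (^-abs -1ℤ d) (ℕₚ.^-zeroˡ d))) ⟩
    1 ℕ.* W                                ≡⟨ ℕₚ.*-identityˡ W ⟩
    W                                      ∎
    where open ≡-Reasoning

  -- By Binet q^m - 1 equals F_m δ up to the unit z̄^m.
  M-q-1 : ∀ m → M (q ^B m B.- B.1#) ≡ ∣ norm (F m) ∣ ℕ.* ∣ norm (F m) ∣ ℕ.* W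
  M-q-1 m = begin
    M (q ^B m B.- B.1#)                          ≡⟨ ℕₚ.*-identityˡ _ ⟨
    1 ℕ.* M (q ^B m B.- B.1#)                    ≡⟨ cong (ℕ._* M (q ^B m B.- B.1#)) (M-unit {z̄ ^B m} (BinetB.Unit-^ {z̄} m BinetB.z̄-unit)) ⟨
    M (z̄ ^B m) ℕ.* M (q ^B m B.- B.1#)           ≡⟨ M-* (z̄ ^B m) (q ^B m B.- B.1#) ⟨
    M (z̄ ^B m B.* (q ^B m B.- B.1#))             ≡⟨ M-cong (BinetB.binet-q m) ⟨
    M (embed (F m) B.* δ)                        ≡⟨ M-* (embed (F m)) δ ⟩
    M (embed (F m)) ℕ.* M δ                      ≡⟨ cong₂ ℕ._*_ (M-embed (F m)) M-δ ⟩
    ∣ norm (F m) ∣ ℕ.* ∣ norm (F m) ∣ ℕ.* W      ∎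
    where open ≡-Reasoning

  module _ (m k : ℕ) (G h : ℤ[X]) (prime : Prime (suc k))
    (eF : F (suc m ℕ.* suc k) ≋ F (suc m) ℤx.* G) (eG : G ≋ h ℤx.* ψ) where

    1+[s-1] : ∀ s → B.1# B.+ (s B.- B.1#) B.≈ s
    1+[s-1] s = IntegerSolver.solve Q.extension 1 (λ s → con′ (+ 1) :+′ (s :-′ con′ (+ 1)) :=′ s) B.refl s
      where open IntegerSolver Q.extension using () renaming (con to con′; _:+_ to _:+′_; _:-_ to _:-′_; _:=_ to _:=′_)

    norm-power : ∀ u j → geometric ((B.1# B.+ u) ^B (suc k ℕ.^ j)) (suc k) B.≈ B.0# →
      M u ℕ.^ (suc k ℕ.^ j ℕ.* k) ≡ suc k ℕ.^ d ℕ.* suc k ℕ.^ d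
    norm-power u j e = begin
      M u ℕ.^ (suc k ℕ.^ j ℕ.* k)          ≡⟨ M-^ u (suc k ℕ.^ j ℕ.* k) ⟨
      M (u ^B (suc k ℕ.^ j ℕ.* k))         ≡⟨ M-cong ev ⟩
      M (ν (suc k) B.* v)                  ≡⟨ M-* (ν (suc k)) v ⟩
      M (ν (suc k)) ℕ.* M v                ≡⟨ cong₂ ℕ._*_ (M-ν (suc k)) (M-unit {v} unit-v) ⟩
      suc k ℕ.^ d ℕ.* suc k ℕ.^ d ℕ.* 1    ≡⟨ ℕₚ.*-identityʳ _ ⟩
      suc k ℕ.^ d ℕ.* suc k ℕ.^ d          ∎
      where
      open ≡-Reasoning
      associate = prime-associate u prime j e
      v = proj₁ associate
      unit-v = proj₁ (proj₂ associate)
      ev = proj₂ (proj₂ associate)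

    norm-F-power : (∣ norm (F (suc m)) ∣ ℕ.* ∣ norm (F (suc m)) ∣ ℕ.* W) ℕ.^ k ≡ suc k ℕ.^ d ℕ.* suc k ℕ.^ d
    norm-F-power = trans (cong₂ ℕ._^_ (sym (M-q-1 (suc m))) (sym (ℕₚ.*-identityˡ k)))
      (norm-power (q ^B suc m B.- B.1#) 0 (B.trans (geometric-cong (suc k)
        (B.trans (B.*-identityʳ _) (1+[s-1] (q ^B suc m)))) (geometric-vanishes m k G h eF eG)))

    -- For m + 1 = p^j the Frobenius congruence replaces u = q^(m+1) - 1 by u = q - 1, whose norm is
    -- W because F_1 = 1.
    norm-w-power : ∀ j → suc m ≡ suc k ℕ.^ j → W ℕ.^ (suc m ℕ.* k) ≡ suc k ℕ.^ d ℕ.* suc k ℕ.^ d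
    norm-w-power j em = trans (cong₂ (λ s t → s ℕ.^ (t ℕ.* k)) W≡ em)
      (norm-power (q B.- B.1#) j (B.trans (geometric-cong (suc k) (B.trans (^B-congˡ (suc k ℕ.^ j) (1+[s-1] q))
        (B.reflexive (cong (q ^B_) (sym em))))) (geometric-vanishes m k G h eF eG)))
      where
      W≡ : W ≡ M (q B.- B.1#)
      W≡ = sym (trans (M-cong {q B.- B.1#} {q ^B 1 B.- B.1#} (B.+-congʳ {B.- B.1#} {q} {q ^B 1} (B.sym {q ^B 1} {q} (B.*-identityʳ q)))) (trans (M-q-1 1)
        (trans (cong (λ t → ∣ t ∣ ℕ.* ∣ t ∣ ℕ.* W) norm-1) (ℕₚ.*-identityˡ W))))

-- Derivatives of Fibonacci polynomials

module DerivativeRules where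
  open Zx using (coeff; const; shiftX; scale; deriv)
  open PolynomialRing
  open Homogenization using (coeff-deriv)
  open CommutativeRing ℤ[x] using (_+_; _*_; +-congˡ; +-cong; *-congˡ; *-congʳ)
    renaming (refl to ≋-refl; sym to ≋-sym; trans to ≋-trans)
  open IntegerSolver ℤ[x] using (solve; _:+_; _:*_; _:=_)

  deriv-cong : ∀ {p q} → p ≋ q → deriv p ≋ deriv q
  at (deriv-cong {p} {q} e) k = trans (coeff-deriv p k)
    (trans (cong (+ suc k ℤ.*_) (at e (suc k))) (sym (coeff-deriv q k)))

  deriv-+ : ∀ p q → deriv (p + q) ≋ deriv p + deriv q
  at (deriv-+ p q) k = begin
    coeff (deriv (p + q)) k                                        ≡⟨ coeff-deriv (p + q) k ⟩
    + suc k ℤ.* coeff (p + q) (suc k)                              ≡⟨ cong (+ suc k ℤ.*_) (coeff-+ p q (suc k)) ⟩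
    + suc k ℤ.* (coeff p (suc k) ℤ.+ coeff q (suc k))              ≡⟨ ℤₚ.*-distribˡ-+ (+ suc k) (coeff p (suc k)) (coeff q (suc k)) ⟩
    + suc k ℤ.* coeff p (suc k) ℤ.+ + suc k ℤ.* coeff q (suc k)    ≡⟨ cong₂ ℤ._+_ (coeff-deriv p k) (coeff-deriv q k) ⟨
    coeff (deriv p) k ℤ.+ coeff (deriv q) k                        ≡⟨ coeff-+ (deriv p) (deriv q) k ⟨
    coeff (deriv p + deriv q) k                                    ∎
    where open ≡-Reasoning

  deriv-∷ : ∀ a p → deriv (a ∷ p) ≋ p + X * deriv p
  deriv-∷ a p = ≋-trans shifted (+-congˡ {p} (shiftX≋X* (deriv p)))
    where
    shifted : deriv (a ∷ p) ≋ p + shiftX (deriv p)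
    at shifted zero = trans (coeff-deriv (a ∷ p) 0) (trans (ℤₚ.*-identityˡ (coeff p 0))
      (sym (trans (coeff-+ p (shiftX (deriv p)) 0) (ℤₚ.+-identityʳ (coeff p 0)))))
    at shifted (suc k) = trans (coeff-deriv (a ∷ p) (suc k)) (trans (ℤₚ.suc-* (+ suc k) (coeff p (suc k)))
      (sym (trans (coeff-+ p (shiftX (deriv p)) (suc k)) (cong (λ t → coeff p (suc k) ℤ.+ t) (coeff-deriv p k)))))

  deriv-scale : ∀ c p → deriv (scale c p) ≋ scale c (deriv p)
  at (deriv-scale c p) k = begin
    coeff (deriv (scale c p)) k              ≡⟨ coeff-deriv (scale c p) k ⟩
    + suc k ℤ.* coeff (scale c p) (suc k)    ≡⟨ cong (+ suc k ℤ.*_) (coeff-scale c p (suc k)) ⟩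
    + suc k ℤ.* (c ℤ.* coeff p (suc k))      ≡⟨ ℤₚ.*-assoc (+ suc k) c (coeff p (suc k)) ⟨
    + suc k ℤ.* c ℤ.* coeff p (suc k)        ≡⟨ cong (ℤ._* coeff p (suc k)) (ℤₚ.*-comm (+ suc k) c) ⟩
    c ℤ.* + suc k ℤ.* coeff p (suc k)        ≡⟨ ℤₚ.*-assoc c (+ suc k) (coeff p (suc k)) ⟩
    c ℤ.* (+ suc k ℤ.* coeff p (suc k))      ≡⟨ cong (c ℤ.*_) (coeff-deriv p k) ⟨
    c ℤ.* coeff (deriv p) k                  ≡⟨ coeff-scale c (deriv p) k ⟨
    coeff (scale c (deriv p)) k              ∎
    where open ≡-Reasoning

  deriv-* : ∀ p q → deriv (p * q) ≋ deriv p * q + p * deriv q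
  deriv-* []      q = ≋-refl
  deriv-* (a ∷ p) q = begin
    deriv (scale a q + shiftX (p * q))                         ≈⟨ deriv-+ (scale a q) (shiftX (p * q)) ⟩
    deriv (scale a q) + deriv (shiftX (p * q))                 ≈⟨ +-cong (≋-trans (deriv-scale a q) (≋-sym (const-* a (deriv q))))
                                                                    (≋-trans (deriv-∷ 0ℤ (p * q)) (+-congˡ {p * q} (*-congˡ {X} (deriv-* p q)))) ⟩
    const a * deriv q + (p * q + X * (deriv p * q + p * deriv q))
      ≈⟨ solve 6 (λ a x p q p′ q′ → a :* q′ :+ (p :* q :+ x :* (p′ :* q :+ p :* q′)) := (p :+ x :* p′) :* q :+ (a :+ x :* p) :* q′) ≋-refl
           (const a) X p q (deriv p) (deriv q) ⟩
    (p + X * deriv p) * q + (const a + X * p) * deriv q        ≈⟨ +-cong (*-congʳ {q} (≋-sym (deriv-∷ a p))) (*-congʳ {deriv q} (≋-sym (∷-split a p))) ⟩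
    deriv (a ∷ p) * q + (a ∷ p) * deriv q                      ∎
    where open Relation.Binary.Reasoning.Setoid (CommutativeRing.setoid ℤ[x])

module FibonacciDerivative where
  open Zx using (const; shiftX; deriv)
  open PolynomialRing
  open FibonacciPolynomials
  open DerivativeRules
  open CommutativeRing ℤ[x] using (_+_; _*_; _-_; -_; +-congˡ; +-congʳ; +-cong; *-congˡ; *-congʳ; *-cong; -‿cong; setoid)
    renaming (refl to ≋-refl; sym to ≋-sym; trans to ≋-trans)
  open IntegerSolver ℤ[x] using (solve; con; _:+_; _:*_; _:-_; :-_; _:=_)
  open Relation.Binary.Reasoning.Setoid setoid

  -- The Lucas polynomial F_(n+1) + F_(n-1), with F_(n-1) replaced by F_(n+1) - x F_n so that n = 0
  -- is covered.
  L : ℕ → ℤ[X]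
  L n = const (+ 2) * F (suc n) - X * F n

  -- Cassini's expression F_(n+1) F_(n-1) - F_n², again with F_(n-1) eliminated.
  cassini : ℕ → ℤ[X]
  cassini n = F (suc n) * F (suc n) - X * F (suc n) * F n - F n * F n

  cassini-sign : ∀ n → cassini n ≋ const (-1ℤ ℤ.^ n)
  cassini-sign zero = solve 1 (λ x → con (+ 1) :* con (+ 1) :- x :* con (+ 1) :* con (+ 0) :- con (+ 0) :* con (+ 0) := con (+ 1)) ≋-refl X
  cassini-sign (suc n) = begin
    cassini (suc n)                          ≈⟨ +-congʳ { - (F (suc n) * F (suc n))} (+-cong (*-cong (F-suc n) (F-suc n)) (-‿cong (*-congʳ {F (suc n)} (*-congˡ {X} (F-suc n))))) ⟩
    (X * a + b) * (X * a + b) - X * (X * a + b) * a - a * a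
      ≈⟨ solve 3 (λ x a b → (x :* a :+ b) :* (x :* a :+ b) :- x :* (x :* a :+ b) :* a :- a :* a := con -1ℤ :* (a :* a :- x :* a :* b :- b :* b)) ≋-refl X a b ⟩
    const -1ℤ * cassini n                    ≈⟨ *-congˡ {const -1ℤ} (cassini-sign n) ⟩
    const -1ℤ * const (-1ℤ ℤ.^ n)            ≈⟨ const-* -1ℤ (const (-1ℤ ℤ.^ n)) ⟩
    const (-1ℤ ℤ.* -1ℤ ℤ.^ n)                ∎
    where
    a = F (suc n)
    b = F n

  -- Completing the square: 4(a² - xab - b²) = (2a - xb)² - (x² + 4)b².
  L-square : ∀ n → L n * L n ≋ const (+ 4) * const (-1ℤ ℤ.^ n) + w * F n * F n
  L-square n = begin
    L n * L n                                            ≈⟨ solve 3 (λ x a b → (con (+ 2) :* a :- x :* b) :* (con (+ 2) :* a :- x :* b)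
                                                              := con (+ 4) :* (a :* a :- x :* a :* b :- b :* b) :+ (x :* x :+ con (+ 4)) :* b :* b) ≋-refl X (F (suc n)) (F n) ⟩
    const (+ 4) * cassini n + w * F n * F n              ≈⟨ +-congʳ {w * F n * F n} (*-congˡ {const (+ 4)} (cassini-sign n)) ⟩
    const (+ 4) * const (-1ℤ ℤ.^ n) + w * F n * F n      ∎

  deriv-F-suc : ∀ n → deriv (F (suc (suc n))) ≋ F (suc n) + X * deriv (F (suc n)) + deriv (F n)
  deriv-F-suc n = ≋-trans (deriv-+ (shiftX (F (suc n))) (F n)) (+-congʳ {deriv (F n)} (deriv-∷ 0ℤ (F (suc n))))

  -- The formula comes from differentiating F_n δ = z^n - z̄^n with z′ = z/δ, z̄′ = -z̄/δ and δ′ =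
  -- x/δ. The proof is a two-step induction along the recurrence, which stays inside ℤ[x].
  w*deriv-F : ∀ n → w * deriv (F n) ≋ const (+ n) * L n - X * F n
  w*deriv-F zero = ≋-trans (solve 2 (λ x w → w :* con (+ 0) := con (+ 0) :* (con (+ 2) :* con (+ 1) :- x :* con (+ 0)) :- x :* con (+ 0)) ≋-refl X w)
    (+-congʳ { - (X * [])} (*-congʳ {L 0} zero≋))
    where
    zero≋ : [] ≋ const (+ 0)
    at zero≋ zero    = refl
    at zero≋ (suc k) = refl
  w*deriv-F (suc zero) = begin
    w * []                                                        ≈⟨ solve 2 (λ x w → w :* con (+ 0) := con (+ 1) :* (con (+ 2) :* (x :* con (+ 1) :+ con (+ 0)) :- x :* con (+ 1)) :- x :* con (+ 1)) ≋-refl X w ⟩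
    const (+ 1) * (const (+ 2) * (X * F 1 + F 0) - X * F 1) - X * F 1
      ≈⟨ +-congʳ { - (X * F 1)} (*-congˡ {const (+ 1)} (+-congʳ { - (X * F 1)} (*-congˡ {const (+ 2)} (≋-sym (F-suc 0))))) ⟩
    const (+ 1) * L 1 - X * F 1                                   ∎
  w*deriv-F (suc (suc n)) = begin
    w * deriv (F (suc (suc n)))                      ≈⟨ *-congˡ {w} (deriv-F-suc n) ⟩
    w * (f + X * deriv f + deriv g)                  ≈⟨ solve 5 (λ w x f f′ g′ → w :* (f :+ x :* f′ :+ g′) := w :* f :+ x :* (w :* f′) :+ w :* g′) ≋-refl w X f (deriv f) (deriv g) ⟩
    w * f + X * (w * deriv f) + w * deriv g          ≈⟨ +-cong (+-congˡ {w * f} (*-congˡ {X} (w*deriv-F (suc n)))) (w*deriv-F n) ⟩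
    w * f + X * ((const (+ 1) + N) * (const (+ 2) * F (suc (suc n)) - X * f) - X * f) + (N * (const (+ 2) * f - X * g) - X * g)
      ≈⟨ +-congʳ {N * (const (+ 2) * f - X * g) - X * g} (+-congˡ {w * f} (*-congˡ {X} (+-congʳ { - (X * f)} (*-congˡ {const (+ 1) + N} (+-congʳ { - (X * f)} (*-congˡ {const (+ 2)} (F-suc n))))))) ⟩
    w * f + X * ((const (+ 1) + N) * (const (+ 2) * (X * f + g) - X * f) - X * f) + (N * (const (+ 2) * f - X * g) - X * g)
      ≈⟨ solve 4 (λ x N f g → (x :* x :+ con (+ 4)) :* f :+ x :* ((con (+ 1) :+ N) :* (con (+ 2) :* (x :* f :+ g) :- x :* f) :- x :* f) :+ (N :* (con (+ 2) :* f :- x :* g) :- x :* g)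
           := (con (+ 2) :+ N) :* (con (+ 2) :* (x :* (x :* f :+ g) :+ f) :- x :* (x :* f :+ g)) :- x :* (x :* f :+ g)) ≋-refl X N f g ⟩
    (const (+ 2) + N) * (const (+ 2) * (X * (X * f + g) + f) - X * (X * f + g)) - X * (X * f + g)
      ≈⟨ +-cong (*-congˡ {const (+ 2) + N} (+-cong (*-congˡ {const (+ 2)} (≋-sym (≋-trans (F-suc (suc n)) (+-congʳ {f} (*-congˡ {X} (F-suc n))))))
           (-‿cong (*-congˡ {X} (≋-sym (F-suc n)))))) (-‿cong (*-congˡ {X} (≋-sym (F-suc n)))) ⟩
    const (+ suc (suc n)) * L (suc (suc n)) - X * F (suc (suc n)) ∎
    where
    f = F (suc n)
    g = F n
    N = const (+ n)

square-injective : ∀ m n → m ℕ.* m ≡ n ℕ.* n → m ≡ n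
square-injective m n e with ℕₚ.<-cmp m n
... | tri< m<n _ _ = ⊥-elim (ℕₚ.<⇒≢ (ℕₚ.*-mono-< m<n m<n) e)
... | tri≈ _ m≡n _ = m≡n
... | tri> _ _ n<m = ⊥-elim (ℕₚ.<⇒≢ (ℕₚ.*-mono-< n<m n<m) (sym e))

^-distribʳ-* : ∀ n a b → (a ℕ.* b) ℕ.^ n ≡ a ℕ.^ n ℕ.* b ℕ.^ n
^-distribʳ-* zero    a b = refl
^-distribʳ-* (suc n) a b rewrite ^-distribʳ-* n a b =
  solve 4 (λ a b x y → a :* b :* (x :* y) := a :* x :* (b :* y)) refl a b (a ℕ.^ n) (b ℕ.^ n)
  where open ℕ-Solver

module NormOfDerivative (ψ : ℤ[X]) (d : ℕ) (monic : PolynomialRing.Monic ψ d) (n : ℕ) (T : ℤ[X])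
  (factor : F n PolynomialRing.≋ CommutativeRing._*_ PolynomialRing.ℤ[x] ψ T) where
  open import Data.Integer using (∣_∣)
  open Zx using (const; deriv)
  open PolynomialRing
  open FibonacciPolynomials
  open FibonacciDerivative
  open DerivativeRules
  open Norm ψ d monic
  open NormOfFibonacci ψ d monic using (W; ^-abs)
  open CommutativeRing ℤ[x] using (_+_; _*_; _-_; -_; +-congˡ; +-congʳ; *-congˡ; -‿cong)
    renaming (refl to ≋-refl; sym to ≋-sym; trans to ≋-trans)
  open IntegerSolver ℤ[x] using (solve; _:+_; _:*_; _:-_; :-_; _:=_)

  abs-norm-const : ∀ c → ∣ norm (const c) ∣ ≡ ∣ c ∣ ℕ.^ d
  abs-norm-const c = trans (cong ∣_∣ (norm-const c)) (^-abs c d)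

  abs-norm-* : ∀ p q → ∣ norm (p * q) ∣ ≡ ∣ norm p ∣ ℕ.* ∣ norm q ∣
  abs-norm-* p q = trans (cong ∣_∣ (norm-* p q)) (ℤₚ.abs-* (norm p) (norm q))

  abs-norm-L : ∣ norm (L n) ∣ ≡ 2 ℕ.^ d
  abs-norm-L = square-injective ∣ norm (L n) ∣ (2 ℕ.^ d) (begin
    ∣ norm (L n) ∣ ℕ.* ∣ norm (L n) ∣            ≡⟨ abs-norm-* (L n) (L n) ⟨
    ∣ norm (L n * L n) ∣                         ≡⟨ cong ∣_∣ (norm-mod (L n * L n) (const (+ 4) * const (-1ℤ ℤ.^ n)) (w * F n * T)
                                                      (≋-trans (L-square n) (+-congˡ {const (+ 4) * const (-1ℤ ℤ.^ n)} (≋-trans (*-congˡ {w * F n} factor)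
                                                        (solve 3 (λ w t p → w :* (p :* t) := w :* t :* p) ≋-refl (w * F n) T ψ))))) ⟩
    ∣ norm (const (+ 4) * const (-1ℤ ℤ.^ n)) ∣   ≡⟨ abs-norm-* (const (+ 4)) (const (-1ℤ ℤ.^ n)) ⟩
    ∣ norm (const (+ 4)) ∣ ℕ.* ∣ norm (const (-1ℤ ℤ.^ n)) ∣ ≡⟨ cong₂ ℕ._*_ (abs-norm-const (+ 4)) (abs-norm-const (-1ℤ ℤ.^ n)) ⟩
    4 ℕ.^ d ℕ.* ∣ -1ℤ ℤ.^ n ∣ ℕ.^ d              ≡⟨ cong (λ t → 4 ℕ.^ d ℕ.* t ℕ.^ d) (trans (^-abs -1ℤ n) (ℕₚ.^-zeroˡ n)) ⟩
    4 ℕ.^ d ℕ.* 1 ℕ.^ d                          ≡⟨ cong (4 ℕ.^ d ℕ.*_) (ℕₚ.^-zeroˡ d) ⟩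
    4 ℕ.^ d ℕ.* 1                                ≡⟨ ℕₚ.*-identityʳ (4 ℕ.^ d) ⟩
    4 ℕ.^ d                                      ≡⟨ ^-distribʳ-* d 2 2 ⟩
    2 ℕ.^ d ℕ.* 2 ℕ.^ d                          ∎)
    where open ≡-Reasoning

  norm-deriv : W ℕ.* ∣ norm (deriv ψ) ∣ ℕ.* ∣ norm T ∣ ≡ (2 ℕ.* n) ℕ.^ d
  norm-deriv = begin
    W ℕ.* ∣ norm (deriv ψ) ∣ ℕ.* ∣ norm T ∣        ≡⟨ cong (ℕ._* ∣ norm T ∣) (abs-norm-* w (deriv ψ)) ⟨
    ∣ norm (w * deriv ψ) ∣ ℕ.* ∣ norm T ∣          ≡⟨ abs-norm-* (w * deriv ψ) T ⟨
    ∣ norm (w * deriv ψ * T) ∣                     ≡⟨ cong ∣_∣ (norm-mod (w * deriv ψ * T) (const (+ n) * L n) (- (X * T) - w * deriv T) identity) ⟩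
    ∣ norm (const (+ n) * L n) ∣                   ≡⟨ abs-norm-* (const (+ n)) (L n) ⟩
    ∣ norm (const (+ n)) ∣ ℕ.* ∣ norm (L n) ∣      ≡⟨ cong₂ ℕ._*_ (abs-norm-const (+ n)) abs-norm-L ⟩
    n ℕ.^ d ℕ.* 2 ℕ.^ d                            ≡⟨ ℕₚ.*-comm (n ℕ.^ d) (2 ℕ.^ d) ⟩
    2 ℕ.^ d ℕ.* n ℕ.^ d                            ≡⟨ ^-distribʳ-* d 2 n ⟨
    (2 ℕ.* n) ℕ.^ d                                ∎
    where
    open ≡-Reasoning
    -- By the product rule the left side is w F_n′ - w ψ T′. The second term and the summand x F_n
    -- of w F_n′ are multiples of ψ and make up the cofactor.
    identity : w * deriv ψ * T ≋ const (+ n) * L n + (- (X * T) - w * deriv T) * ψ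
    identity = ≋-trans (solve 5 (λ w p p′ t t′ → w :* p′ :* t := w :* (p′ :* t :+ p :* t′) :- w :* t′ :* p) ≋-refl w ψ (deriv ψ) T (deriv T))
      (≋-trans (+-congʳ { - (w * deriv T * ψ)} (≋-trans (*-congˡ {w} (≋-trans (≋-sym (deriv-* ψ T)) (deriv-cong (≋-sym factor))))
          (≋-trans (w*deriv-F n) (+-congˡ {const (+ n) * L n} (-‿cong (*-congˡ {X} factor))))))
        (solve 6 (λ s x p t w t′ → s :- x :* (p :* t) :- w :* t′ :* p := s :+ (:- (x :* t) :- w :* t′) :* p) ≋-refl
          (const (+ n) * L n) X ψ T w (deriv T)))

-- The sign of the norm of the derivative

module Reflection where
  open Zx using (coeff; const; shiftX; scale)
  open PolynomialRing
  open CommutativeRing ℤ[x] using (_+_; _*_; _-_; -_; +-congˡ; +-congʳ; +-cong; *-congˡ; *-congʳ; *-cong; -‿cong; setoid)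
    renaming (refl to ≋-refl; sym to ≋-sym; trans to ≋-trans)
  open IntegerSolver ℤ[x] using (solve; con; _:+_; _:*_; _:-_; :-_; _:=_)

  -- p(−x)
  reflect : ℤ[X] → ℤ[X]
  reflect []      = []
  reflect (a ∷ p) = a ∷ (- reflect p)

  -- Even indices are written `k * 2` because this unfolds to two successors, in step with the
  -- alternating signs of `reflect`.
  coeff-reflect-even : ∀ p k → coeff (reflect p) (k ℕ.* 2) ≡ coeff p (k ℕ.* 2)
  coeff-reflect-odd : ∀ p k → coeff (reflect p) (suc (k ℕ.* 2)) ≡ ℤ.- coeff p (suc (k ℕ.* 2))

  coeff-reflect-even []      k       = refl
  coeff-reflect-even (a ∷ p) zero    = refl
  coeff-reflect-even (a ∷ p) (suc k) = trans (coeff-neg (reflect p) (suc (k ℕ.* 2)))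
    (trans (cong ℤ.-_ (coeff-reflect-odd p k)) (ℤₚ.neg-involutive (coeff p (suc (k ℕ.* 2)))))
  coeff-reflect-odd []      k = refl
  coeff-reflect-odd (a ∷ p) k = trans (coeff-neg (reflect p) (k ℕ.* 2)) (cong ℤ.-_ (coeff-reflect-even p k))

  parity : ∀ k → ∃[ j ] (k ≡ j ℕ.* 2 ⊎ k ≡ suc (j ℕ.* 2))
  parity zero    = 0 , inj₁ refl
  parity (suc k) with parity k
  ... | j , inj₁ e = j , inj₂ (cong suc e)
  ... | j , inj₂ e = suc j , inj₁ (cong suc e)

  by-parity : {P : ℕ → Set} → (∀ j → P (j ℕ.* 2)) → (∀ j → P (suc (j ℕ.* 2))) → ∀ k → P k
  by-parity {P} even odd k with parity k
  ... | j , inj₁ refl = even j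
  ... | j , inj₂ refl = odd j

  reflect-cong : ∀ {p q} → p ≋ q → reflect p ≋ reflect q
  at (reflect-cong {p} {q} e) = by-parity
    (λ j → trans (coeff-reflect-even p j) (trans (at e (j ℕ.* 2)) (sym (coeff-reflect-even q j))))
    (λ j → trans (coeff-reflect-odd p j) (trans (cong ℤ.-_ (at e (suc (j ℕ.* 2)))) (sym (coeff-reflect-odd q j))))

  reflect-+ : ∀ p q → reflect (p + q) ≋ reflect p + reflect q
  at (reflect-+ p q) = by-parity
    (λ j → trans (coeff-reflect-even (p + q) j) (trans (coeff-+ p q (j ℕ.* 2))
      (sym (trans (coeff-+ (reflect p) (reflect q) (j ℕ.* 2)) (cong₂ ℤ._+_ (coeff-reflect-even p j) (coeff-reflect-even q j))))))
    (λ j → trans (coeff-reflect-odd (p + q) j) (trans (cong ℤ.-_ (coeff-+ p q (suc (j ℕ.* 2))))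
      (trans (ℤₚ.neg-distrib-+ (coeff p (suc (j ℕ.* 2))) (coeff q (suc (j ℕ.* 2))))
      (sym (trans (coeff-+ (reflect p) (reflect q) (suc (j ℕ.* 2))) (cong₂ ℤ._+_ (coeff-reflect-odd p j) (coeff-reflect-odd q j)))))))

  reflect-scale : ∀ c p → reflect (scale c p) ≋ scale c (reflect p)
  at (reflect-scale c p) = by-parity
    (λ j → trans (coeff-reflect-even (scale c p) j) (trans (coeff-scale c p (j ℕ.* 2))
      (sym (trans (coeff-scale c (reflect p) (j ℕ.* 2)) (cong (c ℤ.*_) (coeff-reflect-even p j))))))
    (λ j → trans (coeff-reflect-odd (scale c p) j) (trans (cong ℤ.-_ (coeff-scale c p (suc (j ℕ.* 2))))
      (trans (ℤₚ.neg-distribʳ-* c (coeff p (suc (j ℕ.* 2))))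
      (sym (trans (coeff-scale c (reflect p) (suc (j ℕ.* 2))) (cong (c ℤ.*_) (coeff-reflect-odd p j)))))))

  reflect-∷ : ∀ a p → reflect (a ∷ p) ≋ const a - X * reflect p
  reflect-∷ a p = ≋-trans (∷-split a (- reflect p)) (+-congˡ {const a}
    (solve 2 (λ x r → x :* :- r := :- (x :* r)) ≋-refl X (reflect p)))

  reflect-* : ∀ p q → reflect (p * q) ≋ reflect p * reflect q
  reflect-* []      q = ≋-refl
  reflect-* (a ∷ p) q = begin
    reflect (scale a q + shiftX (p * q))               ≈⟨ reflect-+ (scale a q) (shiftX (p * q)) ⟩
    reflect (scale a q) + reflect (shiftX (p * q))     ≈⟨ +-cong (≋-trans (reflect-scale a q) (≋-sym (const-* a (reflect q))))
                                                            (≋-trans (reflect-∷ 0ℤ (p * q)) (+-cong const-0 (-‿cong (*-congˡ {X} (reflect-* p q))))) ⟩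
    const a * reflect q + ([] - X * (reflect p * reflect q))
      ≈⟨ solve 4 (λ a x p q → a :* q :+ (con (+ 0) :- x :* (p :* q)) := (a :- x :* p) :* q) ≋-refl (const a) X (reflect p) (reflect q) ⟩
    (const a - X * reflect p) * reflect q              ≈⟨ *-congʳ {reflect q} (≋-sym (reflect-∷ a p)) ⟩
    reflect (a ∷ p) * reflect q                        ∎
    where
    open Relation.Binary.Reasoning.Setoid setoid
    open Homogenization using (const-0)

  Even : ℤ[X] → Set
  Even p = reflect p ≋ p

  ≡neg⇒0 : ∀ i → ℤ.- i ≡ i → i ≡ 0ℤ
  ≡neg⇒0 (+ zero)  _ = refl
  ≡neg⇒0 (+ suc n) ()
  ≡neg⇒0 -[1+ n ]  ()

  Even-odd-coeff : ∀ p → Even p → ∀ k → coeff p (suc (k ℕ.* 2)) ≡ 0ℤ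
  Even-odd-coeff p e k = ≡neg⇒0 _ (trans (sym (coeff-reflect-odd p k)) (at e (suc (k ℕ.* 2))))

  Below-reflect : ∀ p d → Below p d → Below (reflect p) d
  Below-reflect p d b = by-parity {λ k → d ℕ.≤ k → coeff (reflect p) k ≡ 0ℤ}
    (λ j l → trans (coeff-reflect-even p j) (b (j ℕ.* 2) l))
    (λ j l → trans (coeff-reflect-odd p j) (cong ℤ.-_ (b (suc (j ℕ.* 2)) l)))

  Even-xpow : ∀ k → Even (Monomials.xpow (k ℕ.* 2))
  Even-xpow zero    = ≋-refl
  Even-xpow (suc k) = ≋-trans (reflect-∷ 0ℤ (0ℤ ∷ p)) (≋-trans (+-cong const-0 (-‿cong (*-congˡ {X} (≋-trans (reflect-∷ 0ℤ p) (+-congʳ { - (X * reflect p)} const-0)))))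
    (≋-trans (solve 2 (λ x r → con (+ 0) :- x :* (con (+ 0) :- x :* r) := x :* (x :* r)) ≋-refl X (reflect p))
      (≋-trans (*-congˡ {X} (*-congˡ {X} (Even-xpow k))) (≋-sym (≋-trans (shiftX≋X* (0ℤ ∷ p)) (*-congˡ {X} (shiftX≋X* p)))))))
    where
    p = Monomials.xpow (k ℕ.* 2)
    open Homogenization using (const-0)

  Even-* : ∀ p q → Even p → Even q → Even (p * q)
  Even-* p q e e′ = ≋-trans (reflect-* p q) (*-cong e e′)

module Interleaving where
  open import Data.Fin using (Fin; zero; suc)
  open Zx using (det)
  open Determinant
  open DeterminantUniqueness

  -- The even and the odd positions. Since powers of x are listed in descending order and the degree
  -- is even, `low` marks the odd powers and `high` the even ones.
  low high : ∀ {m} → Fin m → Fin (m ℕ.* 2)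
  low zero     = zero
  low (suc i)  = suc (suc (low i))
  high zero    = suc zero
  high (suc i) = suc (suc (high i))

  side : ∀ m → Fin (m ℕ.* 2) → Fin m ⊎ Fin m
  side (suc m) zero          = inj₁ zero
  side (suc m) (suc zero)    = inj₂ zero
  side (suc m) (suc (suc i)) = Sum.map suc suc (side m i)

  side-low : ∀ {m} (i : Fin m) → side m (low i) ≡ inj₁ i
  side-low zero    = refl
  side-low (suc i) = cong (Sum.map suc suc) (side-low i)

  side-high : ∀ {m} (i : Fin m) → side m (high i) ≡ inj₂ i
  side-high zero    = refl
  side-high (suc i) = cong (Sum.map suc suc) (side-high i)

  unside : ∀ m (r : Fin (m ℕ.* 2)) → [ low , high ]′ (side m r) ≡ r
  unside (suc m) zero          = refl
  unside (suc m) (suc zero)    = refl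
  unside (suc m) (suc (suc r)) with side m r | unside m r
  ... | inj₁ i | e = cong (Fin.suc ∘ Fin.suc) e
  ... | inj₂ i | e = cong (Fin.suc ∘ Fin.suc) e

  by-side : ∀ {m} {P : Fin (m ℕ.* 2) → Set} → (∀ i → P (low i)) → (∀ i → P (high i)) → ∀ r → P r
  by-side {m} {P} l h r with side m r | unside m r
  ... | inj₁ i | refl = l i
  ... | inj₂ i | refl = h i

  low-injective : ∀ {m} {i j : Fin m} → low i ≡ low j → i ≡ j
  low-injective {i = zero}  {zero}  e = refl
  low-injective {i = suc i} {suc j} e = cong suc (low-injective (Finₚ.suc-injective (Finₚ.suc-injective e)))

  high-injective : ∀ {m} {i j : Fin m} → high i ≡ high j → i ≡ j
  high-injective {i = zero}  {zero}  e = refl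
  high-injective {i = suc i} {suc j} e = cong suc (high-injective (Finₚ.suc-injective (Finₚ.suc-injective e)))

  low≢high : ∀ {m} {i j : Fin m} → low i ≢ high j
  low≢high {i = zero}  {zero}  ()
  low≢high {i = zero}  {suc j} ()
  low≢high {i = suc i} {zero}  ()
  low≢high {i = suc i} {suc j} e = low≢high (Finₚ.suc-injective (Finₚ.suc-injective e))

  spread : ∀ {m} → Row m → Row m → Row (m ℕ.* 2)
  spread {m} v w c = [ v , w ]′ (side m c)

  -- The block diagonal matrix of E and O with rows and columns interleaved in the same way.
  weave : ∀ {m} → Matrix m → Matrix m → Matrix (m ℕ.* 2)
  weave {m} E O r = [ (λ i → spread (E i) (λ _ → 0ℤ)) , (λ i → spread (λ _ → 0ℤ) (O i)) ]′ (side m r)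

  weave-low : ∀ {m} (E O : Matrix m) i c → weave E O (low i) c ≡ spread (E i) (λ _ → 0ℤ) c
  weave-low E O i c rewrite side-low i = refl

  weave-high : ∀ {m} (E O : Matrix m) i c → weave E O (high i) c ≡ spread (λ _ → 0ℤ) (O i) c
  weave-high E O i c rewrite side-high i = refl

  spread-cong : ∀ {m} {v v′ w w′ : Row m} → (∀ j → v j ≡ v′ j) → (∀ j → w j ≡ w′ j) → ∀ c → spread v w c ≡ spread v′ w′ c
  spread-cong {m} e e′ c with side m c
  ... | inj₁ j = e j
  ... | inj₂ j = e′ j

  spread-linear : ∀ {m} a b {v v₁ v₂ w w₁ w₂ : Row m} →
    (∀ j → v j ≡ a ℤ.* v₁ j ℤ.+ b ℤ.* v₂ j) → (∀ j → w j ≡ a ℤ.* w₁ j ℤ.+ b ℤ.* w₂ j) →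
    ∀ c → spread v w c ≡ a ℤ.* spread v₁ w₁ c ℤ.+ b ℤ.* spread v₂ w₂ c
  spread-linear {m} a b e e′ c with side m c
  ... | inj₁ j = e j
  ... | inj₂ j = e′ j

  0-linear : ∀ a b → 0ℤ ≡ a ℤ.* 0ℤ ℤ.+ b ℤ.* 0ℤ
  0-linear a b = sym (cong₂ ℤ._+_ (ℤₚ.*-zeroʳ a) (ℤₚ.*-zeroʳ b))

  weave-alternatingˡ : ∀ {m} (O : Matrix m) → Alternating (λ E → det (weave E O))
  weave-alternatingˡ {m} O = record
    { respects = λ {E} {E′} e → det-cong (by-side (λ i c → same E E′ i (e i) c) (λ i c → trans (weave-high E O i c) (sym (weave-high E′ O i c))))
    ; linear = λ i a b E E₁ E₂ e₁ e₂ e → det-linear (low i) a b (weave E O) (weave E₁ O) (weave E₂ O)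
        (off i E E₁ e₁) (off i E E₂ e₂)
        (λ c → trans (weave-low E O i c) (trans (spread-linear a b e (λ _ → 0-linear a b) c)
          (sym (cong₂ (λ s t → a ℤ.* s ℤ.+ b ℤ.* t) (weave-low E₁ O i c) (weave-low E₂ O i c)))))
    ; alternates = λ E i j i≢j e → det-alternates (weave E O) (low i) (low j) (i≢j ∘ low-injective)
        (λ c → trans (weave-low E O i c) (trans (spread-cong e (λ _ → refl) c) (sym (weave-low E O j c)))) }
    where
    same : ∀ E E′ i → (∀ c → E i c ≡ E′ i c) → ∀ c → weave E O (low i) c ≡ weave E′ O (low i) c
    same E E′ i e c = trans (weave-low E O i c) (trans (spread-cong e (λ _ → refl) c) (sym (weave-low E′ O i c)))
    off : ∀ i E E′ → (∀ r → r ≢ i → ∀ c → E r c ≡ E′ r c) → ∀ r → r ≢ low i → ∀ c → weave E O r c ≡ weave E′ O r c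
    off i E E′ e = by-side (λ r p → same E E′ r (e r (p ∘ cong low)))
      (λ r _ c → trans (weave-high E O r c) (sym (weave-high E′ O r c)))

  weave-alternatingʳ : ∀ {m} (E : Matrix m) → Alternating (λ O → det (weave E O))
  weave-alternatingʳ {m} E = record
    { respects = λ {O} {O′} e → det-cong (by-side (λ i c → trans (weave-low E O i c) (sym (weave-low E O′ i c))) (λ i c → same O O′ i (e i) c))
    ; linear = λ i a b O O₁ O₂ e₁ e₂ e → det-linear (high i) a b (weave E O) (weave E O₁) (weave E O₂)
        (off i O O₁ e₁) (off i O O₂ e₂)
        (λ c → trans (weave-high E O i c) (trans (spread-linear a b (λ _ → 0-linear a b) e c)
          (sym (cong₂ (λ s t → a ℤ.* s ℤ.+ b ℤ.* t) (weave-high E O₁ i c) (weave-high E O₂ i c)))))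
    ; alternates = λ O i j i≢j e → det-alternates (weave E O) (high i) (high j) (i≢j ∘ high-injective)
        (λ c → trans (weave-high E O i c) (trans (spread-cong (λ _ → refl) e c) (sym (weave-high E O j c)))) }
    where
    same : ∀ O O′ i → (∀ c → O i c ≡ O′ i c) → ∀ c → weave E O (high i) c ≡ weave E O′ (high i) c
    same O O′ i e c = trans (weave-high E O i c) (trans (spread-cong (λ _ → refl) e c) (sym (weave-high E O′ i c)))
    off : ∀ i O O′ → (∀ r → r ≢ i → ∀ c → O r c ≡ O′ r c) → ∀ r → r ≢ high i → ∀ c → weave E O r c ≡ weave E O′ r c
    off i O O′ e = by-side (λ r _ c → trans (weave-low E O r c) (sym (weave-low E O′ r c)))
      (λ r p → same O O′ r (e r (p ∘ cong high)))

  det-δ : ∀ m → det (δ {m}) ≡ 1ℤ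
  det-δ m = trans (det-scalar {m} 1ℤ δ (λ r c → sym (ℤₚ.*-identityˡ (δ r c)))) (ℤₚ.^-zeroˡ m)

  spread-low : ∀ {m} (v w : Row m) j → spread v w (low j) ≡ v j
  spread-low v w j rewrite side-low j = refl

  spread-high : ∀ {m} (v w : Row m) j → spread v w (high j) ≡ w j
  spread-high v w j rewrite side-high j = refl

  δ-injective : ∀ {m n} (f : Fin m → Fin n) → (∀ {i j} → f i ≡ f j → i ≡ j) → ∀ i j → δ (f i) (f j) ≡ δ i j
  δ-injective f inj i j with i Fin.≟ j
  ... | yes refl = trans (δ-refl (f i)) (sym (δ-refl i))
  ... | no  p    = trans (δ-≢ (p ∘ inj)) (sym (δ-≢ p))

  weave-δ : ∀ {m} (r c : Fin (m ℕ.* 2)) → weave {m} δ δ r c ≡ δ r c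
  weave-δ {m} = by-side {m} {P = λ r → ∀ c → weave {m} δ δ r c ≡ δ r c}
    (λ i c → trans (weave-low δ δ i c) (by-side {m} {P = λ c → spread (δ i) (λ _ → 0ℤ) c ≡ δ (low i) c}
      (λ j → trans (spread-low (δ i) (λ _ → 0ℤ) j) (sym (δ-injective low low-injective i j)))
      (λ j → trans (spread-high (δ i) (λ _ → 0ℤ) j) (sym (δ-≢ (low≢high {i = i} {j})))) c))
    (λ i c → trans (weave-high δ δ i c) (by-side {m} {P = λ c → spread (λ _ → 0ℤ) (δ i) c ≡ δ (high i) c}
      (λ j → trans (spread-low (λ _ → 0ℤ) (δ i) j) (sym (δ-≢ (λ e → low≢high {i = j} {i} (sym e)))))
      (λ j → trans (spread-high (λ _ → 0ℤ) (δ i) j) (sym (δ-injective high high-injective i j))) c))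

  -- The determinant is alternating in the rows of each block separately, so uniqueness of
  -- alternating forms is applied once per block.
  det-weave : ∀ {m} (E O : Matrix m) → det (weave E O) ≡ det E ℤ.* det O
  det-weave {m} E O = begin
    det (weave E O)                                ≡⟨ alternating-unique (λ E → det (weave E O)) (weave-alternatingˡ O) E ⟩
    det E ℤ.* det (weave δ O)                      ≡⟨ cong (det E ℤ.*_) (alternating-unique (λ O → det (weave δ O)) (weave-alternatingʳ δ) O) ⟩
    det E ℤ.* (det O ℤ.* det (weave (δ {m}) δ))    ≡⟨ cong (λ t → det E ℤ.* (det O ℤ.* t)) (trans (det-cong {M = weave (δ {m}) δ} (weave-δ {m})) (det-δ (m ℕ.* 2))) ⟩
    det E ℤ.* (det O ℤ.* 1ℤ)                       ≡⟨ cong (det E ℤ.*_) (ℤₚ.*-identityʳ (det O)) ⟩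
    det E ℤ.* det O                                ∎
    where open ≡-Reasoning

module CompanionDeterminant where
  open import Data.Fin using (Fin; zero; suc; toℕ; punchIn; inject₁; fromℕ; lower₁)
  open Zx using (det; sumFin)
  open Determinant
  open DeterminantUniqueness
  open Interleaving using (det-δ)

  -- After expanding the first row into unit rows, every unit row but the last repeats one of the
  -- rows below and gives 0; the last gives a cyclic rearrangement of the identity.
  det-companion : ∀ {e} (M : Matrix (suc e)) → (∀ i c → M (suc i) c ≡ δ (inject₁ i) c) →
    det M ≡ M zero (fromℕ e) ℤ.* sgn (fromℕ e)
  det-companion {e} M rows = begin
    det M                                                             ≡⟨ det-cong {M = M} {(λ c → sumFin (λ j → M zero j ℤ.* δ j c)) ◂ (δ ∘ inject₁)} (λ { zero c → sym (sum-δʳ c (M zero)) ; (suc r) c → rows r c }) ⟩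
    det ((λ c → sumFin (λ j → M zero j ℤ.* δ j c)) ◂ (δ ∘ inject₁))   ≡⟨ expand-row (suc e) (M zero) δ (δ ∘ inject₁) ⟩
    sumFin (λ j → M zero j ℤ.* det (δ j ◂ (δ ∘ inject₁)))             ≡⟨ sum-cong {f = λ j → M zero j ℤ.* det (δ j ◂ (δ ∘ inject₁))} {λ j → δ (fromℕ e) j ℤ.* (M zero j ℤ.* sgn (fromℕ e))} (λ j → trans (cong (M zero j ℤ.*_) (position j))
                                                                           (trans (sym (ℤₚ.*-assoc (M zero j) (δ (fromℕ e) j) (sgn (fromℕ e))))
                                                                             (trans (cong (ℤ._* sgn (fromℕ e)) (ℤₚ.*-comm (M zero j) (δ (fromℕ e) j)))
                                                                               (ℤₚ.*-assoc (δ (fromℕ e) j) (M zero j) (sgn (fromℕ e)))))) ⟩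
    sumFin (λ j → δ (fromℕ e) j ℤ.* (M zero j ℤ.* sgn (fromℕ e)))     ≡⟨ sum-δˡ (fromℕ e) (λ j → M zero j ℤ.* sgn (fromℕ e)) ⟩
    M zero (fromℕ e) ℤ.* sgn (fromℕ e)                                ∎
    where
    open ≡-Reasoning
    open FormProperties {e} det det-alternating
    punchIn-last : ∀ {e} (r : Fin e) → punchIn (fromℕ e) r ≡ inject₁ r
    punchIn-last zero    = refl
    punchIn-last (suc r) = cong suc (punchIn-last r)
    position : ∀ j → det (δ j ◂ (δ ∘ inject₁)) ≡ δ (fromℕ e) j ℤ.* sgn (fromℕ e)
    position j with fromℕ e Fin.≟ j
    ... | yes refl = begin
      det (δ (fromℕ e) ◂ (δ ∘ inject₁))     ≡⟨ det-cong {M = δ (fromℕ e) ◂ (δ ∘ inject₁)} {rotated (fromℕ e)} (λ { zero c → refl ; (suc r) c → cong (λ k → δ k c) (sym (punchIn-last r)) }) ⟩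
      det (rotated (fromℕ e))               ≡⟨ rotated-sgn (fromℕ e) ⟩
      sgn (fromℕ e) ℤ.* det (δ {suc e})     ≡⟨ cong (sgn (fromℕ e) ℤ.*_) (det-δ (suc e)) ⟩
      sgn (fromℕ e) ℤ.* 1ℤ                  ≡⟨ ℤₚ.*-comm (sgn (fromℕ e)) 1ℤ ⟩
      1ℤ ℤ.* sgn (fromℕ e)                  ≡⟨ cong (ℤ._* sgn (fromℕ e)) (δ-refl (fromℕ e)) ⟨
      δ (fromℕ e) (fromℕ e) ℤ.* sgn (fromℕ e) ∎
    ... | no p = begin
      det (δ j ◂ (δ ∘ inject₁))             ≡⟨ det-alternates (δ j ◂ (δ ∘ inject₁)) zero (suc i) (λ ()) (λ c → cong (λ k → δ k c) (sym inject-i)) ⟩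
      0ℤ                                    ≡⟨ ℤₚ.*-zeroˡ (sgn (fromℕ e)) ⟨
      0ℤ ℤ.* sgn (fromℕ e)                  ≡⟨ cong (ℤ._* sgn (fromℕ e)) (δ-≢ p) ⟨
      δ (fromℕ e) j ℤ.* sgn (fromℕ e)       ∎
      where
      e≢j : e ≢ toℕ j
      e≢j q = p (Finₚ.toℕ-injective (trans (Finₚ.toℕ-fromℕ e) q))
      i : Fin e
      i = lower₁ j e≢j
      inject-i : inject₁ i ≡ j
      inject-i = Finₚ.inject₁-lower₁ j e≢j

module NormOfEven (ψ : ℤ[X]) (m : ℕ) (monic : PolynomialRing.Monic ψ (suc m ℕ.* 2)) (ψ-even : Reflection.Even ψ) where
  open import Data.Fin using (Fin; zero; suc; toℕ; inject₁; fromℕ)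
  open Zx using (coeff; oneₚ; shiftX; det; deriv)
  open PolynomialRing
  open Monomials
  open Reflection
  open Interleaving
  open Determinant
  open Homogenization using (coeff-deriv)
  open CommutativeRing ℤ[x] using (_+_; _*_; _-_; -_; +-congˡ; +-congʳ; *-congˡ; *-comm)
    renaming (refl to ≋-refl; sym to ≋-sym; trans to ≋-trans; reflexive to ≋-reflexive)
  open IntegerSolver ℤ[x] using (solve; con; _:+_; _:*_; _:-_; :-_; _:=_)

  d : ℕ
  d = suc m ℕ.* 2

  open Division ψ d monic
  open Norm ψ d monic

  -- Reflecting p = q ψ + r gives another division of p by ψ, so r is its own reflection by
  -- uniqueness.
  remainder-even : ∀ p → Even p → Even (remainder p)
  remainder-even p e = ≋-sym (remainder-unique p (reflect (quotient p)) (reflect (remainder p))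
    (Below-reflect (remainder p) d (remainder-below p))
    (≋-trans (≋-sym e) (≋-trans (reflect-cong (division p)) (≋-trans (reflect-+ (quotient p * ψ) (remainder p))
      (+-congʳ {reflect (remainder p)} (≋-trans (reflect-* (quotient p) ψ) (*-congˡ {reflect (quotient p)} ψ-even)))))))

  -- The remainder of an even p has no term of the odd degree d - 1, so multiplying it by x does not
  -- reach degree d and no further reduction takes place.
  remainder-X : ∀ p → Even p → remainder (X * p) ≋ shiftX (remainder p)
  remainder-X p e = remainder-unique (X * p) (X * quotient p) (shiftX r) r-below
    (≋-trans (*-congˡ {X} (division p)) (≋-trans (solve 4 (λ x q f r → x :* (q :* f :+ r) := x :* q :* f :+ x :* r) ≋-refl X (quotient p) ψ r)
      (+-congˡ {X * quotient p * ψ} (≋-sym (shiftX≋X* r)))))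
    where
    r = remainder p
    r-below : Below (shiftX r) d
    r-below (suc k) (s≤s l) with ℕₚ.m≤n⇒m<n∨m≡n l
    ... | inj₁ l′   = remainder-below p k l′
    ... | inj₂ refl = Even-odd-coeff r (remainder-even p e) m

  toℕ-low : ∀ {m} (i : Fin m) → toℕ (low i) ≡ toℕ i ℕ.* 2
  toℕ-low zero    = refl
  toℕ-low (suc i) = cong (λ t → suc (suc t)) (toℕ-low i)

  toℕ-high : ∀ {m} (i : Fin m) → toℕ (high i) ≡ suc (toℕ i ℕ.* 2)
  toℕ-high zero    = refl
  toℕ-high (suc i) = cong (λ t → suc (suc t)) (toℕ-high i)

  exponent-high : ∀ {m} (i : Fin m) → exponent (high i) ≡ exponent i ℕ.* 2
  exponent-high {m} i rewrite toℕ-high i = sym (ℕₚ.*-distribʳ-∸ 2 m (suc (toℕ i)))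

  exponent-low : ∀ {m} (i : Fin m) → exponent (low i) ≡ suc (exponent i ℕ.* 2)
  exponent-low {m} i rewrite toℕ-low i | ℕₚ.*-distribʳ-∸ 2 m (suc (toℕ i)) =
    ℕₚ.+-∸-assoc 1 {m ℕ.* 2} {suc (toℕ i) ℕ.* 2} (ℕₚ.*-monoˡ-≤ 2 (Finₚ.toℕ<n i))

  module _ (h : ℤ[X]) (h-even : Even h) where

    evenRow : Fin (suc m) → ℤ[X]
    evenRow i = remainder (xpow (exponent i ℕ.* 2) * h)

    evenRow-even : ∀ i → Even (evenRow i)
    evenRow-even i = remainder-even _ (Even-* (xpow (exponent i ℕ.* 2)) h (Even-xpow (exponent i)) h-even)

    -- Multiplication by h on the even polynomials modulo ψ, in the even powers of x. By
    -- `remainder-X` the odd powers give the same matrix.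
    halfMatrix : Matrix (suc m)
    halfMatrix i j = coeff (evenRow i) (exponent j ℕ.* 2)

    row-high : ∀ i c → normMatrix h (high i) c ≡ coeff (evenRow i) (exponent c)
    row-high i c rewrite exponent-high i = refl

    row-low : ∀ i c → normMatrix h (low i) c ≡ coeff (shiftX (evenRow i)) (exponent c)
    row-low i c rewrite exponent-low i = at (≋-trans
      (remainder-cong (≋-trans (xpow-suc-* (exponent i ℕ.* 2) h) (shiftX≋X* (xpow (exponent i ℕ.* 2) * h))))
      (remainder-X (xpow (exponent i ℕ.* 2) * h) (Even-* (xpow (exponent i ℕ.* 2)) h (Even-xpow (exponent i)) h-even))) (exponent c)

    shifted-zero : ∀ i k → coeff (shiftX (evenRow i)) (k ℕ.* 2) ≡ 0ℤ
    shifted-zero i zero    = refl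
    shifted-zero i (suc k) = Even-odd-coeff (evenRow i) (evenRow-even i) k

    checkerboard : ∀ r c → normMatrix h r c ≡ weave halfMatrix halfMatrix r c
    checkerboard = by-side {suc m} {P = λ r → ∀ c → normMatrix h r c ≡ weave halfMatrix halfMatrix r c}
      (λ i c → trans (row-low i c) (trans (by-side {suc m} {P = λ c → coeff (shiftX (evenRow i)) (exponent c) ≡ spread (halfMatrix i) (λ _ → 0ℤ) c}
        (λ j → trans (cong (coeff (shiftX (evenRow i))) (exponent-low j)) (sym (spread-low (halfMatrix i) (λ _ → 0ℤ) j)))
        (λ j → trans (cong (coeff (shiftX (evenRow i))) (exponent-high j)) (trans (shifted-zero i (exponent j)) (sym (spread-high (halfMatrix i) (λ _ → 0ℤ) j)))) c)
        (sym (weave-low halfMatrix halfMatrix i c))))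
      (λ i c → trans (row-high i c) (trans (by-side {suc m} {P = λ c → coeff (evenRow i) (exponent c) ≡ spread (λ _ → 0ℤ) (halfMatrix i) c}
        (λ j → trans (cong (coeff (evenRow i)) (exponent-low j)) (trans (Even-odd-coeff (evenRow i) (evenRow-even i) (exponent j)) (sym (spread-low (λ _ → 0ℤ) (halfMatrix i) j))))
        (λ j → trans (cong (coeff (evenRow i)) (exponent-high j)) (sym (spread-high (λ _ → 0ℤ) (halfMatrix i) j))) c)
        (sym (weave-high halfMatrix halfMatrix i c))))

    norm-even : norm h ≡ det halfMatrix ℤ.* det halfMatrix
    norm-even = trans (det-cong {M = normMatrix h} checkerboard) (det-weave halfMatrix halfMatrix)

  -- Multiplication by x has a companion matrix with the negated coefficients of ψ in its first row.
  -- The corner entry -ψ(0) carries the sign (-1)^(d-1) = -1, as d is even.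
  norm-X : norm X ≡ coeff ψ 0
  norm-X = begin
    norm X                                                                ≡⟨ CompanionDeterminant.det-companion (normMatrix X) lower-rows ⟩
    normMatrix X zero (fromℕ e) ℤ.* sgn (fromℕ e)                         ≡⟨ cong₂ ℤ._*_ (first-row (fromℕ e)) last-sign ⟩
    ℤ.- coeff ψ (exponent (fromℕ e)) ℤ.* -1ℤ                              ≡⟨ cong (λ t → ℤ.- coeff ψ t ℤ.* -1ℤ) (trans (cong (e ∸_) (Finₚ.toℕ-fromℕ e)) (ℕₚ.n∸n≡0 e)) ⟩
    ℤ.- coeff ψ 0 ℤ.* -1ℤ                                                 ≡⟨ ℤₚ.*-comm (ℤ.- coeff ψ 0) -1ℤ ⟩
    -1ℤ ℤ.* ℤ.- coeff ψ 0                                                 ≡⟨ ℤₚ.-1*i≡-i (ℤ.- coeff ψ 0) ⟩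
    ℤ.- ℤ.- coeff ψ 0                                                     ≡⟨ ℤₚ.neg-involutive (coeff ψ 0) ⟩
    coeff ψ 0                                                             ∎
    where
    open ≡-Reasoning
    e = suc (m ℕ.* 2)
    pow-even : ∀ k → Zx.pow -1ℤ (k ℕ.* 2) ≡ 1ℤ
    pow-even zero    = refl
    pow-even (suc k) = cong (λ t → -1ℤ ℤ.* (-1ℤ ℤ.* t)) (pow-even k)
    last-sign : sgn (fromℕ e) ≡ -1ℤ
    last-sign = trans (cong (Zx.pow -1ℤ) (Finₚ.toℕ-fromℕ e)) (cong (-1ℤ ℤ.*_) (pow-even m))
    times-X : ∀ n → xpow n * X ≋ xpow (suc n)
    times-X n = ≋-trans (*-comm (xpow n) X) (≋-sym (shiftX≋X* (xpow n)))
    remainder-top : remainder (xpow d) ≋ xpow d - ψ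
    remainder-top = remainder-unique (xpow d) oneₚ (xpow d - ψ) difference-below
      (solve 2 (λ x f → x := con (+ 1) :* f :+ (x :- f)) ≋-refl (xpow d) ψ)
      where
      difference-below : Below (xpow d - ψ) d
      difference-below k l with ℕₚ.m≤n⇒m<n∨m≡n l
      ... | inj₁ l′ = trans (coeff-minus (xpow d) ψ k) (cong₂ ℤ._-_ (coeff-monomial-≢ 1ℤ d k (ℕₚ.<⇒≢ l′)) (proj₂ monic k l′))
      ... | inj₂ refl = trans (coeff-minus (xpow d) ψ d) (cong₂ ℤ._-_ (coeff-monomial 1ℤ d) (proj₁ monic))
    first-row : ∀ j → normMatrix X zero j ≡ ℤ.- coeff ψ (exponent j)
    first-row j = trans (at (≋-trans (remainder-cong (times-X e)) remainder-top) (exponent j))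
      (trans (coeff-minus (xpow d) ψ (exponent j)) (trans (cong (λ t → t ℤ.- coeff ψ (exponent j))
        (coeff-monomial-≢ 1ℤ d (exponent j) (λ q → ℕₚ.<⇒≢ (exponent-< j) (sym q)))) (ℤₚ.+-identityˡ (ℤ.- coeff ψ (exponent j)))))
    lower-rows : ∀ i c → normMatrix X (suc i) c ≡ δ (inject₁ i) c
    lower-rows i c = trans (at (≋-trans (remainder-cong (≋-trans (times-X (exponent (suc i))) (≋-reflexive (cong xpow next))))
      (remainder-id (xpow (exponent (inject₁ i))) (xpow-below (inject₁ i)))) (exponent c)) (coeff-xpow-δ (inject₁ i) c)
      where
      next : suc (e ∸ suc (toℕ i)) ≡ e ∸ toℕ (inject₁ i)
      next = trans (sym (ℕₚ.+-∸-assoc 1 {e} {suc (toℕ i)} (Finₚ.toℕ<n i))) (cong (e ∸_) (sym (Finₚ.toℕ-inject₁ i)))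

  -- A weak inequality suffices, for it identifies the norm with its absolute value, which is
  -- computed separately.
  norm-deriv-nonneg : 0ℤ ℤ.≤ coeff ψ 0 → 0ℤ ℤ.≤ norm (deriv ψ)
  norm-deriv-nonneg ψ0≥0 = subst (0ℤ ℤ.≤_) (sym value) (*-nonneg ψ0≥0 (square-nonneg (det (halfMatrix h h-even))))
    where
    h = tail (deriv ψ)
    deriv≋ : deriv ψ ≋ shiftX h
    at deriv≋ zero    = trans (coeff-deriv ψ 0) (trans (ℤₚ.*-identityˡ (coeff ψ 1)) (Even-odd-coeff ψ ψ-even 0))
    at deriv≋ (suc k) = sym (coeff-tail (deriv ψ) k)
    h-odd : ∀ j → coeff h (suc (j ℕ.* 2)) ≡ 0ℤ
    h-odd j = trans (coeff-tail (deriv ψ) (suc (j ℕ.* 2))) (trans (coeff-deriv ψ (suc j ℕ.* 2))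
      (trans (cong (+ suc (suc j ℕ.* 2) ℤ.*_) (Even-odd-coeff ψ ψ-even (suc j))) (ℤₚ.*-zeroʳ (+ suc (suc j ℕ.* 2)))))
    h-even : Even h
    at h-even = by-parity (coeff-reflect-even h) (λ j → trans (coeff-reflect-odd h j) (trans (cong ℤ.-_ (h-odd j)) (sym (h-odd j))))
    value : norm (deriv ψ) ≡ coeff ψ 0 ℤ.* (det (halfMatrix h h-even) ℤ.* det (halfMatrix h h-even))
    value = trans (norm-cong (≋-trans deriv≋ (shiftX≋X* h))) (trans (norm-* X h) (cong₂ ℤ._*_ norm-X (norm-even h h-even)))
    *-nonneg : ∀ {i j} → 0ℤ ℤ.≤ i → 0ℤ ℤ.≤ j → 0ℤ ℤ.≤ i ℤ.* j
    *-nonneg {+ i} {+ j} _ _ = subst (0ℤ ℤ.≤_) (ℤₚ.pos-* i j) (ℤ.+≤+ z≤n)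
    square-nonneg : ∀ i → 0ℤ ℤ.≤ i ℤ.* i
    square-nonneg (+ n)    = *-nonneg {+ n} {+ n} (ℤ.+≤+ z≤n) (ℤ.+≤+ z≤n)
    square-nonneg -[1+ n ] = ℤ.+≤+ z≤n

-- Divisors and fibotomic polynomials

module Ranges where

  -- Inductions on the bound peel off the largest index, whereas the list recurses at the front.
  range1-suc : ∀ K → range1 (suc K) ≡ range1 K ++ (suc K ∷ [])
  range1-suc K = trans (cong (map suc) (sym (Listₚ.upTo-∷ʳ K))) (Listₚ.map-++ suc (upTo K) (K ∷ []))

  module _ {P : Pred ℕ 0ℓ} (P? : Decidable P) where

    filter-range-yes : ∀ K → P (suc K) → filter P? (range1 (suc K)) ≡ filter P? (range1 K) ++ (suc K ∷ [])
    filter-range-yes K p = trans (cong (filter P?) (range1-suc K))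
      (trans (Listₚ.filter-++ P? (range1 K) (suc K ∷ [])) (cong (filter P? (range1 K) ++_) (Listₚ.filter-accept P? p)))

    filter-range-no : ∀ K → ¬ P (suc K) → filter P? (range1 (suc K)) ≡ filter P? (range1 K)
    filter-range-no K p = trans (cong (filter P?) (range1-suc K))
      (trans (Listₚ.filter-++ P? (range1 K) (suc K ∷ [])) (trans (cong (filter P? (range1 K) ++_) (Listₚ.filter-reject P? p)) (Listₚ.++-identityʳ _)))

module TotientSum where
  open import Data.Nat
  open import Data.Nat.Properties
  open import Data.Nat.Divisibility
  open import Data.Nat.GCD using (gcd; gcd[m,n]∣m; gcd[m,n]∣n; gcd[m,n]≢0; c*gcd[m,n]≡gcd[cm,cn])
  open Ranges
  open ≡-Reasoning

  sum1 : ℕ → (ℕ → ℕ) → ℕ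
  sum1 zero    f = 0
  sum1 (suc K) f = f (suc K) + sum1 K f

  -- Iverson brackets turn counting into sums whose order can be interchanged.
  [_] : ∀ {P : Set} → Dec P → ℕ
  [ yes _ ] = 1
  [ no  _ ] = 0

  []-cong : ∀ {P Q : Set} (P? : Dec P) (Q? : Dec Q) → (P → Q) → (Q → P) → [ P? ] ≡ [ Q? ]
  []-cong (yes p) (yes q) f g = refl
  []-cong (yes p) (no ¬q) f g = ⊥-elim (¬q (f p))
  []-cong (no ¬p) (yes q) f g = ⊥-elim (¬p (g q))
  []-cong (no ¬p) (no ¬q) f g = refl

  []-no : ∀ {P : Set} (P? : Dec P) → ¬ P → [ P? ] ≡ 0
  []-no (yes p) ¬p = ⊥-elim (¬p p)
  []-no (no _)  ¬p = refl

  []-yes : ∀ {P : Set} (P? : Dec P) → P → [ P? ] ≡ 1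
  []-yes (yes _) p = refl
  []-yes (no ¬p) p = ⊥-elim (¬p p)

  sum1-cong : ∀ K {f g} → (∀ i → 1 ≤ i → i ≤ K → f i ≡ g i) → sum1 K f ≡ sum1 K g
  sum1-cong zero    e = refl
  sum1-cong (suc K) e = cong₂ _+_ (e (suc K) (s≤s z≤n) ≤-refl) (sum1-cong K (λ i l u → e i l (m≤n⇒m≤1+n u)))

  sum1-zero : ∀ K {f} → (∀ i → 1 ≤ i → i ≤ K → f i ≡ 0) → sum1 K f ≡ 0
  sum1-zero zero    e = refl
  sum1-zero (suc K) e = cong₂ _+_ (e (suc K) (s≤s z≤n) ≤-refl) (sum1-zero K (λ i l u → e i l (m≤n⇒m≤1+n u)))

  sum1-+ : ∀ K f g → sum1 K (λ i → f i + g i) ≡ sum1 K f + sum1 K g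
  sum1-+ zero    f g = refl
  sum1-+ (suc K) f g rewrite sum1-+ K f g =
    solve 4 (λ a b c d → (a :+ b) :+ (c :+ d) := (a :+ c) :+ (b :+ d)) refl (f (suc K)) (g (suc K)) (sum1 K f) (sum1 K g)
    where open ℕ-Solver

  sum1-swap : ∀ K M (f : ℕ → ℕ → ℕ) → sum1 K (λ i → sum1 M (f i)) ≡ sum1 M (λ j → sum1 K (λ i → f i j))
  sum1-swap zero    M f = sym (sum1-zero M (λ _ _ _ → refl))
  sum1-swap (suc K) M f = trans (cong (λ t → sum1 M (f (suc K)) + t) (sum1-swap K M f)) (sym (sum1-+ M (f (suc K)) (λ j → sum1 K (λ i → f i j))))

  sum1-single : ∀ K f k → 1 ≤ k → k ≤ K → (∀ i → 1 ≤ i → i ≤ K → i ≢ k → f i ≡ 0) → sum1 K f ≡ f k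
  sum1-single zero f (suc k) 1≤k () z
  sum1-single (suc K) f k 1≤k k≤ z with m≤n⇒m<n∨m≡n k≤
  ... | inj₁ (s≤s k≤K) = cong₂ _+_ (z (suc K) (s≤s z≤n) ≤-refl (λ e → <⇒≢ (s≤s k≤K) (sym e)))
                           (sum1-single K f k 1≤k k≤K (λ i l u → z i l (m≤n⇒m≤1+n u)))
  ... | inj₂ refl = trans (cong (λ t → f (suc K) + t) (sum1-zero K (λ i l u → z i l (m≤n⇒m≤1+n u) (<⇒≢ (s≤s u))))) (+-identityʳ _)

  sum1-extend : ∀ a j f → (∀ i → 1 ≤ i → i ≤ j → f (i + a) ≡ 0) → sum1 (j + a) f ≡ sum1 a f
  sum1-extend a zero    f z = refl
  sum1-extend a (suc j) f z = trans (cong (_+ sum1 (j + a) f) (z (suc j) (s≤s z≤n) ≤-refl))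
    (sum1-extend a j f (λ i l u → z i l (m≤n⇒m≤1+n u)))

  sum1-multiples : ∀ e d f → (∀ s → ¬ (suc e ∣ s) → f s ≡ 0) → sum1 (d * suc e) f ≡ sum1 d (λ t → f (t * suc e))
  sum1-multiples e zero    f z = refl
  sum1-multiples e (suc d) f z = cong (λ t → f (suc d * suc e) + t)
    (trans (sum1-extend (d * suc e) e f off) (sum1-multiples e d f z))
    where
    off : ∀ i → 1 ≤ i → i ≤ e → f (i + d * suc e) ≡ 0
    off i@(suc _) l u = z _ (λ e∣ → <⇒≱ (s≤s u) (∣⇒≤ (∣m+n∣m⇒∣n (subst (suc e ∣_) (+-comm i (d * suc e)) e∣) (n∣m*n d))))

  φ-sum1 : ∀ n → φ n ≡ sum1 n (λ s → [ coprime? s n ])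
  φ-sum1 n = go n
    where
    P? : Decidable (λ s → Coprime s n)
    P? s = coprime? s n
    go : ∀ K → length (filter P? (range1 K)) ≡ sum1 K (λ s → [ P? s ])
    go zero = refl
    go (suc K) with P? (suc K)
    ... | yes p = trans (cong length (filter-range-yes P? K p)) (trans (Listₚ.length-++ (filter P? (range1 K)))
                    (trans (+-comm _ 1) (cong suc (go K))))
    ... | no ¬p = trans (cong length (filter-range-no P? K ¬p)) (go K)

  -- The truncation at K parallels the partial products `Φ n K`, whose degrees it records.
  divisorTotients : ℕ → ℕ → ℕ
  divisorTotients n zero    = 0
  divisorTotients n (suc K) with suc K ∣? n
  ... | yes _ = φ (suc K) + divisorTotients n K
  ... | no  _ = divisorTotients n K

  -- The s with gcd(s,n) = n/d are the multiples of n/d by numbers t ≤ d coprime to d. Writing the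
  -- condition as gcd(s,n) d = n avoids division.
  φ-count : ∀ d e → φ (suc d) ≡ sum1 (suc d * suc e) (λ s → [ gcd s (suc d * suc e) * suc d ≟ suc d * suc e ])
  φ-count d₁ e = sym (begin
    sum1 n (λ s → [ gcd s n * d ≟ n ])                       ≡⟨ sum1-multiples e d _ (λ s ¬e∣s → []-no (gcd s n * d ≟ n) (¬e∣s ∘ e∣ s)) ⟩
    sum1 d (λ t → [ gcd (t * suc e) n * d ≟ n ])             ≡⟨ sum1-cong d (λ t _ _ → []-cong (gcd (t * suc e) n * d ≟ n) (coprime? t d) (to t) (from t)) ⟩
    sum1 d (λ t → [ coprime? t d ])                          ≡⟨ φ-sum1 d ⟨
    φ d                                                      ∎)
    where
    d = suc d₁
    n = d * suc e
    e∣ : ∀ s → gcd s n * d ≡ n → suc e ∣ s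
    e∣ s eq = subst (_∣ s) (*-cancelʳ-≡ (gcd s n) (suc e) d (trans eq (*-comm d (suc e)))) (gcd[m,n]∣m s n)
    gcd-scaled : ∀ t → gcd (t * suc e) n ≡ suc e * gcd t d
    gcd-scaled t = trans (cong₂ gcd (*-comm t (suc e)) (*-comm d (suc e))) (sym (c*gcd[m,n]≡gcd[cm,cn] (suc e) t d))
    to : ∀ t → gcd (t * suc e) n * d ≡ n → Coprime t d
    to t eq = gcd≡1⇒coprime (*-cancelˡ-≡ (gcd t d) 1 (suc e) (*-cancelʳ-≡ (suc e * gcd t d) (suc e * 1) d
      (trans (cong (_* d) (sym (gcd-scaled t))) (trans eq (trans (*-comm d (suc e)) (cong (_* d) (sym (*-identityʳ (suc e)))))))))
    from : ∀ t → Coprime t d → gcd (t * suc e) n * d ≡ n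
    from t c = trans (cong (_* d) (trans (gcd-scaled t) (trans (cong (suc e *_) (coprime⇒gcd≡1 c)) (*-identityʳ (suc e))))) (*-comm (suc e) d)

  -- Double counting of the pairs (d, s) with gcd(s,n) d = n: every s belongs to exactly one d, and
  -- every divisor d to φ(d) values of s.
  totient-sum : ∀ n → 1 ≤ n → divisorTotients n n ≡ n
  totient-sum n@(suc _) _ = begin
    divisorTotients n n                                               ≡⟨ expand n ⟩
    sum1 n (λ d → sum1 n (λ s → [ gcd s n * d ≟ n ]))                 ≡⟨ sum1-swap n n (λ d s → [ gcd s n * d ≟ n ]) ⟩
    sum1 n (λ s → sum1 n (λ d → [ gcd s n * d ≟ n ]))                 ≡⟨ sum1-cong n (λ s _ _ → one s) ⟩
    sum1 n (λ _ → 1)                                                  ≡⟨ ones n ⟩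
    n                                                                 ∎
    where
    ones : ∀ K → sum1 K (λ _ → 1) ≡ K
    ones zero    = refl
    ones (suc K) = cong suc (ones K)
    expand : ∀ K → divisorTotients n K ≡ sum1 K (λ d → sum1 n (λ s → [ gcd s n * d ≟ n ]))
    expand zero = refl
    expand (suc K) with suc K ∣? n
    ... | yes (divides zero ())
    ... | yes (divides (suc e) eq) = cong₂ _+_ (trans (φ-count K e) (cong (λ m → sum1 m (λ s → [ gcd s m * suc K ≟ m ])) (trans (*-comm (suc K) (suc e)) (sym eq)))) (expand K)
    ... | no ∤n = trans (expand K) (cong (_+ sum1 K (λ d → sum1 n (λ s → [ gcd s n * d ≟ n ])))
                    (sym (sum1-zero n (λ s _ _ → []-no (gcd s n * suc K ≟ n) (λ eq → ∤n (divides (gcd s n) (sym eq)))))))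
    one : ∀ s → sum1 n (λ d → [ gcd s n * d ≟ n ]) ≡ 1
    one s with gcd[m,n]∣n s n
    ... | divides k eq = trans (sum1-single n _ k 1≤k k≤n others) ([]-yes (gcd s n * k ≟ n) (trans (*-comm (gcd s n) k) (sym eq)))
      where
      g≢0 : gcd s n ≢ 0
      g≢0 = gcd[m,n]≢0 s n (inj₂ (λ ()))
      1≤k : 1 ≤ k
      1≤k = n≢0⇒n>0 (λ { refl → case0 eq })
        where
        case0 : n ≢ 0
        case0 ()
      k≤n : k ≤ n
      k≤n = ∣⇒≤ (divides (gcd s n) (trans eq (*-comm k (gcd s n))))
      others : ∀ i → 1 ≤ i → i ≤ n → i ≢ k → [ gcd s n * i ≟ n ] ≡ 0
      others i _ _ i≢k = []-no (gcd s n * i ≟ n) (λ eq′ → i≢k (*-cancelˡ-≡ i k (gcd s n) {{≢-nonZero g≢0}} (trans eq′ (trans eq (*-comm k (gcd s n))))))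

module SignAndOrder where
  open import Data.Nat using (_≤_)
  open import Data.Nat.Divisibility using (_∣_; _∣?_; divides)
  open Zx using (coeff; const; oneₚ; shiftX)
  open PolynomialRing
  open Monomials
  open Reflection
  open FibonacciPolynomials
  open TotientSum using ([_]; []-yes; []-no)
  open Homogenization using (const-0; const-·-*; xpow-+)
  open CommutativeRing ℤ[x] using (_+_; _*_; _-_; -_; +-congˡ; +-congʳ; +-cong; *-congˡ; *-congʳ; *-cong; -‿cong; setoid; *-assoc; *-identityˡ)
    renaming (refl to ≋-refl; sym to ≋-sym; trans to ≋-trans; reflexive to ≋-reflexive)
  open IntegerSolver ℤ[x] using (solve; con; _:+_; _:*_; _:-_; :-_; _:=_)

  -- The sign is only asked to square to 1, a condition that passes to products and quotients
  -- without distinguishing cases.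
  EvenOrOdd : ℤ[X] → Set
  EvenOrOdd p = ∃[ ε ] ε ℤ.* ε ≡ 1ℤ × reflect p ≋ const ε * p

  EvenOrOdd-cong : ∀ {p q} → p ≋ q → EvenOrOdd p → EvenOrOdd q
  EvenOrOdd-cong {p} {q} e (ε , s , r) = ε , s , ≋-trans (reflect-cong (≋-sym e)) (≋-trans r (*-congˡ {const ε} e))

  EvenOrOdd-one : EvenOrOdd oneₚ
  EvenOrOdd-one = 1ℤ , refl , ≋-sym (*-identityˡ oneₚ)

  sign-square : ∀ a b → a ℤ.* a ≡ 1ℤ → b ℤ.* b ≡ 1ℤ → (a ℤ.* b) ℤ.* (a ℤ.* b) ≡ 1ℤ
  sign-square a b e e′ = trans (S.solve 2 (λ a b → (a S.:* b) S.:* (a S.:* b) S.:= (a S.:* a) S.:* (b S.:* b)) refl a b) (cong₂ ℤ._*_ e e′)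
    where module S = ℤ-Solver

  EvenOrOdd-* : ∀ {p q} → EvenOrOdd p → EvenOrOdd q → EvenOrOdd (p * q)
  EvenOrOdd-* {p} {q} (a , sa , ra) (b , sb , rb) = a ℤ.* b , sign-square a b sa sb ,
    ≋-trans (reflect-* p q) (≋-trans (*-cong ra rb)
      (≋-trans (solve 4 (λ a b p q → (a :* p) :* (b :* q) := (a :* b) :* (p :* q)) ≋-refl (const a) (const b) p q)
        (*-congʳ {p * q} (const-·-* a b))))

  EvenOrOdd-quotient : ∀ p q d → Monic p d → EvenOrOdd p → EvenOrOdd (p * q) → EvenOrOdd q
  EvenOrOdd-quotient p q d m (a , sa , ra) (b , sb , rb) = a ℤ.* b , sign-square a b sa sb ,
    Monic-cancel p (reflect q) (const (a ℤ.* b) * q) d m (begin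
      p * reflect q                                  ≈⟨ *-congʳ {reflect q} (≋-sym (*-identityˡ p)) ⟩
      oneₚ * p * reflect q                           ≡⟨ cong (λ t → const t * p * reflect q) (sym sa) ⟩
      const (a ℤ.* a) * p * reflect q                ≈⟨ *-congʳ {reflect q} (*-congʳ {p} (≋-sym (const-·-* a a))) ⟩
      const a * const a * p * reflect q              ≈⟨ solve 3 (λ a p r → a :* a :* p :* r := a :* ((a :* p) :* r)) ≋-refl (const a) p (reflect q) ⟩
      const a * ((const a * p) * reflect q)          ≈⟨ *-congˡ {const a} (*-congʳ {reflect q} (≋-sym ra)) ⟩
      const a * (reflect p * reflect q)              ≈⟨ *-congˡ {const a} (≋-trans (≋-sym (reflect-* p q)) rb) ⟩
      const a * (const b * (p * q))                  ≈⟨ solve 4 (λ a b p q → a :* (b :* (p :* q)) := p :* (a :* b :* q)) ≋-refl (const a) (const b) p q ⟩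
      p * (const a * const b * q)                    ≈⟨ *-congˡ {p} (*-congʳ {q} (const-·-* a b)) ⟩
      p * (const (a ℤ.* b) * q)                      ∎)
    where open Relation.Binary.Reasoning.Setoid setoid

  -- The sign (-1)^(n-1), because F_n has the parity of n - 1; starting with -1 at n = 0 puts F_0 =
  -- 0 into the same alternation.
  F-sign : ℕ → ℤ
  F-sign zero    = -1ℤ
  F-sign (suc n) = -1ℤ ℤ.* F-sign n

  reflect-F : ∀ n → reflect (F n) ≋ const (F-sign n) * F n × reflect (F (suc n)) ≋ const (F-sign (suc n)) * F (suc n)
  reflect-F zero = (coeffwise λ { zero → refl ; (suc k) → refl }) , ≋-sym (*-identityˡ oneₚ)
  reflect-F (suc n) = proj₂ (reflect-F n) , (begin
    reflect (shiftX (F (suc n)) + F n)              ≈⟨ reflect-+ (shiftX (F (suc n))) (F n) ⟩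
    reflect (shiftX (F (suc n))) + reflect (F n)    ≈⟨ +-cong (≋-trans (reflect-∷ 0ℤ (F (suc n))) (+-cong const-0 (-‿cong (*-congˡ {X} (proj₂ (reflect-F n)))))) (proj₁ (reflect-F n)) ⟩
    ([] - X * (const (-1ℤ ℤ.* s) * F (suc n))) + const s * F n
      ≈⟨ +-congʳ {const s * F n} (+-congˡ {[]} (-‿cong (*-congˡ {X} (*-congʳ {F (suc n)} (≋-sym (const-·-* -1ℤ s)))))) ⟩
    ([] - X * (const -1ℤ * const s * F (suc n))) + const s * F n
      ≈⟨ solve 4 (λ x s f g → (con (+ 0) :- x :* (con -1ℤ :* s :* f)) :+ s :* g := con -1ℤ :* (con -1ℤ :* s) :* (x :* f :+ g)) ≋-refl X (const s) (F (suc n)) (F n) ⟩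
    const -1ℤ * (const -1ℤ * const s) * (X * F (suc n) + F n)
      ≈⟨ *-cong (≋-trans (*-congˡ {const -1ℤ} (const-·-* -1ℤ s)) (const-·-* -1ℤ (-1ℤ ℤ.* s))) (≋-sym (F-suc n)) ⟩
    const (-1ℤ ℤ.* (-1ℤ ℤ.* s)) * F (suc (suc n))   ∎)
    where
    open Relation.Binary.Reasoning.Setoid setoid
    s = F-sign n

  EvenOrOdd-F : ∀ n → EvenOrOdd (F n)
  EvenOrOdd-F n = F-sign n , square n , proj₁ (reflect-F n)
    where
    square : ∀ n → F-sign n ℤ.* F-sign n ≡ 1ℤ
    square zero    = refl
    square (suc n) = sign-square -1ℤ (F-sign n) refl (square n)

  -- Reflection fixes the constant term, so a nonzero one forces ε = 1.
  EvenOrOdd⇒Even : ∀ {p} → EvenOrOdd p → 0ℤ ℤ.< coeff p 0 → Even p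
  EvenOrOdd⇒Even {p} (ε , _ , r) pos = ≋-trans r (≋-trans (*-congʳ {p} (≋-reflexive (cong const ε≡1))) (*-identityˡ p))
    where
    c = coeff p 0
    ε≡1 : ε ≡ 1ℤ
    ε≡1 = ℤₚ.*-cancelʳ-≡ ε 1ℤ c {{ℤ.≢-nonZero (λ e → ℤₚ.<⇒≢ pos (sym e))}} (trans (sym (coeff-scale ε p 0))
      (trans (sym (at (const-* ε p) 0)) (trans (sym (at r 0)) (trans (coeff-reflect-even p 0) (sym (ℤₚ.*-identityˡ c))))))

  -- Order of vanishing at 0 together with a positive lowest coefficient. Evaluation at 0 alone
  -- would not yield the sign of Ψ_n(0), since F_n vanishes at 0 for even n.
  Order : ℕ → ℤ[X] → Set
  Order k p = ∃[ p′ ] p ≋ xpow k * p′ × 0ℤ ℤ.< coeff p′ 0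

  coeff₀-* : ∀ p q → coeff (p * q) 0 ≡ coeff p 0 ℤ.* coeff q 0
  coeff₀-* []      q = refl
  coeff₀-* (a ∷ p) q = coeff-*-zero a p q

  pos-* : ∀ {a b} → 0ℤ ℤ.< a → 0ℤ ℤ.< b → 0ℤ ℤ.< a ℤ.* b
  pos-* {+ suc a} {+ suc b} _ _ = ℤ.+<+ (s≤s z≤n)
  pos-* {+ zero}  (ℤ.+<+ ())
  pos-* {+ suc a} {+ zero} _ (ℤ.+<+ ())

  pos-cancel : ∀ a b → 0ℤ ℤ.< a → 0ℤ ℤ.< a ℤ.* b → 0ℤ ℤ.< b
  pos-cancel (+ zero)  b         (ℤ.+<+ ()) _
  pos-cancel (+ suc a) (+ suc b) _ _ = ℤ.+<+ (s≤s z≤n)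
  pos-cancel (+ suc a) (+ zero)  _ p = ⊥-elim (ℤₚ.<-irrefl refl (subst (0ℤ ℤ.<_) (ℤₚ.*-zeroʳ (+ suc a)) p))
  pos-cancel (+ suc a) -[1+ b ]  _ ()

  Order-cong : ∀ {k p q} → p ≋ q → Order k p → Order k q
  Order-cong e (p′ , ep , pos) = p′ , ≋-trans (≋-sym e) ep , pos

  Order-zero : ∀ {p} → 0ℤ ℤ.< coeff p 0 → Order 0 p
  Order-zero {p} pos = p , ≋-sym (*-identityˡ p) , pos

  Order-* : ∀ {a b p q} → Order a p → Order b q → Order (a ℕ.+ b) (p * q)
  Order-* {a} {b} {p} {q} (p′ , ep , pp) (q′ , eq , pq) = p′ * q′ ,
    ≋-trans (*-cong ep eq) (≋-trans (solve 4 (λ x p y q → (x :* p) :* (y :* q) := (x :* y) :* (p :* q)) ≋-refl (xpow a) p′ (xpow b) q′)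
      (*-congʳ {p′ * q′} (≋-sym (xpow-+ a b)))) ,
    subst (0ℤ ℤ.<_) (sym (coeff₀-* p′ q′)) (pos-* pp pq)

  Order-quotient : ∀ {a p} q → Order a p → Order a (p * q) → 0ℤ ℤ.< coeff q 0
  Order-quotient {a} {p} q (p′ , ep , pp) (r , er , pr) = pos-cancel (coeff p′ 0) (coeff q 0) pp
    (subst (0ℤ ℤ.<_) (trans (at same 0) (coeff₀-* p′ q)) pr)
    where
    same : r ≋ p′ * q
    same = Monic-cancel (xpow a) r (p′ * q) a (Monic-xpow a)
      (≋-trans (≋-sym er) (≋-trans (*-congʳ {q} ep) (*-assoc (xpow a) p′ q)))

  coeff₀-F-even : ∀ j → coeff (F (j ℕ.* 2)) 0 ≡ 0ℤ
  coeff₀-F-even zero    = refl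
  coeff₀-F-even (suc j) = trans (coeff-+ (shiftX (F (suc (j ℕ.* 2)))) (F (j ℕ.* 2)) 0) (trans (ℤₚ.+-identityˡ _) (coeff₀-F-even j))

  coeff₀-F-odd : ∀ j → coeff (F (suc (j ℕ.* 2))) 0 ≡ 1ℤ
  coeff₀-F-odd zero    = refl
  coeff₀-F-odd (suc j) = trans (coeff-+ (shiftX (F (suc (suc (j ℕ.* 2))))) (F (suc (j ℕ.* 2))) 0)
    (trans (ℤₚ.+-identityˡ _) (coeff₀-F-odd j))

  coeff₁-F-even : ∀ j → coeff (F (j ℕ.* 2)) 1 ≡ + j
  coeff₁-F-even zero    = refl
  coeff₁-F-even (suc j) = trans (coeff-+ (shiftX (F (suc (j ℕ.* 2)))) (F (j ℕ.* 2)) 1) (cong₂ ℤ._+_ (coeff₀-F-odd j) (coeff₁-F-even j))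

  -- The lowest term of F_n is 1 for odd n and (n/2) x for even n.
  Order-F : ∀ n → 1 ≤ n → Order [ 2 ∣? n ] (F n)
  Order-F n 1≤n with parity n
  ... | zero  , inj₁ refl = ⊥-elim (ℕₚ.<⇒≢ 1≤n refl)
  ... | suc j , inj₁ refl = subst (λ k → Order k (F (suc j ℕ.* 2))) (sym ([]-yes (2 ∣? suc j ℕ.* 2) (divides (suc j) refl)))
    (tail f , ≋-trans split (shiftX≋X* (tail f)) , subst (0ℤ ℤ.<_) (sym (trans (coeff-tail f 0) (coeff₁-F-even (suc j)))) (ℤ.+<+ (s≤s z≤n)))
    where
    f = F (suc j ℕ.* 2)
    split : f ≋ shiftX (tail f)
    at split zero    = coeff₀-F-even (suc j)
    at split (suc k) = sym (coeff-tail f k)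
  ... | j , inj₂ refl = subst (λ k → Order k (F (suc (j ℕ.* 2)))) (sym ([]-no (2 ∣? suc (j ℕ.* 2)) odd))
    (Order-zero {F (suc (j ℕ.* 2))} (subst (0ℤ ℤ.<_) (sym (coeff₀-F-odd j)) (ℤ.+<+ (s≤s z≤n))))
    where
    odd : ¬ (2 ∣ suc (j ℕ.* 2))
    odd (divides q e) = ℕₚ.even≢odd q j (trans (ℕₚ.*-comm 2 q) (trans (sym e) (cong suc (ℕₚ.*-comm j 2))))

module DivisorProducts (Ψ : ℕ → ℤ[X]) (fibotomic : IsFibotomic Ψ) where
  open import Data.Nat using (_≤_)
  open import Data.Nat.Divisibility using (_∣_; _∣?_; ∣-refl; 1∣_)
  open Zx using (oneₚ; prodₚ)
  open PolynomialRing
  open FibonacciPolynomials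
  open SignAndOrder
  open Ranges
  open TotientSum using ([_]; divisorTotients; totient-sum)
  open CommutativeRing ℤ[x] using (_+_; _*_; *-congˡ; *-congʳ; *-assoc; *-identityˡ; *-comm)
    renaming (sym to ≋-sym; trans to ≋-trans; reflexive to ≋-reflexive)

  -- A partial product of the factorization of F_n: K = n gives F_n itself, and K = n - 1 the
  -- cofactor T of Ψ_n.
  Φ : ℕ → ℕ → ℤ[X]
  Φ n K = prodₚ (map Ψ (filter (λ d → d ∣? n) (range1 K)))

  prod-snoc : ∀ l x → prodₚ (map Ψ (l ++ (x ∷ []))) ≋ prodₚ (map Ψ l) * Ψ x
  prod-snoc []      x = *-comm (Ψ x) oneₚ
  prod-snoc (y ∷ l) x = ≋-trans (*-congˡ {Ψ y} (prod-snoc l x)) (≋-sym (*-assoc (Ψ y) (prodₚ (map Ψ l)) (Ψ x)))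

  Φ-yes : ∀ n K → suc K ∣ n → Φ n (suc K) ≋ Φ n K * Ψ (suc K)
  Φ-yes n K d = ≋-trans (≋-reflexive (cong (λ l → prodₚ (map Ψ l)) (filter-range-yes (λ d → d ∣? n) K d)))
    (prod-snoc (filter (λ d → d ∣? n) (range1 K)) (suc K))

  Φ-no : ∀ n K → ¬ (suc K ∣ n) → Φ n (suc K) ≋ Φ n K
  Φ-no n K ¬d = ≋-reflexive (cong (λ l → prodₚ (map Ψ l)) (filter-range-no (λ d → d ∣? n) K ¬d))

  Ψ-1 : Ψ 1 ≋ oneₚ
  Ψ-1 = coeffwise (proj₁ fibotomic)

  F-factor : ∀ n → F (suc n) ≋ Φ (suc n) n * Ψ (suc n)
  F-factor n = ≋-trans (coeffwise (proj₂ fibotomic (suc n) (s≤s z≤n))) (Φ-yes (suc n) n ∣-refl)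

  Φ-1 : ∀ n → Φ n 1 ≋ oneₚ
  Φ-1 n = ≋-trans (Φ-yes n 0 (1∣ n)) (≋-trans (*-identityˡ (Ψ 1)) Ψ-1)

  Ψ-2 : Ψ 2 ≋ X
  Ψ-2 = ≋-sym (≋-trans (≋-trans F2 (F-factor 1)) (≋-trans (*-congʳ {Ψ 2} (Φ-1 2)) (*-identityˡ (Ψ 2))))
    where
    F2 : X ≋ F 2
    at F2 zero          = refl
    at F2 (suc zero)    = refl
    at F2 (suc (suc k)) = refl

  -- Exceptional values: Ψ_1 = 1 has degree 0 although φ(1) = 1, and only Ψ_2 = x vanishes at 0.
  degree order : ℕ → ℕ
  degree 1 = 0
  degree n = φ n
  order 2 = 1
  order n = 0

  record Facts (n : ℕ) : Set where
    field
      Ψ-monic : Monic (Ψ n) (degree n)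
      Ψ-evenOrOdd : EvenOrOdd (Ψ n)
      Ψ-order : Order (order n) (Ψ n)
  open Facts

  Φ-order : ℕ → ℕ → ℕ
  Φ-order n (suc (suc K)) = [ 2 ∣? n ]
  Φ-order n _             = 0

  module _ (N : ℕ) (facts : ∀ d → 1 ≤ d → d ≤ N → Facts d) where

    Φ-evenOrOdd : ∀ n K → K ≤ N → EvenOrOdd (Φ n K)
    Φ-evenOrOdd n zero    _   = EvenOrOdd-one
    Φ-evenOrOdd n (suc K) K<N with suc K ∣? n
    ... | yes d = EvenOrOdd-cong {Φ n K * Ψ (suc K)} (≋-sym (Φ-yes n K d))
                    (EvenOrOdd-* {Φ n K} {Ψ (suc K)} (Φ-evenOrOdd n K (ℕₚ.<⇒≤ K<N)) (Ψ-evenOrOdd (facts (suc K) (s≤s z≤n) K<N)))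
    ... | no ¬d = EvenOrOdd-cong {Φ n K} (≋-sym (Φ-no n K ¬d)) (Φ-evenOrOdd n K (ℕₚ.<⇒≤ K<N))

    -- The degree is one less than the totient sum, which counts φ(1) = 1 for the constant Ψ_1.
    Φ-monic : ∀ n K → suc K ≤ N → 1 ≤ divisorTotients n (suc K) × Monic (Φ n (suc K)) (divisorTotients n (suc K) ∸ 1)
    Φ-monic n zero _ with 1 ∣? n
    ... | yes _ = s≤s z≤n , Monic-cong {oneₚ} (≋-sym (Φ-1 n)) (refl , λ { (suc k) _ → refl })
    ... | no ¬d = ⊥-elim (¬d (1∣ n))
    Φ-monic n (suc K) K<N with suc (suc K) ∣? n | Φ-monic n K (ℕₚ.<⇒≤ K<N)
    ... | yes d | 1≤ , m = ℕₚ.≤-trans 1≤ (ℕₚ.m≤n+m _ (φ (suc (suc K)))) ,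
      Monic-cong {Φ n (suc K) * Ψ (suc (suc K))} (≋-sym (Φ-yes n (suc K) d))
        (subst (Monic (Φ n (suc K) * Ψ (suc (suc K))))
          (trans (ℕₚ.+-comm (divisorTotients n (suc K) ∸ 1) (φ (suc (suc K)))) (sym (ℕₚ.+-∸-assoc (φ (suc (suc K))) 1≤)))
          (Monic-* (Φ n (suc K)) (Ψ (suc (suc K))) (divisorTotients n (suc K) ∸ 1) (φ (suc (suc K))) m (Ψ-monic (facts (suc (suc K)) (s≤s z≤n) K<N))))
    ... | no ¬d | 1≤ , m = 1≤ , Monic-cong {Φ n (suc K)} (≋-sym (Φ-no n (suc K) ¬d)) m

    Φ-hasOrder : ∀ n K → K ≤ N → Order (Φ-order n K) (Φ n K)
    Φ-hasOrder n zero       _ = Order-zero {oneₚ} (ℤ.+<+ (s≤s z≤n))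
    Φ-hasOrder n (suc zero) _ = Order-cong {0} {oneₚ} {Φ n 1} (≋-sym (Φ-1 n)) (Order-zero {oneₚ} (ℤ.+<+ (s≤s z≤n)))
    Φ-hasOrder n (suc (suc zero)) 2≤N with 2 ∣? n | Φ-hasOrder n 1 (ℕₚ.<⇒≤ 2≤N)
    ... | yes d | o = Order-cong {1} {Φ n 1 * Ψ 2} (≋-sym (Φ-yes n 1 d)) (Order-* {0} {1} {Φ n 1} {Ψ 2} o (Ψ-order (facts 2 (s≤s z≤n) 2≤N)))
    ... | no ¬d | o = Order-cong {0} {Φ n 1} (≋-sym (Φ-no n 1 ¬d)) o
    Φ-hasOrder n (suc (suc (suc K))) K<N with suc (suc (suc K)) ∣? n | Φ-hasOrder n (suc (suc K)) (ℕₚ.<⇒≤ K<N)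
    ... | yes d | o = Order-cong {[ 2 ∣? n ]} {Φ n (suc (suc K)) * Ψ (suc (suc (suc K)))} (≋-sym (Φ-yes n (suc (suc K)) d))
                        (subst (λ k → Order k (Φ n (suc (suc K)) * Ψ (suc (suc (suc K))))) (ℕₚ.+-identityʳ [ 2 ∣? n ])
                          (Order-* {[ 2 ∣? n ]} {0} {Φ n (suc (suc K))} {Ψ (suc (suc (suc K)))} o (Ψ-order (facts (suc (suc (suc K))) (s≤s z≤n) K<N))))
    ... | no ¬d | o = Order-cong {[ 2 ∣? n ]} {Φ n (suc (suc K))} (≋-sym (Φ-no n (suc (suc K)) ¬d)) o

  divisorTotients-self : ∀ N → divisorTotients (suc N) (suc N) ≡ φ (suc N) ℕ.+ divisorTotients (suc N) N
  divisorTotients-self N with suc N ∣? suc N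
  ... | yes _ = refl
  ... | no ¬d = ⊥-elim (¬d ∣-refl)

  -- Ψ_n is the quotient of F_n by the product of the earlier factors, and degree, parity and order
  -- at 0 are known for both and pass to the quotient. Only the order of Ψ_2 is read off directly.
  facts-step : ∀ N → (∀ d → 1 ≤ d → d ≤ suc N → Facts d) → Facts (suc (suc N))
  facts-step N facts = record
    { Ψ-monic = Monic-quotient (Φ n (suc N)) (Ψ n) (S ∸ 1) (φ n) Φ-monic′
        (Monic-cong {F n} (F-factor (suc N)) (subst (Monic (F n)) degrees (F-monic (suc N))))
    ; Ψ-evenOrOdd = EvenOrOdd-quotient (Φ n (suc N)) (Ψ n) (S ∸ 1) Φ-monic′ (Φ-evenOrOdd (suc N) facts n (suc N) ℕₚ.≤-refl)
        (EvenOrOdd-cong {F n} (F-factor (suc N)) (EvenOrOdd-F n))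
    ; Ψ-order = has-order N facts }
    where
    n = suc (suc N)
    S = divisorTotients n (suc N)
    Φ-monic′ : Monic (Φ n (suc N)) (S ∸ 1)
    Φ-monic′ = proj₂ (Φ-monic (suc N) facts n N ℕₚ.≤-refl)
    1≤S : 1 ≤ S
    1≤S = proj₁ (Φ-monic (suc N) facts n N ℕₚ.≤-refl)
    degrees : suc N ≡ S ∸ 1 ℕ.+ φ n
    degrees = ℕₚ.suc-injective (trans (sym (totient-sum n (s≤s z≤n))) (trans (divisorTotients-self (suc N))
      (trans (ℕₚ.+-comm (φ n) S) (cong (ℕ._+ φ n) (sym (ℕₚ.m+[n∸m]≡n 1≤S))))))
    has-order : ∀ N → (∀ d → 1 ≤ d → d ≤ suc N → Facts d) → Order (order (suc (suc N))) (Ψ (suc (suc N)))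
    has-order zero    facts = Order-cong {1} {X} (≋-sym Ψ-2) (oneₚ , ≋-sym (≋-trans (*-comm X oneₚ) (*-identityˡ X)) , ℤ.+<+ (s≤s z≤n))
    has-order (suc N) facts = Order-zero {Ψ (suc (suc (suc N)))} (Order-quotient {[ 2 ∣? suc (suc (suc N)) ]} {Φ (suc (suc (suc N))) (suc (suc N))} (Ψ (suc (suc (suc N))))
      (Φ-hasOrder (suc (suc N)) facts (suc (suc (suc N))) (suc (suc N)) ℕₚ.≤-refl)
      (Order-cong {[ 2 ∣? suc (suc (suc N)) ]} {F (suc (suc (suc N)))} (F-factor (suc (suc N))) (Order-F (suc (suc (suc N))) (s≤s z≤n))))

  facts-1 : Facts 1
  facts-1 = record
    { Ψ-monic = Monic-cong {oneₚ} (≋-sym Ψ-1) (refl , λ { (suc k) _ → refl })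
    ; Ψ-evenOrOdd = EvenOrOdd-cong {oneₚ} (≋-sym Ψ-1) EvenOrOdd-one
    ; Ψ-order = Order-cong {0} {oneₚ} (≋-sym Ψ-1) (Order-zero {oneₚ} (ℤ.+<+ (s≤s z≤n))) }

  facts-below : ∀ N d → 1 ≤ d → d ≤ N → Facts d
  facts-below zero (suc d) 1≤d ()
  facts-below (suc N) d 1≤d d≤ with ℕₚ.m≤n⇒m<n∨m≡n d≤
  ... | inj₁ (s≤s d≤N) = facts-below N d 1≤d d≤N
  facts-below (suc zero) .1 1≤d d≤ | inj₂ refl = facts-1
  facts-below (suc (suc N)) .(suc (suc N)) 1≤d d≤ | inj₂ refl = facts-step N (facts-below (suc N))

  facts : ∀ n → 1 ≤ n → Facts n
  facts n 1≤n = facts-below n n 1≤n ℕₚ.≤-refl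

-- Prime powers and their divisors

module PrimeArithmetic where
  open import Data.Nat
  open import Data.Nat.Properties
  open import Data.Nat.Divisibility
  open import Data.Nat.DivMod using (m/n*n≡m; m*n/n≡m)
  open import Data.Nat.Induction using (<-wellFounded; Acc; acc)
  open import Data.Nat.Primality using (prime⇒irreducible)
  open import Data.Nat.Primality.Factorisation using (PrimeFactorisation; factorise)

  prime≥2 : ∀ {p} → Prime p → 2 ≤ p
  prime≥2 {p} pr = nonTrivial⇒n>1 p {{prime⇒nonTrivial pr}}

  prime∣prime : ∀ {p q} → Prime p → Prime q → p ∣ q → p ≡ q
  prime∣prime pp pq p∣q with prime⇒irreducible pq p∣q
  ... | inj₁ p≡1 = ⊥-elim (<⇒≢ (prime≥2 pp) (sym p≡1))
  ... | inj₂ p≡q = p≡q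

  prime∣^ : ∀ {p} → Prime p → ∀ a x → p ∣ x ^ a → p ∣ x
  prime∣^ pr zero    x p∣1 = ⊥-elim (<⇒≢ (prime≥2 pr) (sym (∣1⇒≡1 p∣1)))
  prime∣^ pr (suc a) x p∣ with euclidsLemma x (x ^ a) pr p∣
  ... | inj₁ p∣x = p∣x
  ... | inj₂ p∣y = prime∣^ pr a x p∣y

  prime-divisor : ∀ n → 2 ≤ n → ∃[ p ] Prime p × p ∣ n
  prime-divisor n@(suc _) 2≤n = pick (factorise n)
    where
    pick : PrimeFactorisation n → ∃[ p ] Prime p × p ∣ n
    pick record { factors = [] ; isFactorisation = e } = ⊥-elim (<⇒≢ 2≤n (sym e))
    pick record { factors = p ∷ ps ; isFactorisation = e ; factorsPrime = pr ∷ _ } = p , pr , subst (p ∣_) (sym e) (m∣m*n (foldr _*_ 1 ps))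

  divisor-of-prime-power : ∀ {p} → Prime p → ∀ a x → x ∣ p ^ a → ∃[ e ] e ≤ a × x ≡ p ^ e
  divisor-of-prime-power pr zero    x x∣1 = 0 , z≤n , ∣1⇒≡1 x∣1
  divisor-of-prime-power {p} pr (suc a) x (divides y e) with euclidsLemma y x pr (divides (p ^ a) (trans (sym e) (*-comm p (p ^ a))))
  ... | inj₁ (divides y′ refl) = weaken (divisor-of-prime-power pr a x (divides y′ (*-cancelˡ-≡ (p ^ a) (y′ * x) p {{prime⇒nonZero pr}}
          (trans e (trans (*-assoc y′ p x) (trans (cong (y′ *_) (*-comm p x)) (trans (sym (*-assoc y′ x p)) (*-comm (y′ * x) p))))))))
    where
    weaken : ∃[ e ] e ≤ a × x ≡ p ^ e → ∃[ e ] e ≤ suc a × x ≡ p ^ e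
    weaken (e , l , q) = e , m≤n⇒m≤1+n l , q
  ... | inj₂ (divides x′ refl) = raise (divisor-of-prime-power pr a x′ (divides y (*-cancelˡ-≡ (p ^ a) (y * x′) p {{prime⇒nonZero pr}}
          (trans e (trans (sym (*-assoc y x′ p)) (*-comm (y * x′) p))))))
    where
    raise : ∃[ e ] e ≤ a × x′ ≡ p ^ e → ∃[ e ] e ≤ suc a × x′ * p ≡ p ^ e
    raise (e , l , refl) = suc e , s≤s l , *-comm (p ^ e) p

  coprime-powers : ∀ {p q} → Prime p → Prime q → p ≢ q → ∀ a b x → x ∣ p ^ a → x ∣ q ^ b → x ≡ 1
  coprime-powers pp pq p≢q a b x x∣p x∣q with divisor-of-prime-power pp a x x∣p
  ... | zero  , _ , e    = e
  ... | suc e , _ , refl = ⊥-elim (p≢q (prime∣prime pp pq (prime∣^ pp b _ (∣-trans (m∣m*n _) x∣q))))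

  ^-injectiveˡ : ∀ k x y → 1 ≤ k → x ^ k ≡ y ^ k → x ≡ y
  ^-injectiveˡ k x y 1≤k e with <-cmp x y
  ... | tri< l _ _ = ⊥-elim (<⇒≢ (^-monoˡ-< k {{>-nonZero 1≤k}} l) e)
  ... | tri≈ _ q _ = q
  ... | tri> _ _ l = ⊥-elim (<⇒≢ (^-monoˡ-< k {{>-nonZero 1≤k}} l) (sym e))

  ^-injectiveʳ : ∀ p a b → 2 ≤ p → p ^ a ≡ p ^ b → a ≡ b
  ^-injectiveʳ p a b 2≤p e with <-cmp a b
  ... | tri< l _ _ = ⊥-elim (<⇒≢ (^-monoʳ-< p 2≤p l) e)
  ... | tri≈ _ q _ = q
  ... | tri> _ _ l = ⊥-elim (<⇒≢ (^-monoʳ-< p 2≤p l) (sym e))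

  ∣^ : ∀ x k → 1 ≤ k → x ∣ x ^ k
  ∣^ x (suc k) _ = m∣m*n (x ^ k)

  divBy-* : ∀ n p → Prime p → p ∣ n → divBy n p * p ≡ n
  divBy-* n zero    pr _   = ⊥-elim (≢-nonZero⁻¹ 0 {{prime⇒nonZero pr}} refl)
  divBy-* n (suc k) pr p∣n = m/n*n≡m p∣n

  divBy-quotient : ∀ e k → 1 ≤ k → divBy (e * k) k ≡ e
  divBy-quotient e (suc k) _ = m*n/n≡m e (suc k)

  strip : ∀ p → Prime p → ∀ n → 1 ≤ n → ∃[ a ] ∃[ m ] n ≡ p ^ a * m × ¬ (p ∣ m)
  strip p pr n 1≤n = go n 1≤n (<-wellFounded n)
    where
    go : ∀ n → 1 ≤ n → Acc _<_ n → ∃[ a ] ∃[ m ] n ≡ p ^ a * m × ¬ (p ∣ m)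
    go n 1≤n (acc rec) with p ∣? n
    ... | no ∤n = 0 , n , sym (*-identityˡ n) , ∤n
    ... | yes (divides k refl) with go k 1≤k (rec (m<m*n k p {{>-nonZero 1≤k}} (prime≥2 pr)))
      where
      1≤k : 1 ≤ k
      1≤k = n≢0⇒n>0 (λ { refl → <⇒≢ 1≤n refl })
    ...   | a , m , e , ∤m = suc a , m , trans (cong (_* p) e) (trans (*-comm (p ^ a * m) p) (sym (*-assoc p (p ^ a) m))) , ∤m

  -- After all factors p are stripped from n, the rest is neither 0 nor 1, so it has a prime
  -- divisor, which differs from p.
  two-primes : ∀ n → 2 ≤ n → ¬ IsPrimePower n → ∃[ p ] ∃[ q ] Prime p × Prime q × p ≢ q × p ∣ n × q ∣ n
  two-primes n 2≤n npp with prime-divisor n 2≤n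
  ... | p , pp , p∣n with strip p pp n (<⇒≤ 2≤n)
  ...   | a , zero , e , ∤m = ⊥-elim (∤m (divides 0 refl))
  ...   | zero , suc zero , e , ∤m = ⊥-elim (<⇒≢ 2≤n (sym e))
  ...   | suc a , suc zero , e , ∤m = ⊥-elim (npp (p , suc a , pp , s≤s z≤n , trans e (*-identityʳ (p ^ suc a))))
  ...   | a , m@(suc (suc _)) , e , ∤m with prime-divisor m (s≤s (s≤s z≤n))
  ...     | q , pq , q∣m = p , q , pp , pq , (λ { refl → ∤m q∣m }) , p∣n , ∣-trans q∣m (divides (p ^ a) e)

module RangeProducts {P : Pred ℕ 0ℓ} (P? : Decidable P) where
  open import Data.Nat
  open import Data.Nat.Properties
  open Ranges

  rangeProduct : (ℕ → ℕ) → ℕ → ℕ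
  rangeProduct g K = prodℕ (map g (filter P? (range1 K)))

  prodℕ-snoc : ∀ (g : ℕ → ℕ) l x → prodℕ (map g (l ++ (x ∷ []))) ≡ prodℕ (map g l) * g x
  prodℕ-snoc g []      x = *-comm (g x) 1
  prodℕ-snoc g (y ∷ l) x = trans (cong (g y *_) (prodℕ-snoc g l x)) (sym (*-assoc (g y) (prodℕ (map g l)) (g x)))

  product-yes : ∀ g K → P (suc K) → rangeProduct g (suc K) ≡ rangeProduct g K * g (suc K)
  product-yes g K p = trans (cong (λ l → prodℕ (map g l)) (filter-range-yes P? K p)) (prodℕ-snoc g (filter P? (range1 K)) (suc K))

  product-no : ∀ g K → ¬ P (suc K) → rangeProduct g (suc K) ≡ rangeProduct g K
  product-no g K ¬p = cong (λ l → prodℕ (map g l)) (filter-range-no P? K ¬p)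

  product-cong : ∀ g h K → (∀ p → P p → p ≤ K → g p ≡ h p) → rangeProduct g K ≡ rangeProduct h K
  product-cong g h zero    e = refl
  product-cong g h (suc K) e with P? (suc K)
  ... | yes p = trans (product-yes g K p) (trans (cong₂ _*_ (product-cong g h K (λ q Pq l → e q Pq (m≤n⇒m≤1+n l))) (e (suc K) p ≤-refl)) (sym (product-yes h K p)))
  ... | no ¬p = trans (product-no g K ¬p) (trans (product-cong g h K (λ q Pq l → e q Pq (m≤n⇒m≤1+n l))) (sym (product-no h K ¬p)))

  product-* : ∀ g h K → rangeProduct (λ p → g p * h p) K ≡ rangeProduct g K * rangeProduct h K
  product-* g h zero    = refl
  product-* g h (suc K) with P? (suc K)
  ... | yes p = trans (product-yes (λ p → g p * h p) K p) (trans (cong (_* (g (suc K) * h (suc K))) (product-* g h K))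
      (trans (solve 4 (λ a b x y → (a :* b) :* (x :* y) := (a :* x) :* (b :* y)) refl (rangeProduct g K) (rangeProduct h K) (g (suc K)) (h (suc K)))
        (sym (cong₂ _*_ (product-yes g K p) (product-yes h K p)))))
    where open ℕ-Solver
  ... | no ¬p = trans (product-no (λ p → g p * h p) K ¬p) (trans (product-* g h K) (sym (cong₂ _*_ (product-no g K ¬p) (product-no h K ¬p))))

  product-ones : ∀ g K → (∀ p → P p → p ≤ K → g p ≡ 1) → rangeProduct g K ≡ 1
  product-ones g zero    e = refl
  product-ones g (suc K) e with P? (suc K)
  ... | yes p = trans (product-yes g K p) (cong₂ _*_ (product-ones g K (λ q Pq l → e q Pq (m≤n⇒m≤1+n l))) (e (suc K) p ≤-refl))
  ... | no ¬p = trans (product-no g K ¬p) (product-ones g K (λ q Pq l → e q Pq (m≤n⇒m≤1+n l)))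

  product-single : ∀ g K k → P k → 1 ≤ k → k ≤ K → (∀ p → P p → p ≢ k → g p ≡ 1) → rangeProduct g K ≡ g k
  product-single g zero    (suc k) Pk _ () e
  product-single g (suc K) k Pk 1≤k k≤ e with m≤n⇒m<n∨m≡n k≤
  ... | inj₂ refl = trans (product-yes g K Pk) (trans (cong (_* g (suc K)) (product-ones g K (λ p Pp l → e p Pp (<⇒≢ (s≤s l))))) (*-identityˡ _))
  ... | inj₁ (s≤s k≤K) = trans (drop-last (P? (suc K))) (product-single g K k Pk 1≤k k≤K e)
    where
    drop-last : Dec (P (suc K)) → rangeProduct g (suc K) ≡ rangeProduct g K
    drop-last (yes p) = trans (product-yes g K p) (trans (cong (rangeProduct g K *_) (e (suc K) p (λ q → <⇒≢ (s≤s k≤K) (sym q)))) (*-identityʳ _))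
    drop-last (no ¬p) = product-no g K ¬p

open import Data.Nat using (_≤_; _^_; _/_; _+_)
open import Data.Integer using () renaming (+_ to ι)

-- Norms of the factors of F_n

module NormsOfFactors (Ψ : ℕ → ℤ[X]) (fibotomic : IsFibotomic Ψ) (N₀ : ℕ) where
  open import Data.Nat using (_<_)
  open import Data.Nat.Divisibility using (_∣_; _∣?_; divides; ∣⇒≤; ∣-trans; m∣m*n; n∣m*n; ∣m⇒∣m*n)
  open Zx using (oneₚ; deriv)
  open PolynomialRing
  open FibonacciPolynomials
  open DivisorProducts Ψ fibotomic
  open PrimeArithmetic
  open CommutativeRing ℤ[x] using (_*_; *-congʳ; *-assoc; *-comm; *-identityʳ)
    renaming (refl to ≋-refl; sym to ≋-sym; trans to ≋-trans; reflexive to ≋-reflexive)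
  open IntegerSolver ℤ[x] using (solve; _:*_; _:=_)

  N n d : ℕ
  N = suc N₀
  n = suc N
  d = φ n

  ψ : ℤ[X]
  ψ = Ψ n

  ψ-facts : Facts n
  ψ-facts = facts n (s≤s z≤n)

  monic : Monic ψ d
  monic = Facts.Ψ-monic ψ-facts

  open Norm ψ d monic
  open NormOfFibonacci ψ d monic using (W; norm-F-power; norm-w-power; norm-1)
  open NormOfDerivative ψ d monic n (Φ n N) (≋-trans (F-factor N) (*-comm (Φ n N) ψ)) using (abs-norm-*; norm-deriv)

  abs : ℤ[X] → ℕ
  abs p = ℤ.∣ norm p ∣

  abs-cong : ∀ {p q} → p ≋ q → abs p ≡ abs q
  abs-cong e = cong ℤ.∣_∣ (norm-cong e)

  Φ-multiple : ∀ m → m ∣ n → ∀ K → ∃[ H ] Φ n K ≋ Φ m K * H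
  Φ-multiple m m∣n zero = oneₚ , ≋-sym (*-identityʳ oneₚ)
  Φ-multiple m m∣n (suc K) = by-cases (suc K ∣? m) (suc K ∣? n)
    where
    H = proj₁ (Φ-multiple m m∣n K)
    e = proj₂ (Φ-multiple m m∣n K)
    by-cases : Dec (suc K ∣ m) → Dec (suc K ∣ n) → ∃[ H ] Φ n (suc K) ≋ Φ m (suc K) * H
    by-cases (yes dm) (yes dn) = H , ≋-trans (Φ-yes n K dn) (≋-trans (*-congʳ {Ψ (suc K)} e)
      (≋-trans (solve 3 (λ a h p → a :* h :* p := a :* p :* h) ≋-refl (Φ m K) H (Ψ (suc K))) (*-congʳ {H} (≋-sym (Φ-yes m K dm)))))
    by-cases (yes dm) (no ¬dn) = ⊥-elim (¬dn (∣-trans dm m∣n))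
    by-cases (no ¬dm) (yes dn) = H * Ψ (suc K) , ≋-trans (Φ-yes n K dn) (≋-trans (*-congʳ {Ψ (suc K)} e)
      (≋-trans (*-assoc (Φ m K) H (Ψ (suc K))) (*-congʳ {H * Ψ (suc K)} (≋-sym (Φ-no m K ¬dm)))))
    by-cases (no ¬dm) (no ¬dn) = H , ≋-trans (Φ-no n K ¬dn) (≋-trans e (*-congʳ {H} (≋-sym (Φ-no m K ¬dm))))

  Φ-beyond : ∀ m j → Φ (suc m) (j + suc m) ≋ Φ (suc m) (suc m)
  Φ-beyond m zero    = ≋-refl
  Φ-beyond m (suc j) = ≋-trans (Φ-no (suc m) (j + suc m) (λ div → ℕₚ.<⇒≱ (s≤s (ℕₚ.m≤n+m (suc m) j)) (∣⇒≤ div))) (Φ-beyond m j)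

  -- Bringing all proper divisors m to the common bound N allows their products to be compared index
  -- by index.
  F≋Φ : ∀ m → 1 ≤ m → m ≤ N → F m ≋ Φ m N
  F≋Φ (suc m) _ m≤N = ≋-trans (coeffwise (proj₂ fibotomic (suc m) (s≤s z≤n)))
    (≋-sym (≋-trans (≋-reflexive (cong (Φ (suc m)) (sym (ℕₚ.m∸n+n≡m m≤N)))) (Φ-beyond m (N ∸ suc m))))

  -- For a proper divisor m the factor ψ survives in F_n / F_m, which is the hypothesis under which
  -- the geometric sum vanishes modulo ψ.
  cofactor-F : ∀ m → m ∣ n → 1 ≤ m → m ≤ N → ∃[ H ] F n ≋ F m * (H * ψ)
  cofactor-F m m∣n 1≤m m≤N = H , ≋-trans (F-factor N) (≋-trans (*-congʳ {ψ} (≋-trans (proj₂ (Φ-multiple m m∣n N)) (*-congʳ {H} (≋-sym (F≋Φ m 1≤m m≤N)))))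
    (*-assoc (F m) H ψ))
    where H = proj₁ (Φ-multiple m m∣n N)

  quotient-bounds : ∀ m p → Prime p → n ≡ m ℕ.* p → 1 ≤ m × m ≤ N
  quotient-bounds zero    p pr ()
  quotient-bounds (suc m) p pr e = s≤s z≤n , ℕ.s≤s⁻¹ (subst (suc (suc m) ≤_) (sym e) (ℕₚ.m<m*n (suc m) p (prime≥2 pr)))

  Power : ℕ → ℕ → Set
  Power p m = (abs (F m) ℕ.* abs (F m) ℕ.* W) ^ (p ∸ 1) ≡ p ^ d ℕ.* p ^ d

  norm-powers : ∀ p m → Prime p → n ≡ m ℕ.* p →
    Power p m × (∀ j → m ≡ p ^ j → W ^ (m ℕ.* (p ∸ 1)) ≡ p ^ d ℕ.* p ^ d)
  norm-powers zero    m       pr e = ⊥-elim (ℕ.≢-nonZero⁻¹ 0 {{prime⇒nonZero pr}} refl)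
  norm-powers (suc k) zero    pr ()
  norm-powers (suc k) (suc m) pr e = norm-F-power m k (H * ψ) H pr eF ≋-refl , norm-w-power m k (H * ψ) H pr eF ≋-refl
    where
    bounds = quotient-bounds (suc m) (suc k) pr e
    cof = cofactor-F (suc m) (divides (suc k) (trans e (ℕₚ.*-comm (suc m) (suc k)))) (proj₁ bounds) (proj₂ bounds)
    H = proj₁ cof
    eF : F (suc m ℕ.* suc k) ≋ F (suc m) * (H * ψ)
    eF = ≋-trans (≋-reflexive (cong F (sym e))) (proj₂ cof)

  -- The contribution of d = K + 1 to the norm of F m.
  factorAt : ℕ → ℕ → ℕ
  factorAt m K with suc K ∣? m
  ... | yes _ = abs (Ψ (suc K))
  ... | no  _ = 1

  factorAt-yes : ∀ m K → suc K ∣ m → factorAt m K ≡ abs (Ψ (suc K))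
  factorAt-yes m K div with suc K ∣? m
  ... | yes _ = refl
  ... | no ¬d = ⊥-elim (¬d div)

  factorAt-no : ∀ m K → ¬ (suc K ∣ m) → factorAt m K ≡ 1
  factorAt-no m K ¬div with suc K ∣? m
  ... | yes div = ⊥-elim (¬div div)
  ... | no _ = refl

  abs-Φ-suc : ∀ m K → abs (Φ m (suc K)) ≡ abs (Φ m K) ℕ.* factorAt m K
  abs-Φ-suc m K with suc K ∣? m
  ... | yes div = trans (abs-cong (Φ-yes m K div)) (abs-norm-* (Φ m K) (Ψ (suc K)))
  ... | no ¬div = trans (abs-cong (Φ-no m K ¬div)) (sym (ℕₚ.*-identityʳ (abs (Φ m K))))

  abs-Φ-zero : ∀ m → abs (Φ m 0) ≡ 1
  abs-Φ-zero m = cong ℤ.∣_∣ norm-1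

  abs-Ψ∣abs-Φ : ∀ m e K → suc e ∣ m → suc e ≤ K → abs (Ψ (suc e)) ∣ abs (Φ m K)
  abs-Ψ∣abs-Φ m e (suc K) div (s≤s e≤K) = subst (abs (Ψ (suc e)) ∣_) (sym (abs-Φ-suc m K)) (go (ℕₚ.m≤n⇒m<n∨m≡n e≤K))
    where
    go : e < K ⊎ e ≡ K → abs (Ψ (suc e)) ∣ abs (Φ m K) ℕ.* factorAt m K
    go (inj₁ e<K)  = ∣m⇒∣m*n (factorAt m K) (abs-Ψ∣abs-Φ m e K div e<K)
    go (inj₂ refl) = subst (λ t → abs (Ψ (suc e)) ∣ abs (Φ m e) ℕ.* t) (sym (factorAt-yes m e div)) (n∣m*n (abs (Φ m e)))

  module _ (p m : ℕ) (pr : Prime p) (e : n ≡ m ℕ.* p) where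
    1≤p∸1 : 1 ≤ p ∸ 1
    1≤p∸1 = ℕₚ.∸-monoˡ-≤ 1 (prime≥2 pr)

    product∣ : abs (F m) ℕ.* abs (F m) ℕ.* W ∣ p ^ (d + d)
    product∣ = subst (abs (F m) ℕ.* abs (F m) ℕ.* W ∣_)
      (trans (proj₁ (norm-powers p m pr e)) (sym (ℕₚ.^-distribˡ-+-* p d d)))
      (∣^ (abs (F m) ℕ.* abs (F m) ℕ.* W) (p ∸ 1) 1≤p∸1)

    W∣ : W ∣ p ^ (d + d)
    W∣ = ∣-trans (n∣m*n (abs (F m) ℕ.* abs (F m))) product∣

    -- For e dividing n/p, Ψ_e divides F_(n/p), whose norm divides a power of p. Two different such
    -- primes will force the norm of Ψ_e to be ±1.
    abs-Ψ∣ : ∀ K → suc K ∣ m → suc K ≤ N → abs (Ψ (suc K)) ∣ p ^ (d + d)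
    abs-Ψ∣ K div K<N = ∣-trans (abs-Ψ∣abs-Φ m K N div K<N)
      (subst (_∣ p ^ (d + d)) (abs-cong (F≋Φ m (proj₁ bounds) (proj₂ bounds)))
        (∣-trans (m∣m*n (abs (F m))) (∣-trans (m∣m*n W) product∣)))
      where bounds = quotient-bounds m p pr e

  module PrimePower (p a : ℕ) (pr : Prime p) (e : n ≡ p ^ suc a) where

    m : ℕ
    m = p ^ a

    n≡m*p : n ≡ m ℕ.* p
    n≡m*p = trans e (ℕₚ.*-comm p m)

    bounds : 1 ≤ m × m ≤ N
    bounds = quotient-bounds m p pr n≡m*p

    proper-divisor : ∀ K → suc K ≤ N → suc K ∣ n → suc K ∣ m
    proper-divisor K K<N div = from-power (divisor-of-prime-power pr (suc a) (suc K) (subst (suc K ∣_) e div))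
      where
      from-power : ∃[ b ] b ≤ suc a × suc K ≡ p ^ b → suc K ∣ m
      from-power (b , b≤ , eb) with ℕₚ.m≤n⇒m<n∨m≡n b≤
      ... | inj₁ (s≤s b≤a) = subst₂ _∣_ (sym eb) (trans (sym (ℕₚ.^-distribˡ-+-* p b (a ∸ b))) (cong (p ^_) (ℕₚ.m+[n∸m]≡n b≤a))) (m∣m*n (p ^ (a ∸ b)))
      ... | inj₂ refl = ⊥-elim (ℕₚ.<⇒≢ (s≤s K<N) (trans eb (sym e)))

    Φ-same : ∀ K → K ≤ N → Φ n K ≋ Φ m K
    Φ-same zero    _   = ≋-refl
    Φ-same (suc K) K<N = by-cases (suc K ∣? n)
      where
      m∣n : m ∣ n
      m∣n = divides p e
      by-cases : Dec (suc K ∣ n) → Φ n (suc K) ≋ Φ m (suc K)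
      by-cases (yes dn) = ≋-trans (Φ-yes n K dn) (≋-trans (*-congʳ {Ψ (suc K)} (Φ-same K (ℕₚ.<⇒≤ K<N))) (≋-sym (Φ-yes m K (proper-divisor K K<N dn))))
      by-cases (no ¬dn) = ≋-trans (Φ-no n K ¬dn) (≋-trans (Φ-same K (ℕₚ.<⇒≤ K<N)) (≋-sym (Φ-no m K (λ dm → ¬dn (∣-trans dm m∣n)))))

    -- The proper divisors of p^(a+1) are exactly the divisors of p^a, so the cofactor T is F_m
    -- itself.
    Φ≋F : Φ n N ≋ F m
    Φ≋F = ≋-trans (Φ-same N ℕₚ.≤-refl) (≋-sym (F≋Φ m (proj₁ bounds) (proj₂ bounds)))

    Monic-unique : ∀ {q a b} → Monic q a → Monic q b → a ≡ b
    Monic-unique {q} {a} {b} (ta , ba) (tb , bb) with ℕₚ.<-cmp a b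
    ... | tri< l _ _ = ⊥-elim (1≢0 (trans (sym tb) (ba b l)))
    ... | tri≈ _ r _ = r
    ... | tri> _ _ l = ⊥-elim (1≢0 (trans (sym ta) (bb a l)))

    -- Comparing degrees in F_n = F_m ψ yields φ(p^(a+1)) = p^(a+1) - p^a without counting residues.
    degree-sum : ∀ m → 1 ≤ m → Φ n N ≋ F m → n ≡ m + d
    degree-sum (suc m′) _ eF = cong suc (Monic-unique {F n} (F-monic N)
      (Monic-cong {F (suc m′) * ψ} (≋-sym (≋-trans (F-factor N) (*-congʳ {ψ} eF))) (Monic-* (F (suc m′)) ψ m′ d (F-monic m′) monic)))

    k : ℕ
    k = p ∸ 1

    suc-k : suc k ≡ p
    suc-k = ℕₚ.m+[n∸m]≡n (ℕₚ.<⇒≤ (prime≥2 pr))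

    d≡ : d ≡ m ℕ.* k
    d≡ = ℕₚ.+-cancelˡ-≡ m d (m ℕ.* k) (trans (sym (degree-sum m (proj₁ bounds) Φ≋F))
      (trans n≡m*p (trans (cong (m ℕ.*_) (sym suc-k)) (ℕₚ.*-suc m k))))

    1≤k : 1 ≤ k
    1≤k = 1≤p∸1 p m pr n≡m*p

    p^d : p ^ d ℕ.* p ^ d ≡ (p ℕ.* p) ^ (m ℕ.* k)
    p^d = trans (sym (^-distribʳ-* d p p)) (cong ((p ℕ.* p) ^_) d≡)

    W≡ : W ≡ p ℕ.* p
    W≡ = ^-injectiveˡ (m ℕ.* k) W (p ℕ.* p) (ℕₚ.*-mono-≤ (proj₁ bounds) 1≤k)
      (trans (proj₂ (norm-powers p m pr n≡m*p) a refl) p^d)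

    c : ℕ
    c = abs (F m)

    -- Taking the (p - 1)-th root of the norm relation for q^m - 1 gives c² W = p^(2m), and W = p².
    c*p : c ℕ.* p ≡ p ^ m
    c*p = square-injective (c ℕ.* p) (p ^ m) (begin
      c ℕ.* p ℕ.* (c ℕ.* p)      ≡⟨ ℕ-Solver.solve 2 (λ c p → c S.:* p S.:* (c S.:* p) S.:= c S.:* c S.:* (p S.:* p)) refl c p ⟩
      c ℕ.* c ℕ.* (p ℕ.* p)      ≡⟨ cong (c ℕ.* c ℕ.*_) (sym W≡) ⟩
      c ℕ.* c ℕ.* W              ≡⟨ ^-injectiveˡ k (c ℕ.* c ℕ.* W) ((p ℕ.* p) ^ m) 1≤k
                                      (trans (proj₁ (norm-powers p m pr n≡m*p)) (trans p^d (sym (ℕₚ.^-*-assoc (p ℕ.* p) m k)))) ⟩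
      (p ℕ.* p) ^ m              ≡⟨ ^-distribʳ-* m p p ⟩
      p ^ m ℕ.* p ^ m            ∎)
      where
      open ≡-Reasoning
      module S = ℕ-Solver

    -- The exponent p^a + 1 combines the norm p^(m-1) of T with the norm p² of w, in absolute value.
    prime-power-norm : p ^ (p ^ a + 1) ℕ.* abs (deriv ψ) ≡ (2 ℕ.* n) ^ d
    prime-power-norm = begin
      p ^ (m + 1) ℕ.* D                 ≡⟨ cong (ℕ._* D) (trans (ℕₚ.^-distribˡ-+-* p m 1) (cong₂ ℕ._*_ (sym c*p) (ℕₚ.^-identityʳ p))) ⟩
      c ℕ.* p ℕ.* p ℕ.* D               ≡⟨ ℕ-Solver.solve 3 (λ c p D → c S.:* p S.:* p S.:* D S.:= p S.:* p S.:* D S.:* c) refl c p D ⟩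
      p ℕ.* p ℕ.* D ℕ.* c               ≡⟨ cong₂ (λ s t → s ℕ.* D ℕ.* t) (sym W≡) (abs-cong (≋-sym Φ≋F)) ⟩
      W ℕ.* D ℕ.* abs (Φ n N)           ≡⟨ norm-deriv ⟩
      (2 ℕ.* n) ^ d                     ∎
      where
      open ≡-Reasoning
      module S = ℕ-Solver
      D = abs (deriv ψ)

  module NotPrimePower (npp : ¬ IsPrimePower n) where

    P? : ∀ p → Dec (Prime p × p ∣ n)
    P? p = prime? p ×-dec (p ∣? n)

    open RangeProducts P?

    quot : ℕ → ℕ
    quot = divBy n

    quot-* : ∀ p → Prime p × p ∣ n → n ≡ quot p ℕ.* p
    quot-* p (pr , div) = sym (divBy-* n p pr div)

    W≡1 : W ≡ 1
    W≡1 = from (two-primes n (s≤s (s≤s z≤n)) npp)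
      where
      from : ∃[ p ] ∃[ q ] Prime p × Prime q × p ≢ q × p ∣ n × q ∣ n → W ≡ 1
      from (p , q , pp , pq , p≢q , p∣n , q∣n) = coprime-powers pp pq p≢q (d + d) (d + d) W
        (W∣ p (quot p) pp (quot-* p (pp , p∣n))) (W∣ q (quot q) pq (quot-* q (pq , q∣n)))

    -- Since W = 1, the norm c satisfies c^(p-1) = p^d, so c = p^b with b (p - 1) = d. This also
    -- shows that p - 1 divides φ(n) and the division in the exponent is exact.
    abs-F-quot : ∀ p → Prime p × p ∣ n → abs (F (quot p)) ≡ p ^ divBy d (p ∸ 1)
    abs-F-quot p Pp@(pr , p∣n) = from-power (divisor-of-prime-power pr d c (subst (c ∣_) c^k (∣^ c (p ∸ 1) 1≤k)))
      where
      open ≡-Reasoning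
      c = abs (F (quot p))
      1≤k = 1≤p∸1 p (quot p) pr (quot-* p Pp)
      c^k : c ^ (p ∸ 1) ≡ p ^ d
      c^k = square-injective (c ^ (p ∸ 1)) (p ^ d) (begin
        c ^ (p ∸ 1) ℕ.* c ^ (p ∸ 1)          ≡⟨ ^-distribʳ-* (p ∸ 1) c c ⟨
        (c ℕ.* c) ^ (p ∸ 1)                  ≡⟨ cong (_^ (p ∸ 1)) (trans (cong (c ℕ.* c ℕ.*_) W≡1) (ℕₚ.*-identityʳ (c ℕ.* c))) ⟨
        (c ℕ.* c ℕ.* W) ^ (p ∸ 1)            ≡⟨ proj₁ (norm-powers p (quot p) pr (quot-* p Pp)) ⟩
        p ^ d ℕ.* p ^ d                      ∎)
      from-power : ∃[ b ] b ≤ d × c ≡ p ^ b → c ≡ p ^ divBy d (p ∸ 1)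
      from-power (b , _ , eb) = trans eb (cong (p ^_) (sym (trans (cong (λ t → divBy t (p ∸ 1)) (sym b*k)) (divBy-quotient b (p ∸ 1) 1≤k))))
        where
        b*k : b ℕ.* (p ∸ 1) ≡ d
        b*k = ^-injectiveʳ p (b ℕ.* (p ∸ 1)) d (prime≥2 pr) (trans (sym (ℕₚ.^-*-assoc p b (p ∸ 1))) (trans (cong (_^ (p ∸ 1)) (sym eb)) c^k))

    prime-cofactor : ∀ K → suc K ∣ n → suc K ≤ N → ∃[ p ] (Prime p × p ∣ n) × suc K ∣ quot p
    prime-cofactor K (divides zero ()) K<N
    prime-cofactor K (divides (suc zero) e) K<N = ⊥-elim (ℕₚ.<⇒≢ (s≤s K<N) (trans (sym (ℕₚ.*-identityˡ (suc K))) (sym e)))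
    prime-cofactor K (divides f@(suc (suc _)) e) K<N = from (prime-divisor f (s≤s (s≤s z≤n)))
      where
      from : ∃[ p ] Prime p × p ∣ f → ∃[ p ] (Prime p × p ∣ n) × suc K ∣ quot p
      from (p , pr , divides g eg) = p , (pr , p∣n) , divides g (ℕₚ.*-cancelʳ-≡ (quot p) (g ℕ.* suc K) p {{prime⇒nonZero pr}}
        (trans (sym (quot-* p (pr , p∣n))) (trans e (trans (cong (ℕ._* suc K) eg) (swap g p (suc K))))))
        where
        swap : ∀ a b c → a ℕ.* b ℕ.* c ≡ a ℕ.* c ℕ.* b
        swap = ℕ-Solver.solve 3 (λ a b c → a ℕ-Solver.:* b ℕ-Solver.:* c ℕ-Solver.:= a ℕ-Solver.:* c ℕ-Solver.:* b) refl
        p∣n : p ∣ n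
        p∣n = ∣-trans (divides g eg) (divides (suc K) (trans e (ℕₚ.*-comm f (suc K))))

    -- If Ψ_(K+1) has norm ±1, both sides are 1. Otherwise K + 1 divides n/p for exactly one prime
    -- p, since two would make the norm ±1, and the factor occurs once on each side.
    factor-product : ∀ K → suc K ≤ N → factorAt n K ≡ rangeProduct (λ p → factorAt (quot p) K) n
    factor-product K K<N = by-cases (suc K ∣? n) (c ℕ.≟ 1)
      where
      c = abs (Ψ (suc K))
      by-cases : Dec (suc K ∣ n) → Dec (c ≡ 1) → factorAt n K ≡ rangeProduct (λ p → factorAt (quot p) K) n
      by-cases (no ¬div) _ = trans (factorAt-no n K ¬div) (sym (product-ones (λ p → factorAt (quot p) K) n
        (λ p Pp _ → factorAt-no (quot p) K (λ div → ¬div (∣-trans div (divides p (trans (quot-* p Pp) (ℕₚ.*-comm (quot p) p))))))))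
      by-cases (yes div) (yes c≡1) = trans (factorAt-yes n K div) (trans c≡1 (sym (product-ones (λ p → factorAt (quot p) K) n (λ p Pp _ → one p (suc K ∣? quot p)))))
        where
        one : ∀ p → Dec (suc K ∣ quot p) → factorAt (quot p) K ≡ 1
        one p (yes div) = trans (factorAt-yes (quot p) K div) c≡1
        one p (no ¬div) = factorAt-no (quot p) K ¬div
      by-cases (yes div) (no c≢1) = from (prime-cofactor K div K<N)
        where
        from : ∃[ p ] (Prime p × p ∣ n) × suc K ∣ quot p → factorAt n K ≡ rangeProduct (λ p → factorAt (quot p) K) n
        from (q , Pq , Kq) = trans (factorAt-yes n K div) (sym (trans
          (product-single (λ p → factorAt (quot p) K) n q Pq (ℕₚ.<⇒≤ (prime≥2 (proj₁ Pq))) (∣⇒≤ (proj₂ Pq)) others) (factorAt-yes (quot q) K Kq)))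
          where
          others : ∀ p → Prime p × p ∣ n → p ≢ q → factorAt (quot p) K ≡ 1
          others p Pp p≢q = factorAt-no (quot p) K (λ Kp → c≢1 (coprime-powers (proj₁ Pp) (proj₁ Pq) p≢q (d + d) (d + d) c
            (abs-Ψ∣ p (quot p) (proj₁ Pp) (quot-* p Pp) K Kp K<N) (abs-Ψ∣ q (quot q) (proj₁ Pq) (quot-* q Pq) K Kq K<N)))

    abs-Φ-product : ∀ K → K ≤ N → abs (Φ n K) ≡ rangeProduct (λ p → abs (Φ (quot p) K)) n
    abs-Φ-product zero    _   = trans (abs-Φ-zero n) (sym (product-ones (λ p → abs (Φ (quot p) 0)) n (λ p _ _ → abs-Φ-zero (quot p))))
    abs-Φ-product (suc K) K<N = begin
      abs (Φ n (suc K))                                            ≡⟨ abs-Φ-suc n K ⟩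
      abs (Φ n K) ℕ.* factorAt n K                                 ≡⟨ cong₂ ℕ._*_ (abs-Φ-product K (ℕₚ.<⇒≤ K<N)) (factor-product K K<N) ⟩
      rangeProduct (λ p → abs (Φ (quot p) K)) n ℕ.* rangeProduct (λ p → factorAt (quot p) K) n
        ≡⟨ product-* (λ p → abs (Φ (quot p) K)) (λ p → factorAt (quot p) K) n ⟨
      rangeProduct (λ p → abs (Φ (quot p) K) ℕ.* factorAt (quot p) K) n
        ≡⟨ product-cong _ (λ p → abs (Φ (quot p) (suc K))) n (λ p _ _ → sym (abs-Φ-suc (quot p) K)) ⟩
      rangeProduct (λ p → abs (Φ (quot p) (suc K))) n              ∎
      where open ≡-Reasoning

    other-norm : prodℕ (map (λ p → p ^ divBy d (p ∸ 1)) (primeDivisors n)) ℕ.* abs (deriv ψ) ≡ (2 ℕ.* n) ^ d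
    other-norm = begin
      rangeProduct (λ p → p ^ divBy d (p ∸ 1)) n ℕ.* D            ≡⟨ cong (ℕ._* D) (product-cong _ _ n (λ p Pp _ → same p Pp)) ⟩
      rangeProduct (λ p → abs (Φ (quot p) N)) n ℕ.* D             ≡⟨ cong (ℕ._* D) (abs-Φ-product N ℕₚ.≤-refl) ⟨
      abs (Φ n N) ℕ.* D                                           ≡⟨ trans (ℕₚ.*-comm (abs (Φ n N)) D) (cong (ℕ._* abs (Φ n N)) (sym (ℕₚ.*-identityˡ D))) ⟩
      1 ℕ.* D ℕ.* abs (Φ n N)                                     ≡⟨ cong (λ t → t ℕ.* D ℕ.* abs (Φ n N)) W≡1 ⟨
      W ℕ.* D ℕ.* abs (Φ n N)                                     ≡⟨ norm-deriv ⟩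
      (2 ℕ.* n) ^ d                                               ∎
      where
      open ≡-Reasoning
      D = abs (deriv ψ)
      same : ∀ p → Prime p × p ∣ n → p ^ divBy d (p ∸ 1) ≡ abs (Φ (quot p) N)
      same p Pp = trans (sym (abs-F-quot p Pp)) (abs-cong (F≋Φ (quot p) (proj₁ bounds) (proj₂ bounds)))
        where bounds = quotient-bounds (quot p) p (proj₁ Pp) (quot-* p Pp)

-- The discriminant formula

module Discriminant (Ψ : ℕ → ℤ[X]) (fibotomic : IsFibotomic Ψ) (N₀ : ℕ) where
  open import Data.Nat.DivMod using (m*n/n≡m)
  open Zx using (coeff; const; monomial; deriv; pow)
  open PolynomialRing
  open Monomials
  open Reflection
  open SignAndOrder
  open NormsOfFactors Ψ fibotomic N₀ using (N; n; d; ψ; monic; abs; module PrimePower; module NotPrimePower)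
  open CommutativeRing ℤ[x] using (_*_; *-congˡ; *-congʳ; *-assoc)
    renaming (sym to ≋-sym; trans to ≋-trans; reflexive to ≋-reflexive)

  1≤d : 1 ≤ d
  1≤d = subst (1 ≤_) (sym (TotientSum.φ-sum1 n)) (includes-1 N)
    where
    open TotientSum using (sum1; [_]; []-yes)
    includes-1 : ∀ K → 1 ≤ sum1 (suc K) (λ s → [ coprime? s n ])
    includes-1 zero    = ℕₚ.≤-trans (ℕₚ.≤-reflexive (sym ([]-yes (coprime? 1 n) (1-coprimeTo n)))) (ℕₚ.m≤m+n [ coprime? 1 n ] 0)
    includes-1 (suc K) = ℕₚ.≤-trans (includes-1 K) (ℕₚ.m≤n+m _ [ coprime? (suc (suc K)) n ])

  order-0-positive : ∀ {p} → Order 0 p → 0ℤ ℤ.< coeff p 0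
  order-0-positive {p} (p′ , e , pos) = subst (0ℤ ℤ.<_) (sym (trans (at e 0) (coeff-*-identityˡ p′ 0))) pos

  -- The degree is a variable here so that its equation with `suc m * 2` can be matched, which φ(n)
  -- does not permit.
  norm-deriv-nonneg-at : ∀ p d m → (monic : Monic p d) → d ≡ suc m ℕ.* 2 → Even p → 0ℤ ℤ.< coeff p 0 →
    0ℤ ℤ.≤ Norm.norm p d monic (deriv p)
  norm-deriv-nonneg-at p _ m monic refl even pos = NormOfEven.norm-deriv-nonneg p m monic even (ℤₚ.<⇒≤ pos)

  -- The leading coefficient 1 of an even polynomial cannot stand at an odd index.
  even-degree : ∀ p d → Monic p d → Even p → 1 ≤ d → ∃[ m ] d ≡ suc m ℕ.* 2
  even-degree p d monic even 1≤d with parity d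
  ... | suc m , inj₁ e = m , e
  ... | zero , inj₁ e = ⊥-elim (ℕₚ.<⇒≢ 1≤d (sym e))
  ... | j , inj₂ refl = ⊥-elim (1≢0 (trans (sym (proj₁ monic)) (Even-odd-coeff p even j)))

  pow≡^ : ∀ i k → pow i k ≡ i ℤ.^ k
  pow≡^ i zero    = refl
  pow≡^ i (suc k) = cong (i ℤ.*_) (pow≡^ i k)

  -- For d = 2j the exponent d(d - 1)/2 is j + 2j(j - 1), which has the parity of j = d/2.
  discriminant-sign : ∀ d m → d ≡ suc m ℕ.* 2 → pow -1ℤ ((d ℕ.* (d ∸ 1)) / 2) ≡ -1ℤ ℤ.^ (d / 2)
  discriminant-sign _ m refl = begin
    pow -1ℤ ((j ℕ.* 2 ℕ.* e) / 2)            ≡⟨ cong (λ t → pow -1ℤ (t / 2)) (ℕ-Solver.solve 2 (λ j m → j S.:* S.con 2 S.:* (S.con 1 S.:+ m S.:* S.con 2) S.:= (j S.:+ j S.:* m S.:* S.con 2) S.:* S.con 2) refl j m) ⟩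
    pow -1ℤ (((j + j ℕ.* m ℕ.* 2) ℕ.* 2) / 2) ≡⟨ cong (pow -1ℤ) (m*n/n≡m (j + j ℕ.* m ℕ.* 2) 2) ⟩
    pow -1ℤ (j + j ℕ.* m ℕ.* 2)              ≡⟨ pow≡^ -1ℤ (j + j ℕ.* m ℕ.* 2) ⟩
    -1ℤ ℤ.^ (j + j ℕ.* m ℕ.* 2)              ≡⟨ ℤₚ.^-distribˡ-+-* -1ℤ j (j ℕ.* m ℕ.* 2) ⟩
    -1ℤ ℤ.^ j ℤ.* -1ℤ ℤ.^ (j ℕ.* m ℕ.* 2)    ≡⟨ cong (-1ℤ ℤ.^ j ℤ.*_) (even-power (j ℕ.* m)) ⟩
    -1ℤ ℤ.^ j ℤ.* 1ℤ                         ≡⟨ ℤₚ.*-identityʳ (-1ℤ ℤ.^ j) ⟩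
    -1ℤ ℤ.^ j                                ≡⟨ cong (-1ℤ ℤ.^_) (m*n/n≡m j 2) ⟨
    -1ℤ ℤ.^ ((j ℕ.* 2) / 2)                  ∎
    where
    open ≡-Reasoning
    module S = ℕ-Solver
    j = suc m
    e = suc (m ℕ.* 2)
    even-power : ∀ k → -1ℤ ℤ.^ (k ℕ.* 2) ≡ 1ℤ
    even-power zero    = refl
    even-power (suc k) = cong (λ t → -1ℤ ℤ.* (-1ℤ ℤ.* t)) (even-power k)

  ν : ℤ
  ν = Norm.norm ψ d monic (deriv ψ)

  -- Kept as a hypothesis of the formula because n = 2, where ψ is odd, has to be treated apart from
  -- n ≥ 3.
  SignCondition : Set
  SignCondition = 0ℤ ℤ.≤ ν × pow -1ℤ ((d ℕ.* (d ∸ 1)) / 2) ≡ -1ℤ ℤ.^ (d / 2)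

  Δ : ℤ[X]
  Δ = monomial (pow -1ℤ ((d ℕ.* (d ∸ 1)) / 2) ℤ.* ν) (d ℕ.* (d ∸ 1))

  isDiscriminant : Zyx.IsDiscriminant (homogenize d ψ) d Δ
  isDiscriminant = Homogenization.homogenized-discriminant ψ d 1≤d monic

  module _ (sign : SignCondition) where

    multiple-of-Δ : ∀ K → K ℕ.* abs (deriv ψ) ≡ (2 ℕ.* n) ^ d → Zx._≈ₚ_ (Zx._*ₚ_ (const (ι K)) Δ) (numerator (d / 2) n)
    multiple-of-Δ K e = at (≋-trans (*-congˡ {const (ι K)} (monomial-const (s ℤ.* ν) E)) (≋-trans (≋-sym (*-assoc (const (ι K)) (const (s ℤ.* ν)) (xpow E)))
      (≋-trans (*-congʳ {xpow E} (≋-trans (const-·-* (ι K) (s ℤ.* ν)) (≋-reflexive (cong const scalar)))) (≋-sym (monomial-const _ E)))))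
      where
      open Homogenization using (monomial-const; const-·-*)
      open ≡-Reasoning
      s = pow -1ℤ ((d ℕ.* (d ∸ 1)) / 2)
      E = d ℕ.* (d ∸ 1)
      pos-^ : ∀ a k → ι (a ^ k) ≡ ι a ℤ.^ k
      pos-^ a zero    = refl
      pos-^ a (suc k) = trans (ℤₚ.pos-* a (a ^ k)) (cong (ι a ℤ.*_) (pos-^ a k))
      scalar : ι K ℤ.* (s ℤ.* ν) ≡ -1ℤ ℤ.^ (d / 2) ℤ.* ι (2 ℕ.* n) ℤ.^ d
      scalar = begin
        ι K ℤ.* (s ℤ.* ν)                           ≡⟨ cong₂ (λ s t → ι K ℤ.* (s ℤ.* t)) (proj₂ sign) (sym (ℤₚ.0≤i⇒+∣i∣≡i (proj₁ sign))) ⟩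
        ι K ℤ.* (σ ℤ.* ι (abs (deriv ψ)))           ≡⟨ ℤₚ.*-assoc (ι K) σ (ι (abs (deriv ψ))) ⟨
        ι K ℤ.* σ ℤ.* ι (abs (deriv ψ))             ≡⟨ cong (ℤ._* ι (abs (deriv ψ))) (ℤₚ.*-comm (ι K) σ) ⟩
        σ ℤ.* ι K ℤ.* ι (abs (deriv ψ))             ≡⟨ ℤₚ.*-assoc σ (ι K) (ι (abs (deriv ψ))) ⟩
        σ ℤ.* (ι K ℤ.* ι (abs (deriv ψ)))           ≡⟨ cong (σ ℤ.*_) (ℤₚ.pos-* K (abs (deriv ψ))) ⟨
        σ ℤ.* ι (K ℕ.* abs (deriv ψ))               ≡⟨ cong (λ t → σ ℤ.* ι t) e ⟩
        σ ℤ.* ι ((2 ℕ.* n) ^ d)                     ≡⟨ cong (σ ℤ.*_) (pos-^ (2 ℕ.* n) d) ⟩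
        σ ℤ.* ι (2 ℕ.* n) ℤ.^ d                     ∎
        where σ = -1ℤ ℤ.^ (d / 2)

    formula : Σ Zx.Poly (λ Δ →
      Zyx.IsDiscriminant (homogenize (φ n) (Ψ n)) (φ n) Δ ×
      ((∀ p α → Prime p → 1 ≤ α → n ≡ p ^ α →
          Zx._≈ₚ_ (Zx._*ₚ_ (Zx.const (ι (p ^ (p ^ (α ∸ 1) + 1)))) Δ) (numerator (φ n / 2) n)) ×
       (¬ IsPrimePower n →
          Zx._≈ₚ_ (Zx._*ₚ_ (Zx.const (ι (prodℕ (map (λ p → p ^ divBy (φ n) (p ∸ 1)) (primeDivisors n))))) Δ)
                  (numerator (φ n / 2) n))))
    formula = Δ , isDiscriminant ,
      (λ { p (suc a) pr _ e → multiple-of-Δ (p ^ (p ^ a + 1)) (PrimePower.prime-power-norm p a pr e) }) ,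
      (λ npp → multiple-of-Δ (prodℕ (map (λ p → p ^ divBy d (p ∸ 1)) (primeDivisors n))) (NotPrimePower.other-norm npp))

module _ (Ψ : ℕ → ℤ[X]) (fibotomic : IsFibotomic Ψ) where
  open Zx using (coeff; oneₚ; deriv)
  open PolynomialRing
  open Reflection
  open SignAndOrder
  open DivisorProducts Ψ fibotomic

  sign-condition : ∀ N₀ → Discriminant.SignCondition Ψ fibotomic N₀
  -- Here n = 2: ψ = x has derivative 1, and as φ(2) = 1 both exponents of -1 are 0.
  sign-condition zero = subst (0ℤ ℤ.≤_) (sym ν≡1) (ℤ.+≤+ z≤n) , refl
    where
    open NormsOfFactors Ψ fibotomic zero using (ψ; d; monic)
    open Norm ψ d monic using (norm; norm-cong)
    ν≡1 : norm (deriv ψ) ≡ 1ℤ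
    ν≡1 = trans (norm-cong {deriv ψ} {oneₚ} (DerivativeRules.deriv-cong Ψ-2)) (NormOfFibonacci.norm-1 ψ d monic)
  sign-condition (suc N₀) = norm-deriv-nonneg-at ψ d (proj₁ half-degree) monic (proj₂ half-degree) even positive ,
    discriminant-sign d (proj₁ half-degree) (proj₂ half-degree)
    where
    open Discriminant Ψ fibotomic (suc N₀) using (order-0-positive; norm-deriv-nonneg-at; even-degree; discriminant-sign; 1≤d)
    open NormsOfFactors Ψ fibotomic (suc N₀) using (ψ; d; monic; ψ-facts)
    positive : 0ℤ ℤ.< coeff ψ 0
    positive = order-0-positive (Facts.Ψ-order ψ-facts)
    even : Even ψ
    even = EvenOrOdd⇒Even (Facts.Ψ-evenOrOdd ψ-facts) positive
    half-degree : ∃[ m ] d ≡ suc m ℕ.* 2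
    half-degree = even-degree ψ d monic even 1≤d

theorem1p2 : (Ψ : ℕ → ℤ[X]) → IsFibotomic Ψ →
    (n : ℕ) → 2 ≤ n →
    Σ Zx.Poly (λ Δ →
    Zyx.IsDiscriminant (homogenize (φ n) (Ψ n)) (φ n) Δ ×
    ((∀ p α → Prime p → 1 ≤ α → n ≡ p ^ α →
    Zx._≈ₚ_ (Zx._*ₚ_ (Zx.const (ι (p ^ (p ^ (α ∸ 1) + 1)))) Δ)
    (numerator (φ n / 2) n)) ×
    (¬ IsPrimePower n →
    Zx._≈ₚ_ (Zx._*ₚ_ (Zx.const (ι (prodℕ (map (λ p → p ^ divBy (φ n) (p ∸ 1)) (primeDivisors n))))) Δ)
    (numerator (φ n / 2) n))))
theorem1p2 Ψ fibotomic (suc (suc N₀)) (s≤s (s≤s z≤n)) = Discriminant.formula Ψ fibotomic N₀ (sign-condition Ψ fibotomic N₀)
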